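{- There exists $n_0\in\mathbb{N}$ such that for every integer $n\ge n_0$ we have $R(P^t_n,\mathbb{F})=2n-1$.
   Context: All hypergraphs are $3$-uniform. For $3$-uniform hypergraphs $G,H$, the Ramsey number $R(G,H)$ is the least integer $N$ such that every red-blue colouring of the edges of the complete $3$-uniform hypergraph $K_N^{(3)}$ on $N$ vertices contains a red copy of $G$ or a blue copy of $H$. The Fano plane $\mathbb{F}$ is the unique $3$-uniform hypergraph with seven vertices and seven edges in which every pair of vertices is contained in exactly one edge. The tight path $P^t_n$ on $n$ vertices has distinct vertices $v_1,\dots,v_n$ and edges $e_1,\dots,e_{n-2}$ with $e_i=\{v_i,v_{i+1},v_{i+2}\}$. -}

module Defs where

open import Data.Nat using (ℕ; suc; _<_)
open import Data.Fin using (Fin; toℕ; #_)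
open import Data.Bool using (Bool; true; false)
open import Data.Product using (Σ; _×_)
open import Data.Sum using (_⊎_)
open import Relation.Binary.PropositionalEquality using (_≡_)
open import Relation.Nullary using (¬_)
open import Function.Definitions using (Injective)

-- A red/blue colouring of the edges of the complete 3-uniform hypergraph
-- on vertex set Fin N.  An edge {x,y,z} (x,y,z distinct) gets colour
-- col x y z; the symmetry laws make this independent of the ordering
-- (values on non-distinct triples are irrelevant).  true = red, false = blue.
record Colouring (N : ℕ) : Set where
  field
    col   : Fin N → Fin N → Fin N → Bool
    sym₁₂ : ∀ x y z → col x y z ≡ col y x z
    sym₂₃ : ∀ x y z → col x y z ≡ col x z y
open Colouring public

red blue : Bool
red = true
blue = false

TightPathCopy : {N : ℕ} → Colouring N → Bool → ℕ → Set
TightPathCopy {N} c b n =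
  Σ (Fin n → Fin N) λ v → Injective _≡_ _≡_ v ×
    (∀ (i j k : Fin n) → toℕ j ≡ suc (toℕ i) → toℕ k ≡ suc (toℕ j) →
       col c (v i) (v j) (v k) ≡ b)

data FanoEdge : Fin 7 → Fin 7 → Fin 7 → Set where
  e₁ : FanoEdge (# 0) (# 1) (# 2)
  e₂ : FanoEdge (# 0) (# 3) (# 4)
  e₃ : FanoEdge (# 0) (# 5) (# 6)
  e₄ : FanoEdge (# 1) (# 3) (# 5)
  e₅ : FanoEdge (# 1) (# 4) (# 6)
  e₆ : FanoEdge (# 2) (# 3) (# 6)
  e₇ : FanoEdge (# 2) (# 4) (# 5)

FanoCopy : {N : ℕ} → Colouring N → Bool → Set
FanoCopy {N} c b =
  Σ (Fin 7 → Fin N) λ f → Injective _≡_ _≡_ f ×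
    (∀ x y z → FanoEdge x y z → col c (f x) (f y) (f z) ≡ b)

Arrows : ℕ → ℕ → Set
Arrows n N = (c : Colouring N) → TightPathCopy c red n ⊎ FanoCopy c blue

RamseyPathFano≡ : ℕ → ℕ → Set
RamseyPathFano≡ n N = Arrows n N × (∀ M → M < N → ¬ Arrows n M)

-- Fix a colouring with neither copy and cover the vertices by red tight paths whose ends run through red
-- cliques of constant size.  Call two cliques adjacent if one red tight path traverses both; then the two
-- paths ending in them can be merged.  After homogenising, a clique U "misses" W if all edges UUW are blue,
-- and of two non-adjacent cliques one misses the other.  If U misses W and W′, then W ∪ W′ is a red clique,
-- since a blue edge xyz and the three perfect matchings of a 4-subset of U would form a Fano plane.  So every
-- clique misses at most one other, there are no four pairwise non-adjacent cliques, and three of them form a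
-- cyclic pattern: E₁E₁E₂, E₂E₂E₃, E₃E₃E₁ red and E₁E₂E₂, E₂E₃E₃, E₃E₁E₁ blue.
--
-- Consider the largest r ≤ 3 for which there are r pairwise non-adjacent cliques that are huge compared with
-- the cliques used to build the paths.
-- * r = 1: all paths merge into one, which misses only boundedly many vertices.
-- * r = 2, or r = 3 and some vertex v joins E₁ to E₂ in a red tight path (a "connector"): the paths merge into
--   two, containing long stretches of E₁ and E₂.  Each remaining vertex has a red K₄ in its link on E₁ or on
--   E₂ and is inserted there.  The two paths partition the 2n − 1 vertices, so one of them has n vertices.
-- * r = 3 without connectors: the vertices split exactly into red cliques X, Y, Z for which all edges
--   XXY, YYZ, ZZX are red, any other pattern giving a Fano plane.  A path y x x y x x … uses up X together with
--   half as many vertices of Y (or all of Y), and one of the three such paths has n vertices.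
--
-- For the lower bound, split 2n − 2 vertices into halves and colour an edge red iff it lies in one half.
module Submission where

open import Defs
open import Data.Nat using (ℕ; _≤_; _*_; _∸_)
open import Data.Product using (Σ)
open import Data.Bool as Bool using (Bool; true; false)
open import Data.Bool.Properties using () renaming (_≟_ to _≟ᵇ_)
open import Data.Empty using (⊥; ⊥-elim)
open import Data.Fin using (Fin; zero; suc; toℕ; fromℕ<; #_)
import Data.Fin.Properties as FinP
open import Data.List using (List; []; _∷_; _++_; length; take; drop; concat; map; reverse; lookup; tabulate; allFin)
open import Data.List.Properties using (length-++; take++drop≡id; length-take; length-map; length-tabulate; ++-assoc; reverse-++; reverse-involutive)
open import Data.List.Membership.Propositional using (_∈_; _∉_)
open import Data.List.Membership.Propositional.Properties using (∈-∃++; ∈-++⁺ˡ; ∈-++⁺ʳ; ∈-++⁻; ∈-lookup; ∈-allFin)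
import Data.List.Membership.DecPropositional as DecMem
open import Data.List.Relation.Unary.Any using (here; there)
open import Data.List.Relation.Unary.All as All using (All; []; _∷_)
import Data.List.Relation.Unary.All.Properties as AllP
open import Data.List.Relation.Unary.AllPairs as Pairs using (AllPairs; []; _∷_)
import Data.List.Relation.Unary.AllPairs.Properties as PairsP
open import Data.List.Relation.Unary.Unique.Propositional using (Unique)
import Data.List.Relation.Unary.Unique.Propositional.Properties as Uniq
open import Data.List.Relation.Binary.Permutation.Propositional using (_↭_; ↭-refl; ↭-sym; ↭-trans; prep; swap; ↭-reflexive; ↭⇒↭ₛ)
import Data.List.Relation.Binary.Permutation.Propositional.Properties as Perm
import Data.List.Relation.Binary.Permutation.Setoid.Properties as PermS
open import Data.Nat using (zero; suc; _+_; _<_; _<ᵇ_; z≤n; s≤s)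
open import Data.Nat.Properties
open import Data.Product using (∃; ∃₂; _×_; _,_; proj₁; proj₂)
open import Data.Sum using (_⊎_; inj₁; inj₂; [_,_])
open import Data.Unit using (⊤; tt)
open import Relation.Binary.PropositionalEquality using (_≡_; _≢_; refl; sym; trans; cong; cong₂; subst; setoid)
open import Relation.Nullary using (¬_; Dec; yes; no)
open import Relation.Nullary.Decidable using (map′; _×-dec_; ¬?)

-- Sublists up to permutation

infix 4 _≼_

-- The remainder is part of the witness, so that the vertices outside `S` stay available to
-- partitions of the vertex set.
_≼_ : {A : Set} → List A → List A → Set
S ≼ xs = ∃ λ rest → xs ↭ S ++ rest

Dis : {A : Set} → List A → List A → Set
Dis X Y = ∀ {v} → v ∈ X → v ∈ Y → ⊥

module _ {A : Set} where

  open import Algebra.Solver.CommutativeMonoid (Perm.++-commutativeMonoid {A = A}) public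
    using (solve; _⊕_; _⊜_; id)

  ≼-refl : {xs : List A} → xs ≼ xs
  ≼-refl {xs} = [] , ↭-sym (Perm.++-identityʳ xs)

  ↭⇒≼ : {xs ys : List A} → xs ↭ ys → ys ≼ xs
  ↭⇒≼ p = [] , ↭-trans p (↭-sym (Perm.++-identityʳ _))

  ≼-trans : {S T U : List A} → S ≼ T → T ≼ U → S ≼ U
  ≼-trans {S} (r , p) (r′ , q) =
    r ++ r′ , ↭-trans q (↭-trans (Perm.++⁺ʳ r′ p) (Perm.++-assoc S r r′))

  ≼-⊆ : {S xs : List A} → S ≼ xs → ∀ {v} → v ∈ S → v ∈ xs
  ≼-⊆ (_ , p) v∈S = Perm.∈-resp-↭ (↭-sym p) (∈-++⁺ˡ v∈S)

  ≼-++ : {S X T Y : List A} → S ≼ X → T ≼ Y → S ++ T ≼ X ++ Y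
  ≼-++ {S} {_} {T} (r , p) (r′ , q) =
    r ++ r′ , ↭-trans (Perm.++⁺ p q)
      (solve 4 (λ s r t u → (s ⊕ r) ⊕ (t ⊕ u) ⊜ (s ⊕ t) ⊕ (r ⊕ u)) ↭-refl S r T r′)

  ≼-++ˡ : (X Y : List A) → X ≼ X ++ Y
  ≼-++ˡ X Y = Y , ↭-refl

  ≼-++ʳ : (X Y : List A) → Y ≼ X ++ Y
  ≼-++ʳ X Y = X , Perm.++-comm X Y

  ≼-∷ : (x : A) {S T : List A} → S ≼ T → x ∷ S ≼ x ∷ T
  ≼-∷ x (r , p) = r , prep x p

  ≼-there : (x : A) {S T : List A} → S ≼ T → S ≼ x ∷ T
  ≼-there x s = ≼-trans s (≼-++ʳ (x ∷ []) _)

  unique-↭ : {xs ys : List A} → xs ↭ ys → Unique xs → Unique ys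
  unique-↭ p = PermS.Unique-resp-↭ (setoid A) (↭⇒↭ₛ p)

  unique-++ˡ : (xs : List A) {ys : List A} → Unique (xs ++ ys) → Unique xs
  unique-++ˡ [] _ = []
  unique-++ˡ (x ∷ xs) (p ∷ u) =
    All.tabulate (λ v∈ → All.lookup p (∈-++⁺ˡ v∈)) ∷ unique-++ˡ xs u

  unique-++ʳ : (xs : List A) {ys : List A} → Unique (xs ++ ys) → Unique ys
  unique-++ʳ [] u = u
  unique-++ʳ (_ ∷ xs) (_ ∷ u) = unique-++ʳ xs u

  unique-dis : (xs : List A) {ys : List A} → Unique (xs ++ ys) → Dis xs ys
  unique-dis (x ∷ xs) (p ∷ u) (here refl) v∈ys = All.lookup p (∈-++⁺ʳ xs v∈ys) refl
  unique-dis (x ∷ xs) (p ∷ u) (there v∈) v∈ys = unique-dis xs u v∈ v∈ys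

  unique-++ : {xs ys : List A} → Unique xs → Unique ys → Dis xs ys → Unique (xs ++ ys)
  unique-++ u v d = Uniq.++⁺ u v (λ (p , q) → d p q)

  ≼-unique : {S xs : List A} → S ≼ xs → Unique xs → Unique S
  ≼-unique {S} (r , p) u = unique-++ˡ S (unique-↭ p u)

  unique-∷ : {x : A} {xs : List A} → x ∉ xs → Unique xs → Unique (x ∷ xs)
  unique-∷ n u = All.tabulate (λ { v∈ refl → n v∈ }) ∷ u

  ∉-unique : {x : A} {xs : List A} → Unique (x ∷ xs) → x ∉ xs
  ∉-unique (p ∷ _) x∈ = All.lookup p x∈ refl

  ∈⇒≼ : {x : A} {xs : List A} → x ∈ xs → ∃ λ r → xs ↭ x ∷ r
  ∈⇒≼ {x} x∈ with ys , zs , refl ← ∈-∃++ x∈ = ys ++ zs , Perm.shift x ys zs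

  -- Cuts a duplicate-free list out of a larger one. With `ys` = `allFin N` the remainder is the set
  -- of vertices still to be covered.
  unique-⊆⇒≼ : {xs ys : List A} → Unique xs → (∀ {v} → v ∈ xs → v ∈ ys) → xs ≼ ys
  unique-⊆⇒≼ {[]} {ys} _ _ = ys , ↭-refl
  unique-⊆⇒≼ {x ∷ xs} (p ∷ u) sub with r , q ← ∈⇒≼ (sub (here refl)) =
    let s , q′ = unique-⊆⇒≼ u (λ v∈ → tail (All.lookup p v∈) (Perm.∈-resp-↭ q (sub (there v∈))))
    in s , ↭-trans q (prep x q′)
    where
    tail : ∀ {v} → x ≢ v → v ∈ x ∷ r → v ∈ r
    tail x≢v (here refl) = ⊥-elim (x≢v refl)
    tail _ (there v∈) = v∈

  split : ∀ k (xs : List A) → k ≤ length xs → ∃₂ λ S T → xs ↭ S ++ T × length S ≡ k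
  split k xs le = take k xs , drop k xs , ↭-reflexive (sym (take++drop≡id k xs)) ,
    trans (length-take k xs) (m≤n⇒m⊓n≡m le)

  choose : ∀ k (xs : List A) → k ≤ length xs → ∃ λ S → S ≼ xs × length S ≡ k
  choose k xs le = let S , T , p , e = split k xs le in S , (T , p) , e

-- Splitting a list by two colours

+-≤-split : ∀ {a b} c d → a + b ≤ c + d → a ≤ c ⊎ b ≤ d
+-≤-split {a} {b} c d le with ≤-total a c
... | inj₁ p = inj₁ p
... | inj₂ c≤a with ≤-total b d
...   | inj₁ q = inj₂ q
...   | inj₂ d≤b with m≤n⇒m<n∨m≡n d≤b
...     | inj₂ refl = inj₂ ≤-refl
...     | inj₁ d<b = ⊥-elim (<-irrefl refl (<-≤-trans (+-mono-≤-< c≤a d<b) le))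

module _ {A : Set} {P : A → Bool → Set} where

  -- `P x b` reads "x has colour b". A relation is used because the colour may be that of a whole
  -- homogeneous set seen from `x`.
  splitByColour : (xs : List A) → All (λ x → ∃ (P x)) xs →
    ∃₂ λ S T → xs ↭ S ++ T × All (λ x → P x true) S × All (λ x → P x false) T
  splitByColour [] [] = [] , [] , ↭-refl , [] , []
  splitByColour (x ∷ xs) ((b , p) ∷ ps) with splitByColour xs ps
  splitByColour (x ∷ xs) ((true , p) ∷ ps) | S , T , q , s , t = x ∷ S , T , prep x q , p ∷ s , t
  splitByColour (x ∷ xs) ((false , p) ∷ ps) | S , T , q , s , t =
    S , x ∷ T , ↭-trans (prep x q) (↭-sym (Perm.shift x S T)) , s , p ∷ t

  pigeonhole : ∀ s (xs : List A) → s + s ≤ length xs → All (λ x → ∃ (P x)) xs →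
    ∃ λ b → ∃ λ S → S ≼ xs × length S ≡ s × All (λ x → P x b) S
  pigeonhole s xs le ps with splitByColour xs ps
  ... | S , T , q , p , p′
    with +-≤-split (length S) (length T) (≤-trans le (≤-reflexive (trans (Perm.↭-length q) (length-++ S))))
  ... | inj₁ s≤ = let U , U≼ , e = choose s S s≤ in
    true , U , ≼-trans U≼ (T , q) , e , All.tabulate (λ v∈ → All.lookup p (≼-⊆ U≼ v∈))
  ... | inj₂ s≤ = let U , U≼ , e = choose s T s≤ in
    false , U , ≼-trans U≼ (≼-trans (≼-++ʳ S T) (↭⇒≼ q)) , e , All.tabulate (λ v∈ → All.lookup p′ (≼-⊆ U≼ v∈))

-- Ramsey's theorem for graphs

pow : (ℕ → ℕ) → ℕ → ℕ → ℕ
pow f zero s = s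
pow f (suc k) s = f (pow f k s)

-- The elements of `qs` are treated one after the other. `P` is hereditary, so what holds for
-- earlier elements survives later shrinking, and the size needed is `f` iterated once per element.
restrictAll : {A B : Set} (P : A → List B → Set) →
  (∀ {q S T} → S ≼ T → P q T → P q S) → (f : ℕ → ℕ) →
  (∀ q s ys → f s ≤ length ys → ∃ λ S → S ≼ ys × length S ≡ s × P q S) →
  ∀ qs s ys → pow f (length qs) s ≤ length ys →
  ∃ λ S → S ≼ ys × length S ≡ s × All (λ q → P q S) qs
restrictAll P her f step [] s ys le = let S , S≼ , e = choose s ys le in S , S≼ , e , []
restrictAll P her f step (q ∷ qs) s ys le =
  let T , T≼ , e , p = step q (pow f (length qs) s) ys le
      S , S≼ , e′ , ps = restrictAll P her f step qs s T (≤-reflexive (sym e))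
  in S , ≼-trans S≼ T≼ , e′ , her S≼ p ∷ ps

Mono : {A : Set} → Bool → (A → A → Bool) → List A → Set
Mono b f S = ∀ {x y} → x ∈ S → y ∈ S → x ≢ y → f x y ≡ b

-- The recurrence of Erdős and Szekeres with one extra vertex: that vertex splits the others by the
-- colour of the edge to it.
R₂ : ℕ → ℕ → ℕ
R₂ zero _ = 0
R₂ (suc s) zero = 0
R₂ (suc s) (suc t) = suc (R₂ s (suc t) + R₂ (suc s) t)

module _ {A : Set} (f : A → A → Bool) (f-sym : ∀ x y → f x y ≡ f y x) where

  mono-∷ : ∀ {b x S} → All (λ y → f x y ≡ b) S → Mono b f S → Mono b f (x ∷ S)
  mono-∷ ps m (here refl) (here refl) x≢x = ⊥-elim (x≢x refl)
  mono-∷ ps m (here refl) (there y∈) _ = All.lookup ps y∈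
  mono-∷ ps m (there x∈) (here refl) _ = trans (f-sym _ _) (All.lookup ps x∈)
  mono-∷ ps m (there x∈) (there y∈) = m x∈ y∈

  opaque
    ramsey₂ : ∀ s t xs → R₂ s t ≤ length xs →
      (∃ λ S → S ≼ xs × length S ≡ s × Mono true f S) ⊎
      (∃ λ S → S ≼ xs × length S ≡ t × Mono false f S)
    ramsey₂ zero _ xs _ = inj₁ ([] , (xs , ↭-refl) , refl , λ ())
    ramsey₂ (suc s) zero xs _ = inj₂ ([] , (xs , ↭-refl) , refl , λ ())
    ramsey₂ (suc s) (suc t) (x ∷ xs) (s≤s le)
      with splitByColour {P = λ y b → f x y ≡ b} xs (All.tabulate (λ {y} _ → f x y , refl))
    ... | U , W , q , p , p′
      with +-≤-split (length U) (length W) (≤-trans le (≤-reflexive (trans (Perm.↭-length q) (length-++ U))))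
    ... | inj₁ le′ with ramsey₂ s (suc t) U le′
    ...   | inj₁ (S , S≼ , e , m) = inj₁ (x ∷ S , ≼-∷ x (≼-trans S≼ (W , q)) , cong suc e ,
              mono-∷ (All.tabulate (λ v∈ → All.lookup p (≼-⊆ S≼ v∈))) m)
    ...   | inj₂ (S , S≼ , e , m) = inj₂ (S , ≼-there x (≼-trans S≼ (W , q)) , e , m)
    ramsey₂ (suc s) (suc t) (x ∷ xs) (s≤s le) | U , W , q , p , p′ | inj₂ le′
      with ramsey₂ (suc s) t W le′
    ...   | inj₁ (S , S≼ , e , m) =
              inj₁ (S , ≼-there x (≼-trans S≼ (≼-trans (≼-++ʳ U W) (↭⇒≼ q))) , e , m)
    ...   | inj₂ (S , S≼ , e , m) =
              inj₂ (x ∷ S , ≼-∷ x (≼-trans S≼ (≼-trans (≼-++ʳ U W) (↭⇒≼ q))) , cong suc e ,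
              mono-∷ (All.tabulate (λ v∈ → All.lookup p′ (≼-⊆ S≼ v∈))) m)

opaque
  -- Opaque, so that this exponentially large size is never evaluated; `bip-bound` reveals the
  -- formula to the proofs that need it.
  bip : ℕ → ℕ
  bip s = (s + s) + pow (λ k → k + k) (s + s) (suc s)

  bip-bound : ∀ s {k} → bip s ≤ k → (s + s) + pow (λ k → k + k) (s + s) (suc s) ≤ k
  bip-bound s le = le

opaque
  -- For each of 2s points of `xs` in turn, `ys` is halved until the point sees it in one colour;
  -- then s of the points share their colour.
  bipartite : {A B : Set} (f : A → B → Bool) → ∀ s xs ys → bip s ≤ length xs → bip s ≤ length ys →
    ∃₂ λ S T → S ≼ xs × T ≼ ys × length S ≡ s × length T ≡ s × ∃ λ b → ∀ {x y} → x ∈ S → y ∈ T → f x y ≡ b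
  bipartite f s xs ys le le′ =
    let X , X≼ , eX = choose (s + s) xs (≤-trans (m≤m+n _ _) (bip-bound s le))
        T , T≼ , eT , ps = restrictAll (λ x T → ∃ λ b → All (λ y → f x y ≡ b) T)
          (λ S≼ (b , p) → b , All.tabulate (λ v∈ → All.lookup p (≼-⊆ S≼ v∈)))
          (λ k → k + k)
          (λ x k zs l → let b , S , S≼ , e , p = pigeonhole {P = λ y b → f x y ≡ b} k zs l (All.tabulate (λ {y} _ → f x y , refl))
                        in S , S≼ , e , b , p)
          X (suc s) ys (≤-trans (≤-reflexive (cong (λ k → pow (λ j → j + j) k (suc s)) eX)) (≤-trans (m≤n+m _ (s + s)) (bip-bound s le′)))
        b , S , S≼ , eS , p = pigeonhole {P = λ x b → All (λ y → f x y ≡ b) T} s X (≤-reflexive (sym eX)) ps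
        T′ , T′≼ , eT′ = choose s T (≤-trans (n≤1+n s) (≤-reflexive (sym eT)))
    in S , T′ , ≼-trans S≼ X≼ , ≼-trans T′≼ T≼ , eS , eT′ , b , λ x∈ y∈ → All.lookup (All.lookup p x∈) (≼-⊆ T′≼ y∈)

-- Red tight paths and cliques

module Colour {N : ℕ} (c : Colouring N) where

  V : Set
  V = Fin N

  -- The inequalities allow the three lists to coincide: `T b U U W` concerns the edges with two
  -- vertices in `U` and one in `W`, whatever `col` does on degenerate triples.
  T : Bool → List V → List V → List V → Set
  T b X Y Z = ∀ {x y z} → x ∈ X → y ∈ Y → z ∈ Z → x ≢ y → x ≢ z → y ≢ z → col c x y z ≡ b

  T-≼ : ∀ {b X X′ Y Y′ Z Z′} → X′ ≼ X → Y′ ≼ Y → Z′ ≼ Z → T b X Y Z → T b X′ Y′ Z′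
  T-≼ p q r t x∈ y∈ z∈ = t (≼-⊆ p x∈) (≼-⊆ q y∈) (≼-⊆ r z∈)

  T-swap₁₂ : ∀ {b X Y Z} → T b X Y Z → T b Y X Z
  T-swap₁₂ t y∈ x∈ z∈ y≢x y≢z x≢z =
    trans (sym₁₂ c _ _ _) (t x∈ y∈ z∈ (λ e → y≢x (sym e)) x≢z y≢z)

  T-swap₂₃ : ∀ {b X Y Z} → T b X Y Z → T b X Z Y
  T-swap₂₃ t x∈ z∈ y∈ x≢z x≢y z≢y =
    trans (sym₂₃ c _ _ _) (t x∈ y∈ z∈ x≢y x≢z (λ e → z≢y (sym e)))

  record Clique (X : List V) : Set where
    constructor clique
    field
      unique : Unique X
      allRed : T true X X X
  open Clique public

  clique-≼ : ∀ {X Y} → X ≼ Y → Clique Y → Clique X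
  clique-≼ p (clique u t) = clique (≼-unique p u) (T-≼ p p p t)

  T-∷ : ∀ {b x S} → Mono b (col c x) S → T b S S S → T b (x ∷ S) (x ∷ S) (x ∷ S)
  T-∷ m t (here refl) (here refl) z∈ x≢x _ _ = ⊥-elim (x≢x refl)
  T-∷ m t (here refl) (there y∈) (here refl) _ x≢x _ = ⊥-elim (x≢x refl)
  T-∷ m t (here refl) (there y∈) (there z∈) _ _ y≢z = m y∈ z∈ y≢z
  T-∷ m t (there x∈) (here refl) (here refl) _ _ x≢x = ⊥-elim (x≢x refl)
  T-∷ m t (there x∈) (here refl) (there z∈) _ x≢z _ = trans (sym₁₂ c _ _ _) (m x∈ z∈ x≢z)
  T-∷ m t (there x∈) (there y∈) (here refl) x≢y _ _ =
    trans (trans (sym₂₃ c _ _ _) (sym₁₂ c _ _ _)) (m x∈ y∈ x≢y)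
  T-∷ m t (there x∈) (there y∈) (there z∈) = t x∈ y∈ z∈

  link-sym : ∀ v x y → col c v x y ≡ col c v y x
  link-sym = sym₂₃ c

  -- Distinctness of the vertices is kept apart, in `Unique`, because it will follow from a
  -- partition of the vertex set.
  RedPath : List V → Set
  RedPath (x ∷ y ∷ z ∷ l) = col c x y z ≡ true × RedPath (y ∷ z ∷ l)
  RedPath _ = ⊤

  path-tail : ∀ x l → RedPath (x ∷ l) → RedPath l
  path-tail x [] _ = tt
  path-tail x (y ∷ []) _ = tt
  path-tail x (y ∷ z ∷ l) (_ , p) = p

  path-++ʳ : ∀ a {b} → RedPath (a ++ b) → RedPath b
  path-++ʳ [] p = p
  path-++ʳ (x ∷ a) p = path-++ʳ a (path-tail x (a ++ _) p)

  path-++ˡ : ∀ a {b} → RedPath (a ++ b) → RedPath a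
  path-++ˡ [] _ = tt
  path-++ˡ (x ∷ []) _ = tt
  path-++ˡ (x ∷ y ∷ []) _ = tt
  path-++ˡ (x ∷ y ∷ z ∷ a) (r , p) = r , path-++ˡ (y ∷ z ∷ a) p

  -- As `b` has at least two vertices, any three consecutive vertices lie within `a ++ b` or within
  -- `b ++ d`.
  path-glue : ∀ a b d → 2 ≤ length b → RedPath (a ++ b) → RedPath (b ++ d) → RedPath (a ++ b ++ d)
  path-glue [] b d _ _ q = q
  path-glue (x ∷ []) (y ∷ z ∷ b) d _ (r , _) q = r , q
  path-glue (x ∷ y ∷ []) (z ∷ w ∷ b) d _ (r , r′ , _) q = r , r′ , q
  path-glue (x ∷ y ∷ z ∷ a) b d le (r , p) q = r , path-glue (y ∷ z ∷ a) b d le p q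
  path-glue (x ∷ _) (y ∷ []) d (s≤s ()) _ _

  clique-path : ∀ {X} → Clique X → RedPath X
  clique-path {[]} _ = tt
  clique-path {x ∷ []} _ = tt
  clique-path {x ∷ y ∷ []} _ = tt
  clique-path {x ∷ y ∷ z ∷ l} k@(clique ((x≢y ∷ x≢z ∷ _) ∷ (y≢z ∷ _) ∷ _) t) =
    t (here refl) (there (here refl)) (there (there (here refl))) x≢y x≢z y≢z ,
    clique-path (clique-≼ (≼-++ʳ (x ∷ []) (y ∷ z ∷ l)) k)

  -- The only new triples are the three that contain `l`.
  path-insert : ∀ x {a₁ a₂ l a₃ a₄} y → RedPath (x ++ a₁ ∷ a₂ ∷ a₃ ∷ a₄ ∷ y) →
    col c a₁ a₂ l ≡ true → col c a₂ l a₃ ≡ true → col c l a₃ a₄ ≡ true →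
    RedPath (x ++ a₁ ∷ a₂ ∷ l ∷ a₃ ∷ a₄ ∷ y)
  path-insert x {a₁} {a₂} {l} {a₃} {a₄} y p r r′ r″ =
    path-glue x (a₁ ∷ a₂ ∷ []) (l ∷ a₃ ∷ a₄ ∷ y) (s≤s (s≤s z≤n))
      (path-++ˡ (x ++ a₁ ∷ a₂ ∷ []) (subst RedPath (sym (++-assoc x (a₁ ∷ a₂ ∷ []) _)) p))
      (r , r′ , r″ , path-++ʳ (a₁ ∷ a₂ ∷ []) (path-++ʳ x p))

  path-reverse : ∀ l → RedPath l → RedPath (reverse l)
  path-reverse [] _ = tt
  path-reverse (x ∷ []) _ = tt
  path-reverse (x ∷ y ∷ []) _ = tt
  path-reverse (x ∷ y ∷ z ∷ l) (r , p) =
    subst RedPath (sym (trans (reverse-++ (x ∷ y ∷ z ∷ []) l) refl))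
      (path-glue (reverse l) (z ∷ y ∷ []) (x ∷ []) (s≤s (s≤s z≤n))
        (subst RedPath (reverse-++ (y ∷ z ∷ []) l) (path-reverse (y ∷ z ∷ l) p))
        (trans (trans (sym₂₃ c _ _ _) (trans (sym₁₂ c _ _ _) (sym₂₃ c _ _ _))) r , tt))

  -- The connecting path uses all vertices of both cliques and no others, so merging two paths along
  -- it loses no vertex.
  Adj : List V → List V → Set
  Adj U W = ∃₂ λ U′ W′ → U′ ↭ U × W′ ↭ W × RedPath (U′ ++ W′)

  adj-sym : ∀ {U W} → Adj U W → Adj W U
  adj-sym (U , W , p , q , r) = reverse W , reverse U ,
    ↭-trans (Perm.↭-reverse W) q , ↭-trans (Perm.↭-reverse U) p ,
    subst RedPath (reverse-++ U W) (path-reverse (U ++ W) r)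

  -- The spare vertices of `U` go in front and those of `W` at the end, since a clique is a path in
  -- every order. Hence non-adjacency passes to subcliques.
  adj-≼ : ∀ {U W U₀ W₀} → Clique U → Clique W → U₀ ≼ U → W₀ ≼ W →
    2 ≤ length U₀ → 2 ≤ length W₀ → Adj U₀ W₀ → Adj U W
  adj-≼ {U} {W} {U₀} {W₀} kU kW (r , p) (s , q) leU leW (U′ , W′ , p′ , q′ , path) =
    r ++ U′ , W′ ++ s , permU , permW ,
    subst RedPath (sym (++-assoc r U′ (W′ ++ s)))
      (path-glue r U′ (W′ ++ s) (≤-trans leU (≤-reflexive (sym (Perm.↭-length p′))))
        (clique-path (clique-≼ (↭⇒≼ (↭-sym permU)) kU))
        (path-glue U′ W′ s (≤-trans leW (≤-reflexive (sym (Perm.↭-length q′)))) path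
          (clique-path (clique-≼ (↭⇒≼ (↭-sym permW)) kW))))
    where
    permU : r ++ U′ ↭ U
    permU = ↭-trans (Perm.++⁺ˡ r p′) (↭-trans (Perm.++-comm r U₀) (↭-sym p))
    permW : W′ ++ s ↭ W
    permW = ↭-trans (Perm.++⁺ʳ s q′) (↭-sym q)

  clique-adj : ∀ {U W} → Clique (U ++ W) → Adj U W
  clique-adj {U} {W} k = U , W , ↭-refl , ↭-refl , clique-path k

  -- The path survives every reordering of its two ends, so an end can be arranged as an adjacency
  -- demands.
  record HPath (k : ℕ) : Set where
    constructor hpath
    field
      hd mid tl : List V
      hd-clique : T true hd hd hd
      tl-clique : T true tl tl tl
      hd-length : length hd ≡ k
      tl-length : length tl ≡ k
      path : ∀ {h t} → h ↭ hd → t ↭ tl → RedPath (h ++ mid ++ t)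
    verts : List V
    verts = hd ++ mid ++ tl
  open HPath public

  tail≼ : ∀ {k} (P : HPath k) → tl P ≼ verts P
  tail≼ P = ≼-trans (≼-++ʳ (mid P) (tl P)) (≼-++ʳ (hd P) (mid P ++ tl P))

  module _ {k : ℕ} (2≤k : 2 ≤ k) where

    -- `Q` is run backwards: the tails meet in the middle and the two heads become the ends of the
    -- new path.
    join : (P Q : HPath k) → Adj (tl P) (tl Q) → ∃ λ R → verts R ↭ verts P ++ verts {k} Q
    join P Q (U , W , p , q , r) = record
      { hd = hd P ; mid = m ; tl = hd Q ; hd-clique = hd-clique P ; tl-clique = hd-clique Q
      ; hd-length = hd-length P ; tl-length = hd-length Q ; path = good } ,
      ↭-trans (Perm.++⁺ˡ (hd P) (Perm.++⁺ʳ (hd Q) (Perm.++⁺ˡ (mid P) (Perm.++⁺ p (Perm.++⁺ q (Perm.↭-reverse (mid Q)))))))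
        (solve 6 (λ a b d e f g → a ⊕ ((b ⊕ (d ⊕ (e ⊕ f))) ⊕ g) ⊜ (a ⊕ (b ⊕ d)) ⊕ (g ⊕ (f ⊕ e)))
          ↭-refl (hd P) (mid P) (tl P) (tl Q) (mid Q) (hd Q))
      where
      m : List V
      m = mid P ++ U ++ W ++ reverse (mid Q)
      good : ∀ {h t} → h ↭ hd P → t ↭ hd Q → RedPath (h ++ m ++ t)
      good {h} {t} p′ q′ = subst RedPath eq
        (path-glue (h ++ mid P) U (W ++ reverse (mid Q) ++ t) (2≤ (tl-length P) p)
          (subst RedPath (sym (++-assoc h (mid P) U)) (path P p′ p))
          (path-glue U W (reverse (mid Q) ++ t) (2≤ (tl-length Q) q) r back))
        where
        2≤ : ∀ {X Y} → length Y ≡ k → X ↭ Y → 2 ≤ length X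
        2≤ e s = ≤-trans 2≤k (≤-reflexive (trans (sym e) (sym (Perm.↭-length s))))
        back : RedPath (W ++ reverse (mid Q) ++ t)
        back = subst RedPath
          (trans (reverse-++ (reverse t) (mid Q ++ reverse W))
          (trans (cong (_++ reverse (reverse t)) (reverse-++ (mid Q) (reverse W)))
          (trans (cong₂ (λ a b → (a ++ reverse (mid Q)) ++ b) (reverse-involutive W) (reverse-involutive t))
            (++-assoc W (reverse (mid Q)) t))))
          (path-reverse _ (path Q (↭-trans (Perm.↭-reverse t) q′) (↭-trans (Perm.↭-reverse W) q)))
        eq : (h ++ mid P) ++ U ++ W ++ reverse (mid Q) ++ t ≡ h ++ m ++ t
        eq = trans (++-assoc h (mid P) _) (cong (h ++_)
          (trans (cong (mid P ++_) (trans (cong (U ++_) (sym (++-assoc W (reverse (mid Q)) t)))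
            (sym (++-assoc U (W ++ reverse (mid Q)) t)))) (sym (++-assoc (mid P) _ t))))

  cliqueHPath : ∀ {k X} → Clique X → length X ≡ k + k → ∃ λ P → verts {k} P ↭ X
  cliqueHPath {k} {X} kX e with split k X (≤-trans (m≤m+n k k) (≤-reflexive (sym e)))
  ... | S , S′ , p , eS = record
    { hd = S ; mid = [] ; tl = S′
    ; hd-clique = allRed (clique-≼ (S′ , p) kX)
    ; tl-clique = allRed (clique-≼ (≼-trans (≼-++ʳ S S′) (↭⇒≼ p)) kX)
    ; hd-length = eS
    ; tl-length = +-cancelˡ-≡ k _ _ (trans (cong (_+ length S′) (sym eS))
        (trans (sym (length-++ S)) (trans (sym (Perm.↭-length p)) e)))
    ; path = λ q q′ → clique-path (clique-≼ (↭⇒≼ (↭-trans p (↭-sym (Perm.++⁺ q q′)))) kX) } , ↭-sym p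

lookup-injective : ∀ {A : Set} {xs : List A} → Unique xs → ∀ i j → lookup xs i ≡ lookup xs j → i ≡ j
lookup-injective (_ ∷ _) zero zero _ = refl
lookup-injective {xs = _ ∷ xs} (p ∷ _) zero (suc j) e = ⊥-elim (All.lookup p (∈-lookup j) e)
lookup-injective {xs = _ ∷ xs} (p ∷ _) (suc i) zero e = ⊥-elim (All.lookup p (∈-lookup i) (sym e))
lookup-injective (_ ∷ u) (suc i) (suc j) e = cong suc (lookup-injective u i j e)

dis-sym : ∀ {A : Set} {X Y : List A} → Dis X Y → Dis Y X
dis-sym d p q = d q p

dis-≼ : ∀ {A : Set} {X X′ Y Y′ : List A} → X′ ≼ X → Y′ ≼ Y → Dis X Y → Dis X′ Y′
dis-≼ p q d v∈ v∈′ = d (≼-⊆ p v∈) (≼-⊆ q v∈′)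

apart : ∀ {A : Set} {X Y : List A} {x y} → Dis X Y → x ∈ X → y ∈ Y → x ≢ y
apart d x∈ y∈ refl = d x∈ y∈

inhabited : ∀ {A : Set} {xs : List A} {k} → length xs ≡ suc k → ∃ λ x → x ∈ xs
inhabited {xs = x ∷ _} _ = x , here refl

-- Colourings without a blue Fano plane

-- Fix a vertex, colour each pair by the triple it forms with that vertex, apply the graph theorem,
-- and recurse inside the homogeneous set.
R₃ : ℕ → ℕ → ℕ
R₃ zero _ = 0
R₃ (suc s) zero = 0
R₃ (suc s) (suc t) = suc (R₂ (R₃ s (suc t)) (R₃ (suc s) t))

dbl : ℕ → ℕ
dbl k = k + k

opaque
  -- Here m vertices of `U` are kept, `W` is halved once for each ordered pair of them, and then
  -- passed through a Ramsey step for each of the 2s vertices of `U` that remain. The leading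
  -- `suc s` yields `≤-homSize`.
  homSize : ℕ → ℕ
  homSize s = suc s + (m + pow (pow dbl m) m (suc (pow (λ k → R₂ k k) (s + s) s)))
    where
    m : ℕ
    m = R₂ (s + s) (s + s)

  ≤-homSize : ∀ s → s ≤ homSize s
  ≤-homSize s = ≤-trans (n≤1+n s) (m≤m+n (suc s) _)

  homSize-bound : ∀ s {k} → homSize s ≤ k → suc s + (R₂ (s + s) (s + s) +
    pow (pow dbl (R₂ (s + s) (s + s))) (R₂ (s + s) (s + s)) (suc (pow (λ k → R₂ k k) (s + s) s))) ≤ k
  homSize-bound s le = le

  -- The 7 is there because a blue clique on seven vertices contains a blue Fano plane.
  cliqueSize : ℕ → ℕ
  cliqueSize k = R₃ k 7

  cliqueSize-bound : ∀ k {l} → cliqueSize k ≤ l → R₃ k 7 ≤ l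
  cliqueSize-bound k le = le

module NoFano {N : ℕ} (c : Colouring N) (noFano : ¬ FanoCopy c blue) where
  open Colour c

  fano : ∀ {p₀ p₁ p₂ p₃ p₄ p₅ p₆} →
    Unique (p₀ ∷ p₁ ∷ p₂ ∷ p₃ ∷ p₄ ∷ p₅ ∷ p₆ ∷ []) →
    col c p₀ p₁ p₂ ≡ false → col c p₀ p₃ p₄ ≡ false → col c p₀ p₅ p₆ ≡ false →
    col c p₁ p₃ p₅ ≡ false → col c p₁ p₄ p₆ ≡ false → col c p₂ p₃ p₆ ≡ false →
    col c p₂ p₄ p₅ ≡ false → ⊥
  fano {p₀} {p₁} {p₂} {p₃} {p₄} {p₅} {p₆} u b₁ b₂ b₃ b₄ b₅ b₆ b₇ =
    noFano (lookup ps , (λ {i} {j} → lookup-injective u i j) , edge)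
    where
    ps : List V
    ps = p₀ ∷ p₁ ∷ p₂ ∷ p₃ ∷ p₄ ∷ p₅ ∷ p₆ ∷ []
    edge : ∀ x y z → FanoEdge x y z → col c (lookup ps x) (lookup ps y) (lookup ps z) ≡ blue
    edge _ _ _ e₁ = b₁
    edge _ _ _ e₂ = b₂
    edge _ _ _ e₃ = b₃
    edge _ _ _ e₄ = b₄
    edge _ _ _ e₅ = b₅
    edge _ _ _ e₆ = b₆
    edge _ _ _ e₇ = b₇

  -- The three perfect matchings of four points of G, together with xyz, would form a Fano plane.
  blueLinks⇒red : ∀ {G x y z} → Unique G → 4 ≤ length G → x ∉ G → y ∉ G → z ∉ G →
    x ≢ y → x ≢ z → y ≢ z →
    Mono false (col c x) G → Mono false (col c y) G → Mono false (col c z) G → col c x y z ≡ true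
  blueLinks⇒red {a ∷ b ∷ d ∷ e ∷ G} {x} {y} {z} uG@((ab ∷ ad ∷ ae ∷ _) ∷ (bd ∷ be ∷ _) ∷ (de ∷ _) ∷ _) _ x∉ y∉ z∉ x≢y x≢z y≢z mx my mz with col c x y z in eq
  ... | true = refl
  ... | false = ⊥-elim (fano
      ((x≢y ∷ x≢z ∷ All.tabulate λ v∈ e → x∉ (subst (_∈ _) (sym e) (four v∈))) ∷
       (y≢z ∷ All.tabulate λ v∈ e → y∉ (subst (_∈ _) (sym e) (four v∈))) ∷
       All.tabulate (λ v∈ e → z∉ (subst (_∈ _) (sym e) (four v∈))) ∷ unique-++ˡ (a ∷ b ∷ d ∷ e ∷ []) uG)
      eq
      (mx i₀ i₁ ab) (mx i₂ i₃ de) (my i₀ i₂ ad) (my i₁ i₃ be) (mz i₀ i₃ ae) (mz i₁ i₂ bd))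
    where
    four : ∀ {v} → v ∈ a ∷ b ∷ d ∷ e ∷ [] → v ∈ a ∷ b ∷ d ∷ e ∷ G
    four = ∈-++⁺ˡ
    i₀ = here refl
    i₁ = there (here refl)
    i₂ = there (there (here refl))
    i₃ = there (there (there (here refl)))
  blueLinks⇒red {_ ∷ []} _ (s≤s ())
  blueLinks⇒red {_ ∷ _ ∷ []} _ (s≤s (s≤s ()))
  blueLinks⇒red {_ ∷ _ ∷ _ ∷ []} _ (s≤s (s≤s (s≤s ())))

  ramsey₃ : ∀ s t xs → R₃ s t ≤ length xs →
    (∃ λ S → S ≼ xs × length S ≡ s × T true S S S) ⊎ (∃ λ S → S ≼ xs × length S ≡ t × T false S S S)
  ramsey₃ zero _ xs _ = inj₁ ([] , (xs , ↭-refl) , refl , λ ())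
  ramsey₃ (suc s) zero xs _ = inj₂ ([] , (xs , ↭-refl) , refl , λ ())
  ramsey₃ (suc s) (suc t) (x ∷ xs) (s≤s le)
    with ramsey₂ (col c x) (link-sym x) (R₃ s (suc t)) (R₃ (suc s) t) xs le
  ... | inj₁ (U , U≼ , e , m) with ramsey₃ s (suc t) U (≤-reflexive (sym e))
  ...   | inj₁ (S , S≼ , e′ , t′) = inj₁ (x ∷ S , ≼-∷ x (≼-trans S≼ U≼) , cong suc e′ ,
            T-∷ (λ p q → m (≼-⊆ S≼ p) (≼-⊆ S≼ q)) t′)
  ...   | inj₂ (S , S≼ , r) = inj₂ (S , ≼-there x (≼-trans S≼ U≼) , r)
  ramsey₃ (suc s) (suc t) (x ∷ xs) (s≤s le) | inj₂ (U , U≼ , e , m)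
    with ramsey₃ (suc s) t U (≤-reflexive (sym e))
  ...   | inj₁ (S , S≼ , r) = inj₁ (S , ≼-there x (≼-trans S≼ U≼) , r)
  ...   | inj₂ (S , S≼ , e′ , t′) = inj₂ (x ∷ S , ≼-∷ x (≼-trans S≼ U≼) , cong suc e′ ,
            T-∷ (λ p q → m (≼-⊆ S≼ p) (≼-⊆ S≼ q)) t′)

  noBlueClique : ∀ S → length S ≡ 7 → Unique S → T false S S S → ⊥
  noBlueClique (a ∷ b ∷ d ∷ e ∷ f ∷ g ∷ h ∷ []) refl
    u@((ab ∷ ad ∷ ae ∷ af ∷ ag ∷ ah ∷ []) ∷ (bd ∷ be ∷ bf ∷ bg ∷ bh ∷ []) ∷
       (de ∷ df ∷ dg ∷ dh ∷ []) ∷ (ef ∷ eg ∷ eh ∷ []) ∷ (fg ∷ fh ∷ []) ∷ (gh ∷ []) ∷ [] ∷ []) t =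
    fano u (t j₀ j₁ j₂ ab ad bd) (t j₀ j₃ j₄ ae af ef) (t j₀ j₅ j₆ ag ah gh)
      (t j₁ j₃ j₅ be bg eg) (t j₁ j₄ j₆ bf bh fh) (t j₂ j₃ j₆ de dh eh) (t j₂ j₄ j₅ df dg fg)
    where
    j₀ = here refl
    j₁ = there (here refl)
    j₂ = there (there (here refl))
    j₃ = there (there (there (here refl)))
    j₄ = there (there (there (there (here refl))))
    j₅ = there (there (there (there (there (here refl)))))
    j₆ = there (there (there (there (there (there (here refl))))))

  redFromRamsey : ∀ {k xs} → Unique xs →
    (∃ λ S → S ≼ xs × length S ≡ k × T true S S S) ⊎ (∃ λ S → S ≼ xs × length S ≡ 7 × T false S S S) →
    ∃ λ S → S ≼ xs × length S ≡ k × Clique S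
  redFromRamsey u (inj₁ (S , S≼ , e , t)) = S , S≼ , e , clique (≼-unique S≼ u) t
  redFromRamsey u (inj₂ (S , S≼ , e , t)) = ⊥-elim (noBlueClique S e (≼-unique S≼ u) t)

  opaque
    redClique : ∀ k xs → Unique xs → cliqueSize k ≤ length xs → ∃ λ S → S ≼ xs × length S ≡ k × Clique S
    redClique k xs u le = redFromRamsey u (ramsey₃ k 7 xs (cliqueSize-bound k le))

  clique-++ : ∀ {X Y} → Clique X → Clique Y → Dis X Y → T true X X Y → T true X Y Y → Clique (X ++ Y)
  clique-++ {X} {Y} (clique uX tX) (clique uY tY) d t t′ = clique (unique-++ uX uY d) all
    where
    all : T true (X ++ Y) (X ++ Y) (X ++ Y)
    all x∈ y∈ z∈ with ∈-++⁻ X x∈ | ∈-++⁻ X y∈ | ∈-++⁻ X z∈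
    ... | inj₁ p | inj₁ q | inj₁ r = tX p q r
    ... | inj₁ p | inj₁ q | inj₂ r = t p q r
    ... | inj₁ p | inj₂ q | inj₁ r = T-swap₂₃ t p q r
    ... | inj₁ p | inj₂ q | inj₂ r = t′ p q r
    ... | inj₂ p | inj₁ q | inj₁ r = T-swap₁₂ (T-swap₂₃ t) p q r
    ... | inj₂ p | inj₁ q | inj₂ r = T-swap₁₂ t′ p q r
    ... | inj₂ p | inj₂ q | inj₁ r = T-swap₂₃ (T-swap₁₂ t′) p q r
    ... | inj₂ p | inj₂ q | inj₂ r = tY p q r

  blueLink : ∀ {U W w} → Dis U W → T false U U W → w ∈ W → Mono false (col c w) U
  blueLink d t w∈ x∈ y∈ x≢y = trans (trans (sym₁₂ c _ _ _) (sym₂₃ c _ _ _))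
    (t x∈ y∈ w∈ x≢y (apart d x∈ w∈) (apart d y∈ w∈))

  -- Every vertex of `W ++ W′` has a blue link on `U`, so `blueLinks⇒red` applies to any three of
  -- them.
  missTwo : ∀ {U W W′} → Unique U → 4 ≤ length U → Unique W → Unique W′ →
    Dis U W → Dis U W′ → Dis W W′ → T false U U W → T false U U W′ → Clique (W ++ W′)
  missTwo {U} {W} {W′} uU le uW uW′ d d′ d″ t t′ = clique (unique-++ uW uW′ d″)
    (λ x∈ y∈ z∈ x≢y x≢z y≢z → blueLinks⇒red uU le (out x∈) (out y∈) (out z∈) x≢y x≢z y≢z
      (link x∈) (link y∈) (link z∈))
    where
    link : ∀ {w} → w ∈ W ++ W′ → Mono false (col c w) U
    link w∈ with ∈-++⁻ W w∈
    ... | inj₁ p = blueLink d t p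
    ... | inj₂ p = blueLink d′ t′ p
    out : ∀ {w} → w ∈ W ++ W′ → w ∉ U
    out w∈ w∈U with ∈-++⁻ W w∈
    ... | inj₁ p = d w∈U p
    ... | inj₂ p = d′ w∈U p

  opaque
    linkHomogeneous : ∀ v k X → R₂ k k ≤ length X →
      ∃ λ S → S ≼ X × length S ≡ k × ∃ λ b → Mono b (col c v) S
    linkHomogeneous v k X le with ramsey₂ (col c v) (link-sym v) k k X le
    ... | inj₁ (S , p , e , m) = S , p , e , true , m
    ... | inj₂ (S , p , e , m) = S , p , e , false , m

  opaque
    -- `W` is halved once for each ordered pair from `U`.
    constantPairs : ∀ U w W → pow (pow dbl (length U)) (length U) w ≤ length W →
      ∃ λ W′ → W′ ≼ W × length W′ ≡ w × All (λ u → All (λ u′ → ∃ λ b → All (λ w → col c u u′ w ≡ b) W′) U) U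
    constantPairs U w W = restrictAll
      (λ u W → All (λ u′ → ∃ λ b → All (λ w → col c u u′ w ≡ b) W) U)
      (λ S≼ → All.map (λ (b , p) → b , All.tabulate (λ v∈ → All.lookup p (≼-⊆ S≼ v∈))))
      (pow dbl (length U))
      (λ u k ys → restrictAll (λ u′ W → ∃ λ b → All (λ w → col c u u′ w ≡ b) W)
        (λ S≼ (b , p) → b , All.tabulate (λ v∈ → All.lookup p (≼-⊆ S≼ v∈))) dbl
        (λ u′ k zs l → let b , S , S≼ , e , p = pigeonhole {P = λ w b → col c u u′ w ≡ b} k zs l
                             (All.tabulate (λ {w} _ → col c u u′ w , refl))
                       in S , S≼ , e , b , p)
        U k ys)
      U w W

    homogeneousLinks : ∀ U s W → pow (λ k → R₂ k k) (length U) s ≤ length W →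
      ∃ λ W′ → W′ ≼ W × length W′ ≡ s × All (λ u → ∃ λ b → Mono b (col c u) W′) U
    homogeneousLinks U s W = restrictAll (λ u W → ∃ λ b → Mono b (col c u) W)
      (λ S≼ (b , p) → b , λ x∈ y∈ → p (≼-⊆ S≼ x∈) (≼-⊆ S≼ y∈)) (λ k → R₂ k k) linkHomogeneous U s W

    homogeneousUUW : ∀ s w U W → R₂ s s ≤ length U →
      pow (pow dbl (R₂ s s)) (R₂ s s) (suc w) ≤ length W →
      ∃₂ λ U′ W′ → U′ ≼ U × W′ ≼ W × length U′ ≡ s × length W′ ≡ suc w × ∃ λ b → T b U′ U′ W′
    homogeneousUUW s w U W leU leW =
      let U₀ , U₀≼ , eU₀ = choose (R₂ s s) U leU
          W₀ , W₀≼ , eW₀ , pairs = constantPairs U₀ (suc w) W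
            (≤-trans (≤-reflexive (cong (λ j → pow (pow dbl j) j (suc w)) eU₀)) leW)
          -- All vertices of `W₀` now have the same link on `U₀`, so making the link of one of them
          -- homogeneous serves all. The size `suc w` guarantees that one exists.
          w₀ , w₀∈ = inhabited eW₀
          U₁ , U₁≼ , eU₁ , b , mono = linkHomogeneous w₀ s U₀ (≤-reflexive (sym eU₀))
      in U₁ , W₀ , ≼-trans U₁≼ U₀≼ , W₀≼ , eU₁ , eW₀ , b ,
        λ x∈ y∈ z∈ x≢y _ _ → trans
            (let _ , p = All.lookup (All.lookup pairs (≼-⊆ U₁≼ x∈)) (≼-⊆ U₁≼ y∈)
             in trans (All.lookup p z∈) (sym (All.lookup p w₀∈)))
            (trans (trans (sym₂₃ c _ _ _) (sym₁₂ c _ _ _)) (mono x∈ y∈ x≢y))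

    -- `W` is made homogeneous in the link of every vertex of `U`; half of the vertices of `U` then
    -- agree on the colour.
    homogeneousUWW : ∀ s U W → s + s ≤ length U → pow (λ k → R₂ k k) (length U) s ≤ length W →
      ∃₂ λ U′ W′ → U′ ≼ U × W′ ≼ W × length U′ ≡ s × length W′ ≡ s × ∃ λ b → T b U′ W′ W′
    homogeneousUWW s U W leU leW =
      let W₁ , W₁≼ , eW₁ , links = homogeneousLinks U s W leW
          b , U₁ , U₁≼ , eU₁ , mono = pigeonhole s U leU links
      in U₁ , W₁ , U₁≼ , W₁≼ , eU₁ , eW₁ , b , λ x∈ y∈ z∈ _ _ y≢z → All.lookup mono x∈ y∈ z∈ y≢z

    homogenise : ∀ s U W → homSize s ≤ length U → homSize s ≤ length W → ∃₂ λ U′ W′ → U′ ≼ U × W′ ≼ W ×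
      length U′ ≡ s × length W′ ≡ s × ∃₂ λ b b′ → T b U′ U′ W′ × T b′ U′ W′ W′
    homogenise s U W leU leW =
      let U₁ , W₁ , pU , pW , eU , eW , b , t = homogeneousUUW (s + s) (pow (λ k → R₂ k k) (s + s) s) U W
            (≤-trans (≤-trans (m≤m+n _ _) (m≤n+m _ (suc s))) (homSize-bound s leU))
            (≤-trans (m≤n+m _ _) (≤-trans (m≤n+m _ (suc s)) (homSize-bound s leW)))
          U₂ , W₂ , pU′ , pW′ , eU′ , eW′ , b′ , t′ = homogeneousUWW s U₁ W₁ (≤-reflexive (sym eU))
            (≤-trans (≤-reflexive (cong (λ j → pow (λ k → R₂ k k) j s) eU)) (≤-trans (n≤1+n _) (≤-reflexive (sym eW))))
      in U₂ , W₂ , ≼-trans pU′ pU , ≼-trans pW′ pW , eU′ , eW′ , b , b′ , T-≼ pU′ pU′ pW′ t , t′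

-- Pairwise non-adjacent cliques

-- The 4 provides the four points whose perfect matchings enter a Fano plane. In `naSize₃` each
-- layer of `homSize` pays for one of the three pairs.
naSize₂ naSize₃ : ℕ → ℕ
naSize₂ s = homSize (4 + s)
naSize₃ s = homSize (homSize (homSize (4 + s)))

-- Large enough to orient one clique against k others in turn; the base value is what `commonMiss`
-- requires afterwards.
missSize : ℕ → ℕ
missSize zero = homSize 4
missSize (suc k) = homSize (4 + missSize k)

missSize-suc : ∀ k → missSize k ≤ missSize (suc k)
missSize-suc k = ≤-trans (m≤n+m _ 4) (≤-homSize (4 + missSize k))

naSize₄ : ℕ
naSize₄ = missSize 3

module Stages {N : ℕ} (c : Colouring N) (noFano : ¬ FanoCopy c blue) where
  open Colour c
  open NoFano c noFano

  record NonAdj (U W : List V) : Set where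
    field
      cliqueˡ : Clique U
      cliqueʳ : Clique W
      disjoint : Dis U W
      nonadj : ¬ Adj U W
  open NonAdj public

  nonAdj-≼ : ∀ {U W U′ W′} → U′ ≼ U → W′ ≼ W → 2 ≤ length U′ → 2 ≤ length W′ → NonAdj U W → NonAdj U′ W′
  nonAdj-≼ p q l l′ n = record
    { cliqueˡ = clique-≼ p (cliqueˡ n) ; cliqueʳ = clique-≼ q (cliqueʳ n)
    ; disjoint = dis-≼ p q (disjoint n)
    ; nonadj = λ a → nonadj n (adj-≼ (cliqueˡ n) (cliqueʳ n) p q l l′ a) }

  nonAdj-sym : ∀ {U W} → NonAdj U W → NonAdj W U
  nonAdj-sym n = record
    { cliqueˡ = cliqueʳ n ; cliqueʳ = cliqueˡ n
    ; disjoint = dis-sym (disjoint n) ; nonadj = λ a → nonadj n (adj-sym a) }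

  notBothRed : ∀ {U W} → NonAdj U W → T true U U W → T true U W W → ⊥
  notBothRed n t t′ = nonadj n (clique-adj (clique-++ (cliqueˡ n) (cliqueʳ n) (disjoint n) t t′))

  -- By `missTwo` the two missed cliques would form a single clique and so be adjacent.
  notMissBoth : ∀ {U W W′} → NonAdj U W → NonAdj U W′ → NonAdj W W′ → 4 ≤ length U →
    T false U U W → T false U U W′ → ⊥
  notMissBoth n n′ n″ l t t′ = nonadj n″ (clique-adj
    (missTwo (unique (cliqueˡ n)) l (unique (cliqueˡ n″)) (unique (cliqueʳ n″))
      (disjoint n) (disjoint n′) (disjoint n″) t t′))

  flip : ∀ {b U W} → T b U W W → T b W W U
  flip t = T-swap₂₃ (T-swap₁₂ t)

  unflip : ∀ {b U W} → T b U U W → T b W U U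
  unflip t = T-swap₁₂ (T-swap₂₃ t)

  -- Of the colours between the cliques only "`E₂` misses `E₁`" is recorded; this is what absorption
  -- uses.
  record Stage₂ (s : ℕ) : Set where
    field
      {E₁ E₂} : List V
      na : NonAdj E₁ E₂
      b₁₂ : T false E₁ E₂ E₂
      size₁ : s ≤ length E₁
      size₂ : s ≤ length E₂

  record Cyclic (E₁ E₂ E₃ : List V) : Set where
    field
      k₁ : Clique E₁
      k₂ : Clique E₂
      k₃ : Clique E₃
      d₁₂ : Dis E₁ E₂
      d₂₃ : Dis E₂ E₃
      d₃₁ : Dis E₃ E₁
      r₁₂ : T true E₁ E₁ E₂
      b₁₂ : T false E₁ E₂ E₂
      r₂₃ : T true E₂ E₂ E₃
      b₂₃ : T false E₂ E₃ E₃
      r₃₁ : T true E₃ E₃ E₁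
      b₃₁ : T false E₃ E₁ E₁

  rotate : ∀ {E₁ E₂ E₃} → Cyclic E₁ E₂ E₃ → Cyclic E₂ E₃ E₁
  rotate C = record
    { k₁ = k₂ ; k₂ = k₃ ; k₃ = k₁ ; d₁₂ = d₂₃ ; d₂₃ = d₃₁ ; d₃₁ = d₁₂
    ; r₁₂ = r₂₃ ; b₁₂ = b₂₃ ; r₂₃ = r₃₁ ; b₂₃ = b₃₁ ; r₃₁ = r₁₂ ; b₃₁ = b₁₂ }
    where open Cyclic C

  cyclic-≼ : ∀ {E₁ E₂ E₃ F₁ F₂ F₃} → F₁ ≼ E₁ → F₂ ≼ E₂ → F₃ ≼ E₃ → Cyclic E₁ E₂ E₃ → Cyclic F₁ F₂ F₃
  cyclic-≼ p q r C = record
    { k₁ = clique-≼ p k₁ ; k₂ = clique-≼ q k₂ ; k₃ = clique-≼ r k₃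
    ; d₁₂ = dis-≼ p q d₁₂ ; d₂₃ = dis-≼ q r d₂₃ ; d₃₁ = dis-≼ r p d₃₁
    ; r₁₂ = T-≼ p p q r₁₂ ; b₁₂ = T-≼ p q q b₁₂ ; r₂₃ = T-≼ q q r r₂₃ ; b₂₃ = T-≼ q r r b₂₃
    ; r₃₁ = T-≼ r r p r₃₁ ; b₃₁ = T-≼ r p p b₃₁ }
    where open Cyclic C

  record Stage₃ (s : ℕ) : Set where
    field
      {E₁ E₂ E₃} : List V
      cyclic : Cyclic E₁ E₂ E₃
      na₁₂ : NonAdj E₁ E₂
      na₂₃ : NonAdj E₂ E₃
      na₃₁ : NonAdj E₃ E₁
      size₁ : s ≤ length E₁
      size₂ : s ≤ length E₂
      size₃ : s ≤ length E₃

  rotate₃ : ∀ {s} → Stage₃ s → Stage₃ s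
  rotate₃ S = record { cyclic = rotate cyclic ; na₁₂ = na₂₃ ; na₂₃ = na₃₁ ; na₃₁ = na₁₂
                     ; size₁ = size₂ ; size₂ = size₃ ; size₃ = size₁ }
    where open Stage₃ S

  Indep : ℕ → List (List V) → Set
  Indep k Us = All (λ U → k ≤ length U) Us × AllPairs NonAdj Us

  2≤ : ∀ {s k} → k ≡ 4 + s → 2 ≤ k
  2≤ e = ≤-trans (s≤s (s≤s z≤n)) (≤-reflexive (sym e))

  4≤ : ∀ {s k} → k ≡ 4 + s → 4 ≤ k
  4≤ e = ≤-trans (s≤s (s≤s (s≤s (s≤s z≤n)))) (≤-reflexive (sym e))

  s≤ : ∀ {s k} → k ≡ 4 + s → s ≤ k
  s≤ {s} e = ≤-trans (m≤n+m s 4) (≤-reflexive (sym e))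

  indep₂ : ∀ s {U W} → Indep (naSize₂ s) (U ∷ W ∷ []) → Stage₂ s
  indep₂ s {U} {W} (l ∷ l′ ∷ [] , (n ∷ []) ∷ _) with homogenise (4 + s) U W l l′
  ... | U′ , W′ , p , q , e , e′ , false , _ , t , _ = record
    { na = nonAdj-sym (nonAdj-≼ p q (2≤ e) (2≤ e′) n) ; b₁₂ = unflip t ; size₁ = s≤ e′ ; size₂ = s≤ e }
  ... | U′ , W′ , p , q , e , e′ , true , false , _ , t = record
    { na = nonAdj-≼ p q (2≤ e) (2≤ e′) n ; b₁₂ = t ; size₁ = s≤ e ; size₂ = s≤ e′ }
  ... | U′ , W′ , p , q , e , e′ , true , true , t , t′ =
    ⊥-elim (notBothRed (nonAdj-≼ p q (2≤ e) (2≤ e′) n) t t′)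

  -- Each pair contains a miss and no clique misses two others, so the misses form a directed
  -- triangle. Of its two orientations, the second becomes the first when `E₂` and `E₃` are
  -- exchanged.
  orient₃ : ∀ {s E₁ E₂ E₃} → length E₁ ≡ 4 + s → length E₂ ≡ 4 + s → length E₃ ≡ 4 + s →
    NonAdj E₁ E₂ → NonAdj E₂ E₃ → NonAdj E₁ E₃ →
    ∀ c₁₂ d₁₂ c₂₃ d₂₃ c₁₃ d₁₃ →
    T c₁₂ E₁ E₁ E₂ → T d₁₂ E₁ E₂ E₂ → T c₂₃ E₂ E₂ E₃ → T d₂₃ E₂ E₃ E₃ → T c₁₃ E₁ E₁ E₃ → T d₁₃ E₁ E₃ E₃ →
    Stage₃ s
  orient₃ {s} {E₁} {E₂} {E₃} l₁ l₂ l₃ n₁₂ n₂₃ n₁₃ = go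
    where
    go : ∀ c₁₂ d₁₂ c₂₃ d₂₃ c₁₃ d₁₃ →
      T c₁₂ E₁ E₁ E₂ → T d₁₂ E₁ E₂ E₂ → T c₂₃ E₂ E₂ E₃ → T d₂₃ E₂ E₃ E₃ → T c₁₃ E₁ E₁ E₃ → T d₁₃ E₁ E₃ E₃ →
      Stage₃ s
    go true true _ _ _ _ t₁ t₂ _ _ _ _ = ⊥-elim (notBothRed n₁₂ t₁ t₂)
    go _ _ true true _ _ _ _ t₁ t₂ _ _ = ⊥-elim (notBothRed n₂₃ t₁ t₂)
    go _ _ _ _ true true _ _ _ _ t₁ t₂ = ⊥-elim (notBothRed n₁₃ t₁ t₂)
    go false _ _ _ false _ t₁ _ _ _ t₂ _ = ⊥-elim (notMissBoth n₁₂ n₁₃ n₂₃ (4≤ l₁) t₁ t₂)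
    go _ false false _ _ _ _ t₁ t₂ _ _ _ =
      ⊥-elim (notMissBoth (nonAdj-sym n₁₂) n₂₃ n₁₃ (4≤ l₂) (flip t₁) t₂)
    go _ _ _ false _ false _ _ _ t₁ _ t₂ =
      ⊥-elim (notMissBoth (nonAdj-sym n₂₃) (nonAdj-sym n₁₃) (nonAdj-sym n₁₂) (4≤ l₃) (flip t₁) (flip t₂))
    go true false true false false true r₁₂ b₁₂ r₂₃ b₂₃ b₁₃ r₁₃ = record
      { cyclic = record
        { k₁ = cliqueˡ n₁₂ ; k₂ = cliqueˡ n₂₃ ; k₃ = cliqueʳ n₂₃
        ; d₁₂ = disjoint n₁₂ ; d₂₃ = disjoint n₂₃ ; d₃₁ = dis-sym (disjoint n₁₃)
        ; r₁₂ = r₁₂ ; b₁₂ = b₁₂ ; r₂₃ = r₂₃ ; b₂₃ = b₂₃ ; r₃₁ = flip r₁₃ ; b₃₁ = unflip b₁₃ }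
      ; na₁₂ = n₁₂ ; na₂₃ = n₂₃ ; na₃₁ = nonAdj-sym n₁₃ ; size₁ = s≤ l₁ ; size₂ = s≤ l₂ ; size₃ = s≤ l₃ }
    go false true false true true false b₁₂ r₁₂ b₂₃ r₂₃ r₁₃ b₁₃ = record
      { cyclic = record
        { k₁ = cliqueˡ n₁₂ ; k₂ = cliqueʳ n₂₃ ; k₃ = cliqueˡ n₂₃
        ; d₁₂ = disjoint n₁₃ ; d₂₃ = dis-sym (disjoint n₂₃) ; d₃₁ = dis-sym (disjoint n₁₂)
        ; r₁₂ = r₁₃ ; b₁₂ = b₁₃ ; r₂₃ = flip r₂₃ ; b₂₃ = unflip b₂₃ ; r₃₁ = flip r₁₂ ; b₃₁ = unflip b₁₂ }
      ; na₁₂ = n₁₃ ; na₂₃ = nonAdj-sym n₂₃ ; na₃₁ = nonAdj-sym n₁₂ ; size₁ = s≤ l₁ ; size₂ = s≤ l₃ ; size₃ = s≤ l₂ }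

  indep₃ : ∀ s {U W X} → Indep (naSize₃ s) (U ∷ W ∷ X ∷ []) → Stage₃ s
  indep₃ s {U} {W} {X} (l ∷ l′ ∷ l″ ∷ [] , (n ∷ n′ ∷ []) ∷ (n″ ∷ []) ∷ _)
    with U₁ , W₁ , p₁ , q₁ , eU₁ , eW₁ , c₁₂ , d₁₂ , t₁ , t₂ ← homogenise (homSize (homSize (4 + s))) U W l l′
    with U₂ , X₂ , p₂ , q₂ , eU₂ , eX₂ , c₁₃ , d₁₃ , t₅ , t₆ ← homogenise (homSize (4 + s)) U₁ X
           (≤-reflexive (sym eU₁)) (≤-trans (≤-homSize _) l″)
    with W₃ , X₃ , p₃ , q₃ , eW₃ , eX₃ , c₂₃ , d₂₃ , t₃ , t₄ ← homogenise (4 + s) W₁ X₂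
           (≤-trans (≤-homSize _) (≤-reflexive (sym eW₁))) (≤-reflexive (sym eX₂))
    with U₃ , r₃ , eU₃ ← choose (4 + s) U₂ (≤-trans (≤-homSize _) (≤-reflexive (sym eU₂)))
    = let U≼ = ≼-trans r₃ (≼-trans p₂ p₁)
          W≼ = ≼-trans p₃ q₁
          X≼ = ≼-trans q₃ q₂
      in orient₃ eU₃ eW₃ eX₃
        (nonAdj-≼ U≼ W≼ (2≤ eU₃) (2≤ eW₃) n) (nonAdj-≼ W≼ X≼ (2≤ eW₃) (2≤ eX₃) n″)
        (nonAdj-≼ U≼ X≼ (2≤ eU₃) (2≤ eX₃) n′)
        c₁₂ d₁₂ c₂₃ d₂₃ c₁₃ d₁₃
        (T-≼ (≼-trans r₃ p₂) (≼-trans r₃ p₂) p₃ t₁) (T-≼ (≼-trans r₃ p₂) p₃ p₃ t₂) t₃ t₄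
        (T-≼ r₃ r₃ q₃ t₅) (T-≼ r₃ q₃ q₃ t₆)

  orient : ∀ s {U W} → NonAdj U W → homSize (4 + s) ≤ length U → homSize (4 + s) ≤ length W →
    ∃₂ λ U′ W′ → U′ ≼ U × W′ ≼ W × length U′ ≡ 4 + s × length W′ ≡ 4 + s × (T false U′ U′ W′ ⊎ T false W′ W′ U′)
  orient s {U} {W} n l l′ with homogenise (4 + s) U W l l′
  ... | U′ , W′ , p , q , e , e′ , false , _ , t , _ = U′ , W′ , p , q , e , e′ , inj₁ t
  ... | U′ , W′ , p , q , e , e′ , true , false , _ , t = U′ , W′ , p , q , e , e′ , inj₂ (flip t)
  ... | U′ , W′ , p , q , e , e′ , true , true , t , t′ =
    ⊥-elim (notBothRed (nonAdj-≼ p q (2≤ e) (2≤ e′) n) t t′)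

  -- After shrinking, one of `A` and `B` misses the other, and then it misses two cliques.
  commonMiss : ∀ {U A B} → NonAdj U A → NonAdj U B → NonAdj A B → 2 ≤ length U →
    homSize 4 ≤ length A → homSize 4 ≤ length B → T false A A U → T false B B U → ⊥
  commonMiss nA nB n l lA lB tA tB with orient 0 n lA lB
  ... | A′ , B′ , p , q , e , e′ , inj₁ t = notMissBoth (nonAdj-sym (nonAdj-≼ ≼-refl p l (2≤ e) nA))
        (nonAdj-≼ p q (2≤ e) (2≤ e′) n) (nonAdj-≼ ≼-refl q l (2≤ e′) nB) (4≤ e) (T-≼ p p ≼-refl tA) t
  ... | A′ , B′ , p , q , e , e′ , inj₂ t = notMissBoth (nonAdj-sym (nonAdj-≼ ≼-refl q l (2≤ e′) nB))
        (nonAdj-sym (nonAdj-≼ p q (2≤ e) (2≤ e′) n)) (nonAdj-≼ ≼-refl p l (2≤ e) nA) (4≤ e′) (T-≼ q q ≼-refl tB) t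

  missSize-2≤ : ∀ {k} → missSize 3 ≤ k → 2 ≤ k
  missSize-2≤ le = ≤-trans (s≤s (s≤s z≤n)) (≤-trans (≤-homSize (4 + missSize 2)) le)

  restrict : ∀ {X X′ Y} → X′ ≼ X → T false X X Y ⊎ T false Y Y X → T false X′ X′ Y ⊎ T false Y Y X′
  restrict p (inj₁ t) = inj₁ (T-≼ p p ≼-refl t)
  restrict p (inj₂ t) = inj₂ (T-≼ ≼-refl ≼-refl p t)

  -- Two of the three misses at `U` point the same way: outwards they contradict `notMissBoth`,
  -- inwards `commonMiss`.
  fourOrientations : ∀ {U A B D} → 4 ≤ length U → NonAdj U A → NonAdj U B → NonAdj U D → NonAdj A B → NonAdj A D → NonAdj B D →
    missSize 0 ≤ length A → missSize 0 ≤ length B → missSize 0 ≤ length D →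
    T false U U A ⊎ T false A A U → T false U U B ⊎ T false B B U → T false U U D ⊎ T false D D U → ⊥
  fourOrientations l nA nB nD nAB nAD nBD lA lB lD (inj₁ a) (inj₁ b) _ = notMissBoth nA nB nAB l a b
  fourOrientations l nA nB nD nAB nAD nBD lA lB lD (inj₁ a) (inj₂ b) (inj₁ d) = notMissBoth nA nD nAD l a d
  fourOrientations l nA nB nD nAB nAD nBD lA lB lD (inj₁ a) (inj₂ b) (inj₂ d) = commonMiss nB nD nBD (≤-trans (s≤s (s≤s z≤n)) l) lB lD b d
  fourOrientations l nA nB nD nAB nAD nBD lA lB lD (inj₂ a) (inj₁ b) (inj₁ d) = notMissBoth nB nD nBD l b d
  fourOrientations l nA nB nD nAB nAD nBD lA lB lD (inj₂ a) (inj₁ b) (inj₂ d) = commonMiss nA nD nAD (≤-trans (s≤s (s≤s z≤n)) l) lA lD a d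
  fourOrientations l nA nB nD nAB nAD nBD lA lB lD (inj₂ a) (inj₂ b) _ = commonMiss nA nB nAB (≤-trans (s≤s (s≤s z≤n)) l) lA lB a b

  indep₄ : ∀ {U A B D} → Indep naSize₄ (U ∷ A ∷ B ∷ D ∷ []) → ⊥
  indep₄ {U} {A} {B} {D} (l ∷ lA ∷ lB ∷ lD ∷ [] , (nA ∷ nB ∷ nD ∷ []) ∷ (nAB ∷ nAD ∷ []) ∷ (nBD ∷ []) ∷ _)
    with U₁ , A₁ , p₁ , pA , f₁ , eA , oA ← orient (missSize 2) nA l lA
    with U₂ , B₂ , p₂ , pB , f₂ , eB , oB ← orient (missSize 1) (nonAdj-≼ p₁ ≼-refl (2≤ f₁) (missSize-2≤ lB) nB)
           (s≤ f₁) (≤-trans (missSize-suc 2) lB)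
    with U₃ , D₃ , p₃ , pD , f₃ , eD , oD ← orient (missSize 0) (nonAdj-≼ (≼-trans p₂ p₁) ≼-refl (2≤ f₂) (missSize-2≤ lD) nD)
           (s≤ f₂) (≤-trans (missSize-suc 1) (≤-trans (missSize-suc 2) lD))
    = fourOrientations (4≤ f₃) (nonAdj-≼ U≼ pA (2≤ f₃) (2≤ eA) nA) (nonAdj-≼ U≼ pB (2≤ f₃) (2≤ eB) nB) (nonAdj-≼ U≼ pD (2≤ f₃) (2≤ eD) nD)
        (nonAdj-≼ pA pB (2≤ eA) (2≤ eB) nAB) (nonAdj-≼ pA pD (2≤ eA) (2≤ eD) nAD) (nonAdj-≼ pB pD (2≤ eB) (2≤ eD) nBD)
        (≤-trans (missSize-suc 0) (≤-trans (missSize-suc 1) (s≤ eA))) (≤-trans (missSize-suc 0) (s≤ eB)) (s≤ eD)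
        (restrict (≼-trans p₃ p₂) oA) (restrict p₃ oB) oD
    where U≼ = ≼-trans p₃ (≼-trans p₂ p₁)

-- Merging and absorbing

-- The relation may be proved with the remaining list in hand, as a merge of two paths requires.
allPairs-from : ∀ {A : Set} {R : A → A → Set} xs →
  (∀ x y rest → xs ↭ x ∷ y ∷ rest → R x y) → AllPairs R xs
allPairs-from [] f = []
allPairs-from (x ∷ xs) f =
  All.tabulate (λ y∈ → let r , p = ∈⇒≼ y∈ in f x _ r (prep x p)) ∷
  allPairs-from xs (λ y z rest p → f y z (x ∷ rest) (↭-trans (prep x p) (↭-sym (Perm.shift x (y ∷ z ∷ []) rest))))

concat-↭ : ∀ {A B : Set} (f : A → List B) {xs ys : List A} → xs ↭ ys → concat (map f xs) ↭ concat (map f ys)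
concat-↭ f _↭_.refl = ↭-refl
concat-↭ f (prep x p) = Perm.++⁺ˡ (f x) (concat-↭ f p)
concat-↭ f (swap x y p) = ↭-trans (Perm.shifts (f x) (f y)) (Perm.++⁺ˡ (f y) (Perm.++⁺ˡ (f x) (concat-↭ f p)))
concat-↭ f (_↭_.trans p q) = ↭-trans (concat-↭ f p) (concat-↭ f q)

opaque
  linkSize : ℕ
  linkSize = R₂ 4 4

  linkSize-bound : ∀ {k} → linkSize ≤ k → R₂ 4 4 ≤ k
  linkSize-bound le = le

-- Each absorbed vertex costs four vertices of one side; the base keeps enough for one more
-- application of Ramsey's theorem to a link.
absorbSize : ℕ → ℕ
absorbSize zero = 4 + linkSize
absorbSize (suc k) = 4 + absorbSize k

absorbSize-link : ∀ k → linkSize ≤ absorbSize k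
absorbSize-link zero = m≤n+m _ 4
absorbSize-link (suc k) = ≤-trans (absorbSize-link k) (m≤n+m _ 4)

absorbSize-mono : ∀ {j k} → j ≤ k → absorbSize j ≤ absorbSize k
absorbSize-mono {k = zero} z≤n = ≤-refl
absorbSize-mono {k = suc k} z≤n = ≤-trans (absorbSize-mono {k = k} z≤n) (m≤n+m _ 4)
absorbSize-mono (s≤s le) = +-monoʳ-≤ 4 (absorbSize-mono le)

rest≼ : ∀ {A : Set} {a b d e : A} {r xs : List A} → xs ↭ a ∷ b ∷ d ∷ e ∷ r → r ≼ xs
rest≼ {a = a} {b} {d} {e} {r} p = ≼-trans (≼-++ʳ (a ∷ b ∷ d ∷ e ∷ []) r) (↭⇒≼ p)

drop4 : ∀ {A : Set} {a b d e : A} {r xs : List A} {k} → xs ↭ a ∷ b ∷ d ∷ e ∷ r → 4 + k ≤ length xs → k ≤ length r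
drop4 p le = +-cancelˡ-≤ 4 _ _ (≤-trans le (≤-reflexive (Perm.↭-length p)))

module Process {N : ℕ} (c : Colouring N) (noFano : ¬ FanoCopy c blue) where
  open Colour c
  open NoFano c noFano
  open Stages c noFano

  module _ (r k : ℕ) (2≤k : 2 ≤ k) (noIndep : ∀ Us → length Us ≡ suc r → Indep k Us → ⊥)
    {X : List V} (uX : Unique X)
    (final : ∀ (Ps : List (HPath k)) L → length Ps ≤ r → length L ≤ cliqueSize (k + k) →
      AllPairs (λ P Q → NonAdj (tl P) (tl Q)) Ps → X ↭ concat (map verts Ps) ++ L → ⊥) where

    -- The number of paths plus leftover vertices drops when a red clique in `L` becomes a path,
    -- since at least two vertices are replaced by one path, and also when two paths merge. If
    -- neither is possible, the tails are pairwise non-adjacent, so there are at most `r` paths.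
    process : ∀ m (Ps : List (HPath k)) L → length Ps + length L < m → X ↭ concat (map verts Ps) ++ L → ⊥
    process (suc m) Ps L (s≤s lt) p with cliqueSize (k + k) ≤? length L
    ... | yes le =
      let S , (rest , q) , e , kS = redClique (k + k) L (unique-++ʳ (concat (map verts Ps)) (unique-↭ p uX)) le
          P , vP = cliqueHPath kS e
          1<S : 2 ≤ length S
          1<S = ≤-trans 2≤k (≤-trans (m≤m+n k k) (≤-reflexive (sym e)))
      in process m (P ∷ Ps) rest
        (≤-trans (≤-trans
          (≤-reflexive (cong suc (sym (+-suc (length Ps) (length rest)))))
          (≤-trans (≤-reflexive (sym (+-suc (length Ps) (suc (length rest)))))
            (+-monoʳ-≤ (length Ps) (≤-trans (+-monoˡ-≤ (length rest) 1<S)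
              (≤-reflexive (trans (sym (length-++ S)) (sym (Perm.↭-length q))))))))
          lt)
        (↭-trans p (↭-trans (Perm.++⁺ˡ (concat (map verts Ps)) q)
          (↭-trans (solve 3 (λ a b d → a ⊕ (b ⊕ d) ⊜ (b ⊕ a) ⊕ d) ↭-refl (concat (map verts Ps)) S rest)
            (Perm.++⁺ʳ rest (Perm.++⁺ʳ (concat (map verts Ps)) (↭-sym vP))))))
    ... | no nle = conclude
      where
      Vs : List V
      Vs = concat (map verts Ps)
      pair : ∀ P Q rest → Ps ↭ P ∷ Q ∷ rest → NonAdj (tl P) (tl Q)
      pair P Q rest q = record
        { cliqueˡ = clique (unique-++ˡ (tl P) uPQ) (tl-clique P)
        ; cliqueʳ = clique (unique-++ʳ (tl P) uPQ) (tl-clique Q)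
        ; disjoint = unique-dis (tl P) uPQ
        -- An adjacency would permit a merge, and the induction refutes the merged configuration.
        ; nonadj = λ a → let R , vR = join 2≤k P Q a in
            process m (R ∷ rest) L
              (≤-trans (≤-reflexive (cong (_+ length L) (sym (Perm.↭-length q)))) lt)
              (↭-trans p (Perm.++⁺ʳ L (↭-trans (concat-↭ verts q)
                (↭-trans (↭-sym (Perm.++-assoc (verts P) (verts Q) _)) (Perm.++⁺ʳ _ (↭-sym vR)))))) }
        where
        uPQ : Unique (tl P ++ tl Q)
        uPQ = ≼-unique
          (≼-trans (≼-++ (tail≼ P) (tail≼ Q))
          (≼-trans (≼-++ˡ (verts P ++ verts Q) _)
          (≼-trans (↭⇒≼ (↭-trans (concat-↭ verts q) (↭-sym (Perm.++-assoc (verts P) (verts Q) _))))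
          (≼-trans (≼-++ˡ Vs L) (↭⇒≼ p))))) uX
      pairs : AllPairs (λ P Q → NonAdj (tl P) (tl Q)) Ps
      pairs = allPairs-from Ps pair
      conclude : ⊥
      conclude with suc r ≤? length Ps
      ... | no few = final Ps L (≤-pred (≰⇒> few)) (<⇒≤ (≰⇒> nle)) pairs p
      ... | yes many = noIndep (map tl (take (suc r) Ps))
        (trans (length-map tl (take (suc r) Ps)) (trans (length-take (suc r) Ps) (m≤n⇒m⊓n≡m many)))
        (AllP.map⁺ (All.tabulate (λ {P} _ → ≤-reflexive (sym (tl-length P)))) , PairsP.map⁺ (PairsP.take⁺ (suc r) pairs))

  -- Either v has a red K₄ in its link on H₂, or a blue K₄, and then its whole link on H₁ is red.
  absorb : (Φ : List V → List V → Set) →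
    (∀ x {a₁ a₂ l a₃ a₄} y D → Φ (x ++ a₁ ∷ a₂ ∷ a₃ ∷ a₄ ∷ y) D →
      col c a₁ a₂ l ≡ true → col c a₂ l a₃ ≡ true → col c l a₃ a₄ ≡ true →
      Φ (x ++ a₁ ∷ a₂ ∷ l ∷ a₃ ∷ a₄ ∷ y) D) →
    (∀ x {a₁ a₂ l a₃ a₄} y D → Φ D (x ++ a₁ ∷ a₂ ∷ a₃ ∷ a₄ ∷ y) →
      col c a₁ a₂ l ≡ true → col c a₂ l a₃ ≡ true → col c l a₃ a₄ ≡ true →
      Φ D (x ++ a₁ ∷ a₂ ∷ l ∷ a₃ ∷ a₄ ∷ y)) →
    ∀ H₁ H₂ L → Unique (H₁ ++ H₂ ++ L) → T false H₁ H₂ H₂ →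
    absorbSize (length L) ≤ length H₁ → absorbSize (length L) ≤ length H₂ →
    (∀ {H₁′ H₂′} → H₁′ ↭ H₁ → H₂′ ↭ H₂ → Φ H₁′ H₂′) →
    ∃₂ λ D₁ D₂ → Φ D₁ D₂ × D₁ ++ D₂ ↭ H₁ ++ H₂ ++ L
  absorb Φ ins₁ ins₂ H₁ H₂ [] u t l₁ l₂ φ =
    H₁ , H₂ , φ ↭-refl ↭-refl , Perm.++⁺ˡ H₁ (↭-sym (Perm.++-identityʳ H₂))
  absorb Φ ins₁ ins₂ H₁ H₂ (v ∷ L) u t l₁ l₂ φ
    with ramsey₂ (col c v) (link-sym v) 4 4 H₂ (linkSize-bound (≤-trans (absorbSize-link (suc (length L))) l₂))
  ... | inj₁ (a ∷ b ∷ d ∷ e ∷ [] , S≼@(r , p) , refl , m)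
    with (ab ∷ ad ∷ ae ∷ []) ∷ (bd ∷ be ∷ []) ∷ (de ∷ []) ∷ _ ←
           ≼-unique (≼-trans S≼ (≼-trans (≼-++ˡ H₂ (v ∷ L)) (≼-++ʳ H₁ _))) u
    -- The finished block around `v` is moved into the predicate, so the recursion sees only the
    -- vertices of `H₁` and `H₂` that are still free to be reordered.
    = let D₁ , D₂ , φ′ , q = absorb (λ D₁ D₂ → Φ D₁ (a ∷ b ∷ v ∷ d ∷ e ∷ D₂))
            (λ x y D → ins₁ x y (a ∷ b ∷ v ∷ d ∷ e ∷ D)) (λ x y → ins₂ (a ∷ b ∷ v ∷ d ∷ e ∷ x) y)
            H₁ r L (≼-unique (≼-++ (≼-refl {xs = H₁}) (≼-++ (rest≼ p) (≼-++ʳ (v ∷ []) L))) u)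
            (T-≼ ≼-refl (rest≼ p) (rest≼ p) t) (≤-trans (m≤n+m _ 4) l₁) (drop4 p l₂)
            (λ {H₁′} {H₂′} p₁ p₂ → ins₂ [] H₂′ H₁′ (φ p₁ (↭-trans (Perm.++⁺ˡ (a ∷ b ∷ d ∷ e ∷ []) p₂) (↭-sym p)))
              (trans (rot a b) (m (here refl) (there (here refl)) ab))
              (trans (sym₁₂ c _ _ _) (m (there (here refl)) (there (there (here refl))) bd))
              (m (there (there (here refl))) (there (there (there (here refl)))) de))
      in D₁ , a ∷ b ∷ v ∷ d ∷ e ∷ D₂ , φ′ ,
        ↭-trans (solve 5 (λ x f g h y → x ⊕ (f ⊕ (g ⊕ (h ⊕ y))) ⊜ (f ⊕ (g ⊕ h)) ⊕ (x ⊕ y)) ↭-refl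
            D₁ (a ∷ b ∷ []) (v ∷ []) (d ∷ e ∷ []) D₂)
        (↭-trans (Perm.++⁺ˡ (a ∷ b ∷ v ∷ d ∷ e ∷ []) q)
        (↭-trans (solve 6 (λ f g h x y z → (f ⊕ (g ⊕ h)) ⊕ (x ⊕ (y ⊕ z)) ⊜ x ⊕ ((f ⊕ (h ⊕ y)) ⊕ (g ⊕ z))) ↭-refl
            (a ∷ b ∷ []) (v ∷ []) (d ∷ e ∷ []) H₁ r L)
          (Perm.++⁺ˡ H₁ (Perm.++⁺ʳ (v ∷ L) (↭-sym p)))))
    where
    rot : ∀ x y → col c x y v ≡ col c v x y
    rot x y = trans (sym₂₃ c _ _ _) (sym₁₂ c _ _ _)
  absorb Φ ins₁ ins₂ H₁ H₂ (v ∷ L) u t l₁ l₂ φ | inj₂ (G , G≼ , eG , m)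
    with a ∷ b ∷ d ∷ e ∷ [] , r , p , refl ← split 4 H₁ (≤-trans (m≤m+n 4 _) l₁)
    with (ab ∷ ad ∷ ae ∷ []) ∷ (bd ∷ be ∷ []) ∷ (de ∷ []) ∷ _ ← ≼-unique (≼-trans (r , p) (≼-++ˡ H₁ _)) u
    = let D₁ , D₂ , φ′ , q = absorb (λ D₁ D₂ → Φ (a ∷ b ∷ v ∷ d ∷ e ∷ D₁) D₂)
            (λ x y → ins₁ (a ∷ b ∷ v ∷ d ∷ e ∷ x) y) (λ x y D → ins₂ x y (a ∷ b ∷ v ∷ d ∷ e ∷ D))
            r H₂ L (≼-unique (≼-++ (rest≼ p) (≼-++ (≼-refl {xs = H₂}) (≼-++ʳ (v ∷ []) L))) u)
            (T-≼ (rest≼ p) ≼-refl ≼-refl t) (drop4 p l₁) (≤-trans (m≤n+m _ 4) l₂)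
            (λ {H₁′} {H₂′} p₁ p₂ → ins₁ [] H₁′ H₂′ (φ (↭-trans (Perm.++⁺ˡ (a ∷ b ∷ d ∷ e ∷ []) p₁) (↭-sym p)) p₂)
              (red-v (here refl) (there (here refl)) ab)
              (trans (sym₂₃ c _ _ _) (red-v (there (here refl)) (there (there (here refl))) bd))
              (trans (trans (sym₁₂ c _ _ _) (sym₂₃ c _ _ _)) (red-v (there (there (here refl))) (there (there (there (here refl)))) de)))
      in a ∷ b ∷ v ∷ d ∷ e ∷ D₁ , D₂ , φ′ ,
        ↭-trans (Perm.++⁺ˡ (a ∷ b ∷ v ∷ d ∷ e ∷ []) q)
        (↭-trans (solve 6 (λ f g h x y z → (f ⊕ (g ⊕ h)) ⊕ (x ⊕ (y ⊕ z)) ⊜ (f ⊕ (h ⊕ x)) ⊕ (y ⊕ (g ⊕ z))) ↭-refl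
            (a ∷ b ∷ []) (v ∷ []) (d ∷ e ∷ []) r H₂ L)
          (Perm.++⁺ʳ (H₂ ++ v ∷ L) (↭-sym p)))
    where
    v∉H₁ : v ∉ H₁
    v∉H₁ v∈ = unique-dis H₁ u v∈ (∈-++⁺ʳ H₂ (here refl))
    v∉H₂ : v ∉ H₂
    v∉H₂ v∈ = unique-dis H₂ (unique-++ʳ H₁ u) v∈ (here refl)
    dis : Dis H₁ H₂
    dis p q = unique-dis H₁ u p (∈-++⁺ˡ q)
    link : ∀ {x} → x ∈ H₁ → Mono false (col c x) G
    link x∈ y∈ z∈ = t x∈ (≼-⊆ G≼ y∈) (≼-⊆ G≼ z∈) (apart dis x∈ (≼-⊆ G≼ y∈)) (apart dis x∈ (≼-⊆ G≼ z∈))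
    red-v : ∀ {x y} → x ∈ a ∷ b ∷ d ∷ e ∷ [] → y ∈ a ∷ b ∷ d ∷ e ∷ [] → x ≢ y → col c x y v ≡ true
    red-v x∈ y∈ x≢y = blueLinks⇒red (≼-unique (≼-trans G≼ (≼-trans (≼-++ˡ H₂ _) (≼-++ʳ H₁ _))) u)
      (≤-reflexive (sym eG))
      (λ x∈G → dis (≼-⊆ (r , p) x∈) (≼-⊆ G≼ x∈G)) (λ y∈G → dis (≼-⊆ (r , p) y∈) (≼-⊆ G≼ y∈G))
      (λ v∈G → v∉H₂ (≼-⊆ G≼ v∈G)) x≢y
      (λ { refl → v∉H₁ (≼-⊆ (r , p) x∈) }) (λ { refl → v∉H₁ (≼-⊆ (r , p) y∈) })
      (link (≼-⊆ (r , p) x∈)) (link (≼-⊆ (r , p) y∈)) m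

-- Two paths that partition the vertices

connSize : ℕ
connSize = naSize₄ + absorbSize (cliqueSize (naSize₄ + naSize₄))

module Endgame {N : ℕ} (c : Colouring N) (noFano : ¬ FanoCopy c blue)
  {n : ℕ} (size : suc N ≡ n + n)
  (noPath : ∀ Q → Unique Q → Colour.RedPath c Q → length Q < n) where
  open Colour c
  open NoFano c noFano
  open Stages c noFano
  open Process c noFano

  uniqueAll : Unique (allFin N)
  uniqueAll = Uniq.allFin⁺ N

  -- Two parts of at most n - 1 vertices each make at most 2n - 2, one fewer than `N`.
  halves : ∀ {Q R} → allFin N ↭ Q ++ R → length Q < n → length R < n → ⊥
  halves {Q} {R} p q r = <-irrefl refl (begin-strict
    length Q + suc (length R)         <⟨ ≤-refl ⟩
    suc (length Q) + suc (length R)   ≤⟨ +-mono-≤ q r ⟩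
    n + n                             ≡⟨ sym size ⟩
    suc N                             ≡⟨ cong suc (trans (sym (length-allFin N)) (trans (Perm.↭-length p) (length-++ Q))) ⟩
    suc (length Q + length R)         ≡⟨ sym (+-suc (length Q) (length R)) ⟩
    length Q + suc (length R)         ∎)
    where
    open ≤-Reasoning
    length-allFin : ∀ m → length (allFin m) ≡ m
    length-allFin m = length-tabulate {n = m} (λ i → i)

  onePath : ∀ {Q R} → allFin N ↭ Q ++ R → RedPath Q → length R < n → ⊥
  onePath {Q} {R} p q = halves {Q} {R} p (noPath Q (unique-++ˡ Q (unique-↭ p uniqueAll)) q)

  twoPaths : ∀ {Q R} → allFin N ↭ Q ++ R → RedPath Q → RedPath R → ⊥
  twoPaths {Q} {R} p q r = onePath p q (noPath R (unique-++ʳ Q (unique-↭ p uniqueAll)) r)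

  hpath-path : ∀ {k} (P : HPath k) → RedPath (verts P)
  hpath-path P = path P ↭-refl ↭-refl

  -- A red path on U ++ A that can be continued by whatever continues every ordering of A.
  LeftEnd RightEnd : List V → List V → Set
  LeftEnd A U = ∃ λ α → α ↭ U ++ A × ∀ Z → (∀ {A′} → A′ ↭ A → RedPath (A′ ++ Z)) → RedPath (α ++ Z)
  RightEnd A U = ∃ λ α → α ↭ U ++ A × ∀ Z → (∀ {A′} → A′ ↭ A → RedPath (Z ++ A′)) → RedPath (Z ++ α)

  bare : ∀ A → LeftEnd A []
  bare A = A , ↭-refl , λ Z f → f ↭-refl

  -- The adjacency dictates an order of `tl P`, which `P` tolerates, and an order `A₀` of `A`, which
  -- the continuation tolerates.
  attach : ∀ {k A} (P : HPath k) → 2 ≤ k → 2 ≤ length A → Adj (tl P) A → LeftEnd A (verts P)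
  attach {k} {A} P 2≤k 2≤A (F , A₀ , p , q , r) = (hd P ++ mid P ++ F) ++ A₀ ,
    Perm.++⁺ (Perm.++⁺ˡ (hd P) (Perm.++⁺ˡ (mid P) p)) q ,
    λ Z f → subst RedPath (sym (++-assoc (hd P ++ mid P ++ F) A₀ Z))
      (path-glue (hd P ++ mid P ++ F) A₀ Z (≤-trans 2≤A (≤-reflexive (sym (Perm.↭-length q))))
        (subst RedPath (trans (++-assoc (hd P) (mid P) _) (trans (cong (hd P ++_) (sym (++-assoc (mid P) F A₀))) (sym (++-assoc (hd P) (mid P ++ F) A₀))))
          (path-glue (hd P ++ mid P) F A₀ (≤-trans 2≤k (≤-reflexive (trans (sym (tl-length P)) (sym (Perm.↭-length p)))))
            (subst RedPath (sym (++-assoc (hd P) (mid P) F)) (path P ↭-refl p)) r))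
        (f q))

  mirror : ∀ {A U} → LeftEnd A U → RightEnd A U
  mirror {A} (α , p , f) = reverse α , ↭-trans (Perm.↭-reverse α) p , λ Z g →
    subst RedPath (trans (reverse-++ α (reverse Z)) (cong (_++ reverse α) (reverse-involutive Z)))
      (path-reverse (α ++ reverse Z) (f (reverse Z) λ {A′} q →
        subst RedPath (trans (reverse-++ Z (reverse A′)) (cong (_++ reverse Z) (reverse-involutive A′)))
          (path-reverse (Z ++ reverse A′) (g (↭-trans (Perm.↭-reverse A′) q)))))

  insertWithin : ∀ α β x {a₁ a₂ l a₃ a₄} y → RedPath (α ++ (x ++ a₁ ∷ a₂ ∷ a₃ ∷ a₄ ∷ y) ++ β) →
    col c a₁ a₂ l ≡ true → col c a₂ l a₃ ≡ true → col c l a₃ a₄ ≡ true →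
    RedPath (α ++ (x ++ a₁ ∷ a₂ ∷ l ∷ a₃ ∷ a₄ ∷ y) ++ β)
  insertWithin α β x y p r r′ r″ = subst RedPath (eq _) (path-insert (α ++ x) (y ++ β) (subst RedPath (sym (eq _)) p) r r′ r″)
    where
    eq : ∀ w → (α ++ x) ++ w ++ β ≡ α ++ (x ++ w) ++ β
    eq w = trans (++-assoc α x (w ++ β)) (cong (α ++_) (sym (++-assoc x w β)))

  oneStage : ∀ k → 2 ≤ k → (∀ Us → length Us ≡ 2 → Indep k Us → ⊥) → cliqueSize (k + k) < n → ⊥
  oneStage k 2≤k noIndep small = process 1 k 2≤k noIndep uniqueAll final (suc N) [] (allFin N) (s≤s (≤-reflexive (length-tabulate {n = N} (λ i → i)))) ↭-refl
    where
    final : ∀ (Ps : List (HPath k)) L → length Ps ≤ 1 → length L ≤ cliqueSize (k + k) →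
      AllPairs (λ P Q → NonAdj (tl P) (tl Q)) Ps → allFin N ↭ concat (map verts Ps) ++ L → ⊥
    final [] L _ l _ p = onePath {[]} {L} p tt (≤-<-trans l small)
    final (P ∷ []) L _ l _ p = onePath (↭-trans p (Perm.++⁺ʳ L (Perm.++-identityʳ (verts P)))) (hpath-path P) (≤-<-trans l small)
    final (_ ∷ _ ∷ _) L (s≤s ()) _ _ _

  -- p, q, r, s: the path ends F₁, F₂ are adjacent to A₁, A₂ in the order F₁A₁, F₂A₂, F₂A₁, F₁A₂.
  matching₂ : ∀ {p q r s : Set} → (p → q → ⊥) → (r → s → ⊥) →
    (¬ p → ¬ r → ⊥) → (¬ s → ¬ q → ⊥) → (¬ p → ¬ s → ⊥) → (¬ q → ¬ r → ⊥) → ⊥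
  matching₂ pq rs pr sq ps qr = pr no-p (λ r → ps no-p (rs r))
    where no-p = λ p → qr (pq p) (λ r → sq (rs r) (pq p))

  -- The i-th path runs through `Uᵢ`, `Aᵢ` and then `Hᵢ`; the leftover `L` is inserted into the two
  -- stretches `H₁` and `H₂`.
  finish₂ : ∀ {A₁ A₂ H₁ H₂ U₁ U₂ L} → Clique (A₁ ++ H₁) → Clique (A₂ ++ H₂) → T false H₁ H₂ H₂ →
    LeftEnd A₁ U₁ → LeftEnd A₂ U₂ →
    absorbSize (length L) ≤ length H₁ → absorbSize (length L) ≤ length H₂ →
    allFin N ↭ (A₁ ++ H₁) ++ (A₂ ++ H₂) ++ (U₁ ++ U₂ ++ L) → ⊥
  finish₂ {A₁} {A₂} {H₁} {H₂} {U₁} {U₂} {L} k₁ k₂ t (α₁ , p₁ , f₁) (α₂ , p₂ , f₂) l₁ l₂ p =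
    let D₁ , D₂ , (q₁ , q₂) , q = absorb
          (λ D₁ D₂ → RedPath (α₁ ++ D₁ ++ []) × RedPath (α₂ ++ D₂ ++ []))
          (λ x y D (r , r′) s s′ s″ → insertWithin α₁ [] x y r s s′ s″ , r′)
          (λ x y D (r , r′) s s′ s″ → r , insertWithin α₂ [] x y r′ s s′ s″)
          H₁ H₂ L (≼-unique (A₁ ++ A₂ ++ U₁ ++ U₂ , ↭-trans p
            (solve 7 (λ a h b g u w l → (a ⊕ h) ⊕ ((b ⊕ g) ⊕ (u ⊕ (w ⊕ l))) ⊜ (h ⊕ (g ⊕ l)) ⊕ (a ⊕ (b ⊕ (u ⊕ w)))) ↭-refl
              A₁ H₁ A₂ H₂ U₁ U₂ L)) uniqueAll) t l₁ l₂
          (λ q q′ → f₁ _ (along k₁ q) , f₂ _ (along k₂ q′))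
    in twoPaths (↭-trans p (↭-trans
        (solve 7 (λ a h b g u w l → (a ⊕ h) ⊕ ((b ⊕ g) ⊕ (u ⊕ (w ⊕ l))) ⊜ ((u ⊕ a) ⊕ (w ⊕ b)) ⊕ (h ⊕ (g ⊕ l))) ↭-refl
              A₁ H₁ A₂ H₂ U₁ U₂ L)
        (↭-trans (Perm.++⁺ (Perm.++⁺ (↭-sym p₁) (↭-sym p₂)) (↭-sym q))
          (solve 4 (λ a b d e → (a ⊕ b) ⊕ (d ⊕ e) ⊜ (a ⊕ (d ⊕ id)) ⊕ (b ⊕ (e ⊕ id))) ↭-refl α₁ α₂ D₁ D₂)))) q₁ q₂
    where
    along : ∀ {A H H′} → Clique (A ++ H) → H′ ↭ H → ∀ {A′} → A′ ↭ A → RedPath (A′ ++ H′ ++ [])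
    along k q q′ = clique-path (clique-≼ (↭⇒≼ (↭-sym (Perm.++⁺ q′ (↭-trans (Perm.++-identityʳ _) q)))) k)

  -- One path visits `U₂`, `A₂`, `H₂`, crosses the connector, and goes on through `H₁`, `A₁`, `U₁`,
  -- absorbing `L` on the way. The other path is `Q`.
  finish₃ : ∀ {A₁ A₂ H₁ H₂ U₁ U₂ Q L f f′ v g f″ g′ g″} →
    Clique ((A₂ ++ H₂) ++ f ∷ f′ ∷ []) → Clique (g′ ∷ g″ ∷ H₁ ++ A₁) → T false H₁ H₂ H₂ →
    RedPath (f ∷ f′ ∷ v ∷ g ∷ f″ ∷ g′ ∷ g″ ∷ []) → RedPath Q →
    LeftEnd A₁ U₁ → LeftEnd A₂ U₂ →
    absorbSize (length L) ≤ length H₁ → absorbSize (length L) ≤ length H₂ →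
    allFin N ↭ (f ∷ f′ ∷ v ∷ g ∷ f″ ∷ g′ ∷ g″ ∷ []) ++ (A₁ ++ H₁) ++ (A₂ ++ H₂) ++ (U₁ ++ U₂ ++ Q ++ L) → ⊥
  finish₃ {A₁} {A₂} {H₁} {H₂} {U₁} {U₂} {Q} {L} {f} {f′} {v} {g} {f″} {g′} {g″} k₂ k₁ t (c₁ , c₂ , c₃ , c₄ , c₅ , _) rQ left₁ (α , pα , fα) l₁ l₂ p =
    let β , pβ , fβ = mirror left₁
        D₁ , D₂ , r , q = absorb
          (λ D₁ D₂ → RedPath (α ++ D₂ ++ K ++ D₁ ++ β))
          (λ x y D r s s′ s″ → subst RedPath (sym (reassoc α D _ β)) (insertWithin (α ++ D ++ K) β x y (subst RedPath (reassoc α D _ β) r) s s′ s″))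
          (λ x y D r s s′ s″ → insertWithin α (K ++ D ++ β) x y r s s′ s″)
          H₁ H₂ L (≼-unique (K ++ A₁ ++ A₂ ++ U₁ ++ U₂ ++ Q , ↭-trans p
            (solve 9 (λ k a h b g u w q l → k ⊕ ((a ⊕ h) ⊕ ((b ⊕ g) ⊕ (u ⊕ (w ⊕ (q ⊕ l))))) ⊜ (h ⊕ (g ⊕ l)) ⊕ (k ⊕ (a ⊕ (b ⊕ (u ⊕ (w ⊕ q)))))) ↭-refl
              K A₁ H₁ A₂ H₂ U₁ U₂ Q L)) uniqueAll) t l₁ l₂
          (λ {H₁′} {H₂′} q₁ q₂ → fα _ λ {A₂′} qA₂ → subst RedPath (back A₂′ H₂′ H₁′ β) (fβ (A₂′ ++ H₂′ ++ K ++ H₁′) λ {A₁′} qA₁ →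
            subst RedPath (forth A₂′ H₂′ H₁′ A₁′)
              (path-glue (A₂′ ++ H₂′) (f ∷ f′ ∷ []) _ (s≤s (s≤s z≤n))
                (clique-path (clique-≼ (↭⇒≼ (Perm.++⁺ʳ (f ∷ f′ ∷ []) (↭-sym (Perm.++⁺ qA₂ q₂)))) k₂))
                (c₁ , c₂ , c₃ , c₄ , c₅ , clique-path (clique-≼ (↭⇒≼ (Perm.++⁺ˡ (g′ ∷ g″ ∷ []) (↭-sym (Perm.++⁺ q₁ qA₁)))) k₁)))))
    in twoPaths (↭-trans p (↭-trans
        (solve 9 (λ k a h b g u w q l → k ⊕ ((a ⊕ h) ⊕ ((b ⊕ g) ⊕ (u ⊕ (w ⊕ (q ⊕ l))))) ⊜ (((u ⊕ a) ⊕ (w ⊕ b)) ⊕ (h ⊕ (g ⊕ l))) ⊕ (k ⊕ q)) ↭-refl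
              K A₁ H₁ A₂ H₂ U₁ U₂ Q L)
        (↭-trans (Perm.++⁺ʳ (K ++ Q) (Perm.++⁺ (Perm.++⁺ (↭-sym pβ) (↭-sym pα)) (↭-sym q)))
          (solve 6 (λ b a d e k q → ((b ⊕ a) ⊕ (d ⊕ e)) ⊕ (k ⊕ q) ⊜ (a ⊕ (e ⊕ (k ⊕ (d ⊕ b)))) ⊕ q) ↭-refl β α D₁ D₂ K Q)))) r rQ
    where
    K : List V
    K = f ∷ f′ ∷ v ∷ g ∷ f″ ∷ g′ ∷ g″ ∷ []
    reassoc : ∀ a d w b → a ++ d ++ K ++ w ++ b ≡ (a ++ d ++ K) ++ w ++ b
    reassoc a d w b = trans (cong (a ++_) (sym (++-assoc d K (w ++ b)))) (sym (++-assoc a (d ++ K) (w ++ b)))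
    back : ∀ a h h′ b → (a ++ h ++ K ++ h′) ++ b ≡ a ++ h ++ K ++ h′ ++ b
    back a h h′ b = trans (++-assoc a (h ++ K ++ h′) b) (cong (a ++_) (++-assoc h (K ++ h′) b))
    forth : ∀ a h h′ b → (a ++ h) ++ f ∷ f′ ∷ v ∷ g ∷ f″ ∷ g′ ∷ g″ ∷ h′ ++ b ≡ (a ++ h ++ K ++ h′) ++ b
    forth a h h′ b = trans (++-assoc a h _) (sym (back a h h′ b))

  -- `A` is the place where an outer path attaches, `H` the stock for absorption.
  carve : ∀ k a (E : List V) → k + a ≤ length E → ∃₂ λ A H → A ++ H ≼ E × length A ≡ k × length H ≡ a
  carve k a E le =
    let A , R , p , eA = split k E (≤-trans (m≤m+n k a) le)
        H , H≼ , eH = choose a R (+-cancelˡ-≤ k a (length R)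
          (≤-trans le (≤-reflexive (trans (Perm.↭-length p) (trans (length-++ A) (cong (_+ length R) eA))))))
    in A , H , ≼-trans (≼-++ (≼-refl {xs = A}) H≼) (↭⇒≼ p) , eA , eH

  separated : ∀ {B X F A} → allFin N ↭ B ++ X → F ≼ X → A ≼ B → T true F F F → Clique A → ¬ Adj F A → NonAdj F A
  separated {B} p F≼ A≼ t k na = record
    { cliqueˡ = clique (≼-unique F≼ (unique-++ʳ B u)) t ; cliqueʳ = k
    ; disjoint = dis-≼ F≼ A≼ (dis-sym (unique-dis B u)) ; nonadj = na }
    where u = unique-↭ p uniqueAll

  -- Pieces of `E₁` and `E₂` are set aside before the rest is covered, so that they are intact when
  -- the paths have to be attached and the leftover absorbed.
  twoStage : ∀ k → 2 ≤ k → (∀ Us → length Us ≡ 3 → Indep k Us → ⊥) →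
    Stage₂ (k + absorbSize (cliqueSize (k + k))) →
    (k + absorbSize (cliqueSize (k + k))) + (k + absorbSize (cliqueSize (k + k))) + cliqueSize (k + k) < n → ⊥
  twoStage k 2≤k noIndep S small
    with A₁ , H₁ , p₁ , eA₁ , eH₁ ← carve k (absorbSize (cliqueSize (k + k))) (Stage₂.E₁ S) (Stage₂.size₁ S)
    with A₂ , H₂ , p₂ , eA₂ , eH₂ ← carve k (absorbSize (cliqueSize (k + k))) (Stage₂.E₂ S) (Stage₂.size₂ S)
    with X , pX ← unique-⊆⇒≼ (≼-unique (≼-++ p₁ p₂)
           (unique-++ (unique (cliqueˡ (Stage₂.na S))) (unique (cliqueʳ (Stage₂.na S))) (disjoint (Stage₂.na S)))) (λ {v} _ → ∈-allFin v)
    = process 2 k 2≤k noIndep (unique-++ʳ B (unique-↭ pX uniqueAll)) final (suc (length X)) [] X ≤-refl ↭-refl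
    where
    open Stage₂ S
    B : List V
    B = (A₁ ++ H₁) ++ (A₂ ++ H₂)
    a : ℕ
    a = absorbSize (cliqueSize (k + k))
    k₁ : Clique (A₁ ++ H₁)
    k₁ = clique-≼ p₁ (cliqueˡ na)
    k₂ : Clique (A₂ ++ H₂)
    k₂ = clique-≼ p₂ (cliqueʳ na)
    B-length : length B ≡ (k + a) + (k + a)
    B-length = trans (length-++ (A₁ ++ H₁)) (cong₂ _+_ (trans (length-++ A₁) (cong₂ _+_ eA₁ eH₁)) (trans (length-++ A₂) (cong₂ _+_ eA₂ eH₂)))
    few : ∀ {L} → length L ≤ cliqueSize (k + k) → length (B ++ L) < n
    few {L} l = ≤-<-trans (≤-trans (≤-reflexive (trans (length-++ B) (cong (_+ length L) B-length))) (+-monoʳ-≤ ((k + a) + (k + a)) l)) small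
    A₁≼ : A₁ ≼ B
    A₁≼ = ≼-trans (≼-++ˡ A₁ H₁) (≼-++ˡ (A₁ ++ H₁) (A₂ ++ H₂))
    A₂≼ : A₂ ≼ B
    A₂≼ = ≼-trans (≼-++ˡ A₂ H₂) (≼-++ʳ (A₁ ++ H₁) (A₂ ++ H₂))
    2≤A : ∀ {j} → j ≡ k → 2 ≤ j
    2≤A e = ≤-trans 2≤k (≤-reflexive (sym e))
    naA : NonAdj A₁ A₂
    naA = nonAdj-≼ (≼-trans (≼-++ˡ A₁ H₁) p₁) (≼-trans (≼-++ˡ A₂ H₂) p₂) (2≤A eA₁) (2≤A eA₂) na
    match : ∀ P Q L → length L ≤ cliqueSize (k + k) → X ↭ verts {k} P ++ verts {k} Q ++ L → Adj (tl P) A₁ → Adj (tl Q) A₂ → ⊥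
    match P Q L l q a₁ a₂ = finish₂ k₁ k₂
      (T-≼ (≼-trans (≼-++ʳ A₁ H₁) p₁) (≼-trans (≼-++ʳ A₂ H₂) p₂) (≼-trans (≼-++ʳ A₂ H₂) p₂) b₁₂)
      (attach P 2≤k (2≤A eA₁) a₁) (attach Q 2≤k (2≤A eA₂) a₂)
      (≤-trans (absorbSize-mono l) (≤-reflexive (sym eH₁))) (≤-trans (absorbSize-mono l) (≤-reflexive (sym eH₂)))
      (↭-trans pX (↭-trans (Perm.++⁺ˡ B q) (Perm.++-assoc (A₁ ++ H₁) (A₂ ++ H₂) _)))
    final : ∀ (Ps : List (HPath k)) L → length Ps ≤ 2 → length L ≤ cliqueSize (k + k) →
      AllPairs (λ P Q → NonAdj (tl P) (tl Q)) Ps → X ↭ concat (map verts Ps) ++ L → ⊥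
    final [] L _ l _ p = onePath {[]} {B ++ L} (↭-trans pX (Perm.++⁺ˡ B p)) tt (few l)
    final (P ∷ []) L _ l _ p = onePath {verts P} (↭-trans pX (↭-trans
      (Perm.++⁺ˡ B (↭-trans p (Perm.++⁺ʳ L (Perm.++-identityʳ (verts P))))) (Perm.shifts B (verts P)))) (hpath-path P) (few l)
    -- Any three of `tl P`, `tl Q`, `A₁`, `A₂` contain an adjacent pair, which forces a perfect
    -- matching between the tails and the `Aᵢ`.
    final (P ∷ Q ∷ []) L _ l ((nPQ ∷ []) ∷ _) p = matching₂
      (match P Q L l pq) (match Q P L l (↭-trans pq (Perm.shifts (verts P) (verts Q))))
      (λ np nr → noIndep (tl P ∷ tl Q ∷ A₁ ∷ []) refl
        (k≤ (tl-length P) ∷ k≤ (tl-length Q) ∷ k≤ eA₁ ∷ [] , (nPQ ∷ na₁ P P≼ np ∷ []) ∷ (na₁ Q Q≼ nr ∷ []) ∷ [] ∷ []))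
      (λ ns nq → noIndep (tl P ∷ tl Q ∷ A₂ ∷ []) refl
        (k≤ (tl-length P) ∷ k≤ (tl-length Q) ∷ k≤ eA₂ ∷ [] , (nPQ ∷ na₂ P P≼ ns ∷ []) ∷ (na₂ Q Q≼ nq ∷ []) ∷ [] ∷ []))
      (λ np ns → noIndep (tl P ∷ A₁ ∷ A₂ ∷ []) refl
        (k≤ (tl-length P) ∷ k≤ eA₁ ∷ k≤ eA₂ ∷ [] , (na₁ P P≼ np ∷ na₂ P P≼ ns ∷ []) ∷ (naA ∷ []) ∷ [] ∷ []))
      (λ nq nr → noIndep (tl Q ∷ A₁ ∷ A₂ ∷ []) refl
        (k≤ (tl-length Q) ∷ k≤ eA₁ ∷ k≤ eA₂ ∷ [] , (na₁ Q Q≼ nr ∷ na₂ Q Q≼ nq ∷ []) ∷ (naA ∷ []) ∷ [] ∷ []))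
      where
      pq : X ↭ verts P ++ verts Q ++ L
      pq = ↭-trans p (solve 3 (λ p q l → (p ⊕ (q ⊕ id)) ⊕ l ⊜ p ⊕ (q ⊕ l)) ↭-refl (verts P) (verts Q) L)
      P≼ : verts P ≼ X
      P≼ = _ , pq
      Q≼ : verts Q ≼ X
      Q≼ = _ , ↭-trans pq (Perm.shifts (verts P) (verts Q))
      k≤ : ∀ {j} → j ≡ k → k ≤ j
      k≤ e = ≤-reflexive (sym e)
      na₁ : ∀ P → verts P ≼ X → ¬ Adj (tl P) A₁ → NonAdj (tl P) A₁
      na₁ P P≼ = separated pX (≼-trans (tail≼ P) P≼) A₁≼ (tl-clique P) (clique-≼ (≼-++ˡ A₁ H₁) k₁)
      na₂ : ∀ P → verts P ≼ X → ¬ Adj (tl P) A₂ → NonAdj (tl P) A₂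
      na₂ P P≼ = separated pX (≼-trans (tail≼ P) P≼) A₂≼ (tl-clique P) (clique-≼ (≼-++ˡ A₂ H₂) k₂)
    final (_ ∷ _ ∷ _ ∷ _) L (s≤s (s≤s ())) _ _ _

  avoid : ∀ (xs : List V) E → Unique E → ∃ λ E′ → E′ ≼ E × Dis xs E′ × length E ≤ length xs + length E′
  avoid [] E u = E , ≼-refl , (λ ()) , ≤-refl
  avoid (x ∷ xs) E u with avoid xs E u
  ... | E′ , E′≼ , d , l with DecMem._∈?_ FinP._≟_ x E′
  ...   | no x∉ = E′ , E′≼ , (λ { (here refl) q → x∉ q ; (there p) q → d p q }) , m≤n⇒m≤1+n l
  ...   | yes x∈ with r , p ← ∈⇒≼ x∈ =
    r , ≼-trans r≼ E′≼ ,
    (λ { (here refl) q → ∉-unique (unique-↭ p (≼-unique E′≼ u)) q ; (there y∈) q → d y∈ (≼-⊆ r≼ q) }) ,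
    ≤-trans l (≤-reflexive (trans (cong (length xs +_) (Perm.↭-length p)) (+-suc (length xs) (length r))))
    where
    r≼ : r ≼ E′
    r≼ = ≼-trans (≼-++ʳ (x ∷ []) r) (↭⇒≼ p)

  -- Hall's condition for matching A₁ and A₂ to two of three path ends; aᵢ and bᵢ say that the i-th end is
  -- adjacent to A₁ and to A₂.
  noFirst : ∀ {a₁ a₂ a₃ b₁ b₂ b₃ : Set} → (a₁ → b₂ → ⊥) → (a₁ → b₃ → ⊥) → (a₂ → b₁ → ⊥) → (a₃ → b₁ → ⊥) →
    (¬ a₂ → ¬ a₃ → ¬ b₂ → ¬ b₃ → ⊥) → (¬ b₁ → ¬ b₂ → ¬ b₃ → ⊥) → ¬ a₁
  noFirst m₁₂ m₁₃ m₂₁ m₃₁ four b p = b (λ q → four (λ r → m₂₁ r q) (λ r → m₃₁ r q) (m₁₂ p) (m₁₃ p)) (m₁₂ p) (m₁₃ p)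

  -- The path f f′ v g f″ g′ g″ leads from E₂ to E₁.
  module Connector {E₁ E₂ : List V} (na : NonAdj E₁ E₂) (r₁₂ : T true E₁ E₁ E₂) (b₁₂ : T false E₁ E₂ E₂)
    (size₁ : 5 + (2 + connSize) ≤ length E₁) (size₂ : 5 + (2 + connSize) ≤ length E₂)
    (small : 7 + (connSize + connSize) + cliqueSize (naSize₄ + naSize₄) < n)
    {v f f′ f″ g : V} (f∈ : f ∈ E₂) (f′∈ : f′ ∈ E₂) (f″∈ : f″ ∈ E₂) (g∈ : g ∈ E₁)
    (distinct : Unique (v ∷ f ∷ f′ ∷ f″ ∷ g ∷ []))
    (red₁ : col c v f f′ ≡ true) (red₂ : col c v f′ g ≡ true) (red₃ : col c v f″ g ≡ true) where

    k a : ℕ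
    k = naSize₄
    a = absorbSize (cliqueSize (naSize₄ + naSize₄))

    2≤k : 2 ≤ k
    2≤k = missSize-2≤ ≤-refl

    bad : List V
    bad = v ∷ f ∷ f′ ∷ f″ ∷ g ∷ []

    module _ (A₁ A₂ H₁ H₂ : List V) {g′ g″ : V} (q₁ : g′ ∷ g″ ∷ (A₁ ++ H₁) ≼ E₁) (d₁ : Dis bad (g′ ∷ g″ ∷ (A₁ ++ H₁)))
      (q₂ : A₂ ++ H₂ ≼ E₂) (d₂ : Dis bad (A₂ ++ H₂))
      (eA₁ : length A₁ ≡ k) (eH₁ : length H₁ ≡ a) (eA₂ : length A₂ ≡ k) (eH₂ : length H₂ ≡ a) where

      K B : List V
      K = f ∷ f′ ∷ v ∷ g ∷ f″ ∷ g′ ∷ g″ ∷ []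
      B = K ++ ((A₁ ++ H₁) ++ (A₂ ++ H₂))

      uniqueB : Unique B
      uniqueB = unique-↭
        (solve 9 (λ v f h j g x y a b → (v ⊕ (f ⊕ (h ⊕ (j ⊕ g)))) ⊕ ((x ⊕ (y ⊕ a)) ⊕ b) ⊜
            (f ⊕ (h ⊕ (v ⊕ (g ⊕ (j ⊕ (x ⊕ y)))))) ⊕ (a ⊕ b)) ↭-refl
          (v ∷ []) (f ∷ []) (f′ ∷ []) (f″ ∷ []) (g ∷ []) (g′ ∷ []) (g″ ∷ []) (A₁ ++ H₁) (A₂ ++ H₂))
        (unique-++ distinct
          (unique-++ (≼-unique q₁ (unique (cliqueˡ na))) (≼-unique q₂ (unique (cliqueʳ na))) (dis-≼ q₁ q₂ (disjoint na)))
          λ x∈ y∈ → both x∈ (∈-++⁻ (g′ ∷ g″ ∷ (A₁ ++ H₁)) y∈))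
        where
        both : ∀ {x} → x ∈ bad → x ∈ g′ ∷ g″ ∷ (A₁ ++ H₁) ⊎ x ∈ A₂ ++ H₂ → ⊥
        both x∈ (inj₁ y∈) = d₁ x∈ y∈
        both x∈ (inj₂ y∈) = d₂ x∈ y∈

      k₁ : Clique (g′ ∷ g″ ∷ H₁ ++ A₁)
      k₁ = clique-≼ (≼-trans (↭⇒≼ (prep g′ (prep g″ (Perm.++-comm A₁ H₁)))) q₁) (cliqueˡ na)

      kA₁ : Clique A₁
      kA₁ = clique-≼ (≼-trans (≼-++ˡ A₁ H₁) (≼-trans (≼-++ʳ (g′ ∷ g″ ∷ []) (A₁ ++ H₁)) q₁)) (cliqueˡ na)

      kA₂ : Clique A₂
      kA₂ = clique-≼ (≼-trans (≼-++ˡ A₂ H₂) q₂) (cliqueʳ na)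

      k₂ : Clique ((A₂ ++ H₂) ++ f ∷ f′ ∷ [])
      k₂ = clique-≼ (unique-⊆⇒≼ (≼-unique ff≼B uniqueB) sub) (cliqueʳ na)
        where
        ff≼B : (A₂ ++ H₂) ++ f ∷ f′ ∷ [] ≼ B
        ff≼B = (v ∷ g ∷ f″ ∷ g′ ∷ g″ ∷ []) ++ (A₁ ++ H₁) ,
          solve 4 (λ f r a b → (f ⊕ r) ⊕ (a ⊕ b) ⊜ (b ⊕ f) ⊕ (r ⊕ a)) ↭-refl
            (f ∷ f′ ∷ []) (v ∷ g ∷ f″ ∷ g′ ∷ g″ ∷ []) (A₁ ++ H₁) (A₂ ++ H₂)
        sub : ∀ {x} → x ∈ (A₂ ++ H₂) ++ f ∷ f′ ∷ [] → x ∈ E₂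
        sub x∈ with ∈-++⁻ (A₂ ++ H₂) x∈
        ... | inj₁ p = ≼-⊆ q₂ p
        ... | inj₂ (here refl) = f∈
        ... | inj₂ (there (here refl)) = f′∈

      -- The three edges of the connector come first. The last two triples have two vertices in `E₁`
      -- and one in `E₂`, so `r₁₂` makes them red.
      core : RedPath K
      core with g′∈ ← ≼-⊆ q₁ (here refl) | g″∈ ← ≼-⊆ q₁ (there (here refl)) =
        trans (trans (sym₂₃ c _ _ _) (sym₁₂ c _ _ _)) red₁ ,
        trans (sym₁₂ c _ _ _) red₂ ,
        trans (sym₂₃ c _ _ _) red₃ ,
        trans (sym₂₃ c _ _ _) (r₁₂ g∈ g′∈ f″∈ g≢g′ (apart (disjoint na) g∈ f″∈) (apart (disjoint na) g′∈ f″∈)) ,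
        trans (trans (sym₁₂ c _ _ _) (sym₂₃ c _ _ _))
          (r₁₂ g′∈ g″∈ f″∈ g′≢g″ (apart (disjoint na) g′∈ f″∈) (apart (disjoint na) g″∈ f″∈)) , tt
        where
        g≢g′ : g ≢ g′
        g≢g′ refl = d₁ (there (there (there (there (here refl))))) (here refl)
        g′≢g″ : g′ ≢ g″
        g′≢g″ refl = ∉-unique (≼-unique q₁ (unique (cliqueˡ na))) (here refl)

      m : ℕ
      m = cliqueSize (k + k)

      B-length : length B ≡ 7 + (connSize + connSize)
      B-length = cong (7 +_) (trans (length-++ (A₁ ++ H₁)) (cong₂ _+_ (trans (length-++ A₁) (cong₂ _+_ eA₁ eH₁)) (trans (length-++ A₂) (cong₂ _+_ eA₂ eH₂))))

      A₁≼ : A₁ ≼ B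
      A₁≼ = ≼-trans (≼-++ˡ A₁ H₁) (≼-trans (≼-++ˡ (A₁ ++ H₁) (A₂ ++ H₂)) (≼-++ʳ K _))

      A₂≼ : A₂ ≼ B
      A₂≼ = ≼-trans (≼-++ˡ A₂ H₂) (≼-trans (≼-++ʳ (A₁ ++ H₁) (A₂ ++ H₂)) (≼-++ʳ K _))

      2≤A : ∀ {j} → j ≡ k → 2 ≤ j
      2≤A e = ≤-trans 2≤k (≤-reflexive (sym e))

      k≤ : ∀ {j} → j ≡ k → k ≤ j
      k≤ e = ≤-reflexive (sym e)

      naA : NonAdj A₁ A₂
      naA = nonAdj-≼ (≼-trans (≼-++ˡ A₁ H₁) (≼-trans (≼-++ʳ (g′ ∷ g″ ∷ []) (A₁ ++ H₁)) q₁)) (≼-trans (≼-++ˡ A₂ H₂) q₂)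
        (2≤A eA₁) (2≤A eA₂) na

      module _ {X : List V} (pX : allFin N ↭ B ++ X) where

        few : ∀ {L} → length L ≤ m → length (B ++ L) < n
        few {L} l = ≤-<-trans (≤-trans (≤-reflexive (trans (length-++ B) (cong (_+ length L) B-length)))
          (+-monoʳ-≤ (7 + (connSize + connSize)) l)) small

        done : ∀ {U₁ U₂ Q L} → LeftEnd A₁ U₁ → LeftEnd A₂ U₂ → RedPath Q → length L ≤ m → X ↭ U₁ ++ U₂ ++ Q ++ L → ⊥
        done end₁ end₂ rQ l q = finish₃ k₂ k₁
          (T-≼ (≼-trans (≼-++ʳ A₁ H₁) (≼-trans (≼-++ʳ (g′ ∷ g″ ∷ []) (A₁ ++ H₁)) q₁)) (≼-trans (≼-++ʳ A₂ H₂) q₂) (≼-trans (≼-++ʳ A₂ H₂) q₂) b₁₂)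
          core rQ end₁ end₂
          (≤-trans (absorbSize-mono l) (≤-reflexive (sym eH₁))) (≤-trans (absorbSize-mono l) (≤-reflexive (sym eH₂)))
          (↭-trans pX (↭-trans (Perm.++⁺ˡ B q) (Perm.++⁺ˡ K (Perm.++-assoc (A₁ ++ H₁) (A₂ ++ H₂) _))))

        na₁ : ∀ P → verts {k} P ≼ X → ¬ Adj (tl P) A₁ → NonAdj (tl P) A₁
        na₁ P P≼ = separated pX (≼-trans (tail≼ P) P≼) A₁≼ (tl-clique P) kA₁

        na₂ : ∀ P → verts {k} P ≼ X → ¬ Adj (tl P) A₂ → NonAdj (tl P) A₂
        na₂ P P≼ = separated pX (≼-trans (tail≼ P) P≼) A₂≼ (tl-clique P) kA₂

        att₁ : ∀ P → Adj (tl {k} P) A₁ → LeftEnd A₁ (verts P)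
        att₁ P = attach P 2≤k (2≤A eA₁)

        att₂ : ∀ P → Adj (tl {k} P) A₂ → LeftEnd A₂ (verts P)
        att₂ P = attach P 2≤k (2≤A eA₂)

        fourOf : ∀ P Q → verts {k} P ≼ X → verts {k} Q ≼ X → NonAdj (tl P) (tl Q) →
          ¬ Adj (tl P) A₁ → ¬ Adj (tl Q) A₁ → ¬ Adj (tl P) A₂ → ¬ Adj (tl Q) A₂ → ⊥
        fourOf P Q P≼ Q≼ nPQ p₁ q₁ p₂ q₂ = indep₄ {tl P} {tl Q} {A₁} {A₂}
          (k≤ (tl-length P) ∷ k≤ (tl-length Q) ∷ k≤ eA₁ ∷ k≤ eA₂ ∷ [] ,
           (nPQ ∷ na₁ P P≼ p₁ ∷ na₂ P P≼ p₂ ∷ []) ∷ (na₁ Q Q≼ q₁ ∷ na₂ Q Q≼ q₂ ∷ []) ∷ (naA ∷ []) ∷ [] ∷ [])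

        final : ∀ (Ps : List (HPath k)) L → length Ps ≤ 3 → length L ≤ m →
          AllPairs (λ P Q → NonAdj (tl P) (tl Q)) Ps → X ↭ concat (map verts Ps) ++ L → ⊥
        final [] L _ l _ p = onePath {[]} {B ++ L} (↭-trans pX (Perm.++⁺ˡ B p)) tt (few l)
        final (P ∷ []) L _ l _ p = onePath {verts P} (↭-trans pX (↭-trans
          (Perm.++⁺ˡ B (↭-trans p (Perm.++⁺ʳ L (Perm.++-identityʳ (verts P))))) (Perm.shifts B (verts P)))) (hpath-path P) (few l)
        -- A single adjacency suffices: one path is attached, the other side of the long path stays
        -- bare, and the remaining path serves as `Q`.
        final (P ∷ Q ∷ []) L _ l ((nPQ ∷ []) ∷ _) p = fourOf P Q (_ , pq) (_ , qp) nPQ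
          (λ a → done (att₁ P a) (bare A₂) (hpath-path Q) l pq)
          (λ a → done (att₁ Q a) (bare A₂) (hpath-path P) l qp)
          (λ a → done (bare A₁) (att₂ P a) (hpath-path Q) l pq)
          (λ a → done (bare A₁) (att₂ Q a) (hpath-path P) l qp)
          where
          pq : X ↭ verts P ++ verts Q ++ L
          pq = ↭-trans p (solve 3 (λ p q l → (p ⊕ (q ⊕ id)) ⊕ l ⊜ p ⊕ (q ⊕ l)) ↭-refl (verts P) (verts Q) L)
          qp : X ↭ verts Q ++ verts P ++ L
          qp = ↭-trans pq (Perm.shifts (verts P) (verts Q))
        final (P ∷ Q ∷ R ∷ []) L _ l ((nPQ ∷ nPR ∷ []) ∷ (nQR ∷ []) ∷ _) p =
          -- Matching `A₁` and `A₂` to two different tails would finish, with the third path as `Q`.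
          -- Otherwise `noFirst` leaves `A₁` adjacent to no tail, giving four pairwise non-adjacent
          -- cliques.
          indep₄ {tl P} {tl Q} {tl R} {A₁}
            (k≤ (tl-length P) ∷ k≤ (tl-length Q) ∷ k≤ (tl-length R) ∷ k≤ eA₁ ∷ [] ,
             (nPQ ∷ nPR ∷ na₁ P P≼ (noFirst (match P Q R pqr) (match P R Q prq) (match Q P R qpr) (match R P Q rpq) (fourOf Q R Q≼ R≼ nQR) noB) ∷ []) ∷
             (nQR ∷ na₁ Q Q≼ (noFirst (match Q P R qpr) (match Q R P qrp) (match P Q R pqr) (match R Q P rqp) (fourOf P R P≼ R≼ nPR) (λ q p → noB p q)) ∷ []) ∷
             (na₁ R R≼ (noFirst (match R P Q rpq) (match R Q P rqp) (match P R Q prq) (match Q R P qrp) (fourOf P Q P≼ Q≼ nPQ) (λ r p q → noB p q r)) ∷ []) ∷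
             [] ∷ [])
          where
          match : ∀ P Q R → X ↭ verts P ++ verts Q ++ verts R ++ L → Adj (tl {k} P) A₁ → Adj (tl {k} Q) A₂ → ⊥
          match P Q R q a₁ a₂ = done (att₁ P a₁) (att₂ Q a₂) (hpath-path {k} R) l q
          pqr : X ↭ verts P ++ verts Q ++ verts R ++ L
          pqr = ↭-trans p (solve 4 (λ p q r l → (p ⊕ (q ⊕ (r ⊕ id))) ⊕ l ⊜ p ⊕ (q ⊕ (r ⊕ l))) ↭-refl (verts P) (verts Q) (verts R) L)
          prq : X ↭ verts P ++ verts R ++ verts Q ++ L
          prq = ↭-trans pqr (Perm.++⁺ˡ (verts P) (Perm.shifts (verts Q) (verts R)))
          qpr : X ↭ verts Q ++ verts P ++ verts R ++ L
          qpr = ↭-trans pqr (Perm.shifts (verts P) (verts Q))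
          qrp : X ↭ verts Q ++ verts R ++ verts P ++ L
          qrp = ↭-trans qpr (Perm.++⁺ˡ (verts Q) (Perm.shifts (verts P) (verts R)))
          rpq : X ↭ verts R ++ verts P ++ verts Q ++ L
          rpq = ↭-trans prq (Perm.shifts (verts P) (verts R))
          rqp : X ↭ verts R ++ verts Q ++ verts P ++ L
          rqp = ↭-trans rpq (Perm.++⁺ˡ (verts R) (Perm.shifts (verts P) (verts Q)))
          P≼ : verts P ≼ X
          P≼ = _ , pqr
          Q≼ : verts Q ≼ X
          Q≼ = _ , qpr
          R≼ : verts R ≼ X
          R≼ = _ , rpq
          noB : ¬ Adj (tl P) A₂ → ¬ Adj (tl Q) A₂ → ¬ Adj (tl R) A₂ → ⊥
          noB p q r = indep₄ {tl P} {tl Q} {tl R} {A₂}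
            (k≤ (tl-length P) ∷ k≤ (tl-length Q) ∷ k≤ (tl-length R) ∷ k≤ eA₂ ∷ [] ,
             (nPQ ∷ nPR ∷ na₂ P P≼ p ∷ []) ∷ (nQR ∷ na₂ Q Q≼ q ∷ []) ∷ (na₂ R R≼ r ∷ []) ∷ [] ∷ [])
        final (_ ∷ _ ∷ _ ∷ _ ∷ _) L (s≤s (s≤s (s≤s ()))) _ _ _

        noFour : ∀ Us → length Us ≡ 4 → Indep k Us → ⊥
        noFour (_ ∷ _ ∷ _ ∷ _ ∷ []) refl i = indep₄ i

        contradictory : ⊥
        contradictory = process 3 k 2≤k noFour (unique-++ʳ B (unique-↭ pX uniqueAll)) final (suc (length X)) [] X ≤-refl ↭-refl

    -- The five vertices in `bad` are avoided in both cliques, `v` included because it may lie in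
    -- either. Two further vertices of `E₁` become `g′` and `g″`, and the rest is carved up.
    connector : ⊥
    connector
      with E₁′ , p₁ , d₁ , l₁ ← avoid bad E₁ (unique (cliqueˡ na))
      with E₂′ , p₂ , d₂ , l₂ ← avoid bad E₂ (unique (cliqueʳ na))
      with le₁ ← +-cancelˡ-≤ 5 _ _ (≤-trans size₁ l₁)
      with le₂ ← +-cancelˡ-≤ 5 _ _ (≤-trans size₂ l₂)
      with g′ ∷ g″ ∷ [] , R , q , refl ← split 2 E₁′ (≤-trans (m≤m+n 2 _) le₁)
      with A₁ , H₁ , h₁ , eA₁ , eH₁ ← carve k a R (+-cancelˡ-≤ 2 _ _ (≤-trans le₁ (≤-reflexive (Perm.↭-length q))))
      with A₂ , H₂ , h₂ , eA₂ , eH₂ ← carve k a E₂′ (≤-trans (m≤n+m _ 2) le₂)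
      with r₁ ← ≼-trans (≼-∷ g′ (≼-∷ g″ h₁)) (↭⇒≼ q)
      with u ← uniqueB A₁ A₂ H₁ H₂ (≼-trans r₁ p₁) (λ x y → d₁ x (≼-⊆ r₁ y)) (≼-trans h₂ p₂) (λ x y → d₂ x (≼-⊆ h₂ y)) eA₁ eH₁ eA₂ eH₂
      with X , pX ← unique-⊆⇒≼ u (λ {v} _ → ∈-allFin v)
      = contradictory A₁ A₂ H₁ H₂ (≼-trans r₁ p₁) (λ x y → d₁ x (≼-⊆ r₁ y)) (≼-trans h₂ p₂) (λ x y → d₂ x (≼-⊆ h₂ y)) eA₁ eH₁ eA₂ eH₂ pX

-- The cyclic case without connectors

opaque
  unfolding bip
  ≤-bip : ∀ s → s ≤ bip s
  ≤-bip s = ≤-trans (m≤m+n s s) (m≤m+n (s + s) _)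

opaque
  ram : ℕ → ℕ → ℕ
  ram = R₂

  ram-bound : ∀ s t {k} → ram s t ≤ k → R₂ s t ≤ k
  ram-bound s t le = le

-- One `bip` for each of the two uses of `crossBlue` in `typeX`; the 4 provides the points for
-- `linkRed`.
blueSize : ℕ → ℕ
blueSize s = 4 + bip (3 + bip (3 + s))

typeSize : ℕ → ℕ → ℕ
typeSize t s = ram t (blueSize s) + (ram (blueSize s) 4 + (t + blueSize s))

cliqueClassSize : ℕ → ℕ
cliqueClassSize t = ram t (ram t (ram t 4))

forwardSize : ℕ → ℕ
forwardSize t = typeSize t (typeSize t (typeSize t 2))

-- The successor accounts for the vertex `e` that `crossFano` removes from `E₁`.
crossSize : ℕ
crossSize = suc (typeSize 2 2)

rainbowSize : ℕ
rainbowSize = bip (3 + bip (3 + bip (3 + crossSize)))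

module Structure {N : ℕ} (c : Colouring N) (noFano : ¬ FanoCopy c blue) where
  open Colour c
  open NoFano c noFano
  open Stages c noFano

  -- The three red edges would form the tight path f f′ v g f″, leading from `E₂` towards `E₁`.
  NoConn : List V → List V → Set
  NoConn E₁ E₂ = ∀ {v f f′ f″ g} → f ∈ E₂ → f′ ∈ E₂ → f″ ∈ E₂ → g ∈ E₁ →
    Unique (v ∷ f ∷ f′ ∷ f″ ∷ g ∷ []) →
    col c v f f′ ≡ true → col c v f′ g ≡ true → col c v f″ g ≡ true → ⊥

  record Triple (E₁ E₂ E₃ : List V) : Set where
    field
      cyclic : Cyclic E₁ E₂ E₃
      nc₁₂ : NoConn E₁ E₂
      nc₂₃ : NoConn E₂ E₃
      nc₃₁ : NoConn E₃ E₁
    open Cyclic cyclic public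

  rotateT : ∀ {E₁ E₂ E₃} → Triple E₁ E₂ E₃ → Triple E₂ E₃ E₁
  rotateT t = record { cyclic = rotate cyclic ; nc₁₂ = nc₂₃ ; nc₂₃ = nc₃₁ ; nc₃₁ = nc₁₂ }
    where open Triple t

  noConn-≼ : ∀ {E₁ E₂ F₁ F₂} → F₁ ≼ E₁ → F₂ ≼ E₂ → NoConn E₁ E₂ → NoConn F₁ F₂
  noConn-≼ p q nc f f′ f″ g = nc (≼-⊆ q f) (≼-⊆ q f′) (≼-⊆ q f″) (≼-⊆ p g)

  triple-≼ : ∀ {E₁ E₂ E₃ F₁ F₂ F₃} → F₁ ≼ E₁ → F₂ ≼ E₂ → F₃ ≼ E₃ → Triple E₁ E₂ E₃ → Triple F₁ F₂ F₃
  triple-≼ p q r t = record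
    { cyclic = cyclic-≼ p q r cyclic
    ; nc₁₂ = noConn-≼ p q nc₁₂ ; nc₂₃ = noConn-≼ q r nc₂₃ ; nc₃₁ = noConn-≼ r p nc₃₁ }
    where open Triple t

  -- For suitable t, the classes X, Y, Z consist of the v with NoRed t v E₂, NoRed t v E₃, NoRed t v E₁.
  NoRed : ℕ → V → List V → Set
  NoRed t v E = ∀ S → S ≼ E → length S ≡ t → v ∉ S → Mono true (col c v) S → ⊥

  noRed-≼ : ∀ {t v E F} → F ≼ E → NoRed t v E → NoRed t v F
  noRed-≼ p nr S S≼ = nr S (≼-trans S≼ p)

  Cross : V → List V → List V → Set
  Cross v X Y = ∀ {x y} → x ∈ X → y ∈ Y → col c v x y ≡ false

  mono-≼ : ∀ {b v S T} → S ≼ T → Mono b (col c v) T → Mono b (col c v) S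
  mono-≼ p m x∈ y∈ = m (≼-⊆ p x∈) (≼-⊆ p y∈)

  cross-≼ : ∀ {v X X′ Y Y′} → X′ ≼ X → Y′ ≼ Y → Cross v X Y → Cross v X′ Y′
  cross-≼ p q m x∈ y∈ = m (≼-⊆ p x∈) (≼-⊆ q y∈)

  -- Were the homogeneous bipartite piece red, three vertices of its `E₂` side and one of its `E₁`
  -- side would form a connector with `v`, whose link on `E₂` is red. The 3 makes room for them.
  crossBlue : ∀ s {v E₁ E₂} → NoConn E₁ E₂ → Unique E₂ → Dis E₁ E₂ → v ∉ E₁ → v ∉ E₂ → Mono true (col c v) E₂ →
    bip (3 + s) ≤ length E₁ → bip (3 + s) ≤ length E₂ →
    ∃₂ λ F₁ F₂ → F₁ ≼ E₁ × F₂ ≼ E₂ × length F₁ ≡ 3 + s × length F₂ ≡ 3 + s × Cross v F₁ F₂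
  crossBlue s {v} nc uE d v∉₁ v∉₂ mono l₁ l₂ with bipartite (col c v) (3 + s) _ _ l₁ l₂
  ... | F₁ , F₂ , p , q , e , e′ , false , m = F₁ , F₂ , p , q , e , e′ , m
  ... | g ∷ _ , f ∷ f′ ∷ f″ ∷ _ , p , q , _ , _ , true , m with ≼-unique q uE
  ...   | (ff′ ∷ ff″ ∷ _) ∷ (f′f″ ∷ _) ∷ _ = ⊥-elim (nc f∈ f′∈ f″∈ g∈
    (unique-∷ (λ { (here refl) → v∉₂ f∈ ; (there (here refl)) → v∉₂ f′∈ ; (there (there (here refl))) → v∉₂ f″∈
                 ; (there (there (there (here refl)))) → v∉₁ g∈ })
      ((ff′ ∷ ff″ ∷ apart (dis-sym d) f∈ g∈ ∷ []) ∷ (f′f″ ∷ apart (dis-sym d) f′∈ g∈ ∷ []) ∷ (apart (dis-sym d) f″∈ g∈ ∷ []) ∷ [] ∷ []))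
    (mono f∈ f′∈ ff′)
    (trans (link-sym _ _ _) (m (here refl) (there (here refl))))
    (trans (link-sym _ _ _) (m (here refl) (there (there (here refl))))))
    where
    f∈ = ≼-⊆ q (here refl)
    f′∈ = ≼-⊆ q (there (here refl))
    f″∈ = ≼-⊆ q (there (there (here refl)))
    g∈ = ≼-⊆ p (here refl)

  -- The blue part of the link of a vertex that behaves like a member of `E₁`.
  record TypeX (s : ℕ) (x : V) (E₁ E₂ E₃ : List V) : Set where
    field
      {F₁ F₂ F₃} : List V
      p₁ : F₁ ≼ E₁
      p₂ : F₂ ≼ E₂
      p₃ : F₃ ≼ E₃
      size₁ : s ≤ length F₁
      size₂ : s ≤ length F₂
      size₃ : s ≤ length F₃
      mono₂ : Mono false (col c x) F₂
      cross₂₃ : Cross x F₂ F₃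
      cross₁₃ : Cross x F₁ F₃

  noRed⇒blue : ∀ t s {x E} → NoRed t x E → x ∉ E → ram t s ≤ length E →
    ∃ λ G → G ≼ E × length G ≡ s × Mono false (col c x) G
  noRed⇒blue t s {x} {E} nr x∉ l with ramsey₂ (col c x) (link-sym x) t s E (ram-bound t s l)
  ... | inj₁ (S , p , e , m) = ⊥-elim (nr S p e (λ q → x∉ (≼-⊆ p q)) m)
  ... | inj₂ r = r

  -- Both `x` and all vertices of `E` have blue links on `G`, so `blueLinks⇒red` applies to `x` with
  -- any two vertices of `E`.
  linkRed : ∀ {x E F G} → Unique F → Dis E F → x ∉ E → x ∉ F → T false E F F →
    G ≼ F → 4 ≤ length G → Mono false (col c x) G → Mono true (col c x) E
  linkRed {x} {E} {F} {G} uF d x∉E x∉F t p l m y∈ z∈ y≢z =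
    blueLinks⇒red (≼-unique p uF) l (λ q → x∉F (≼-⊆ p q)) (λ q → d y∈ (≼-⊆ p q)) (λ q → d z∈ (≼-⊆ p q))
      (λ { refl → x∉E y∈ }) (λ { refl → x∉E z∈ }) y≢z m (link y∈) (link z∈)
    where
    link : ∀ {y} → y ∈ E → Mono false (col c y) G
    link y∈ a∈ b∈ = t y∈ (≼-⊆ p a∈) (≼-⊆ p b∈) (apart d y∈ (≼-⊆ p a∈)) (apart d y∈ (≼-⊆ p b∈))

  -- A blue K₄ in the link on `E₃` would make the link on `E₂` red, against `NoRed`; so that link is
  -- red on a large part of `E₃`, and `crossBlue` settles the pairs between `E₂` and `E₃`. The blue
  -- set found in `E₂` makes the link on `E₁` red, and `crossBlue` settles the pairs between `E₃`
  -- and `E₁`.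
  typeX : ∀ t s {x E₁ E₂ E₃} → Triple E₁ E₂ E₃ → NoRed t x E₂ → x ∉ E₁ → x ∉ E₂ → x ∉ E₃ →
    typeSize t s ≤ length E₁ → typeSize t s ≤ length E₂ → typeSize t s ≤ length E₃ → TypeX s x E₁ E₂ E₃
  typeX t s {x} {E₁} {E₂} {E₃} tr nr x∉₁ x∉₂ x∉₃ l₁ l₂ l₃
    with noRed⇒blue t (blueSize s) nr x∉₂ (≤-trans (m≤m+n (ram t (blueSize s)) _) l₂)
       | ramsey₂ (col c x) (link-sym x) (blueSize s) 4 E₃
           (ram-bound (blueSize s) 4 (≤-trans (≤-trans (m≤m+n _ (t + blueSize s)) (m≤n+m _ (ram t (blueSize s)))) l₃))
  ... | _ | inj₂ (S , S≼ , eS , m) =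
    let U , U≼ , eU = choose t E₂ (≤-trans (≤-trans (≤-trans (m≤m+n t _) (m≤n+m _ (ram (blueSize s) 4))) (m≤n+m _ (ram t (blueSize s)))) l₂)
    in ⊥-elim (nr U U≼ eU (λ q → x∉₂ (≼-⊆ U≼ q))
         (mono-≼ U≼ (linkRed (unique k₃) d₂₃ x∉₂ x∉₃ b₂₃ S≼ (≤-reflexive (sym eS)) m)))
    where open Triple tr
  ... | G , G≼ , eG , mG | inj₁ (F , F≼ , eF , mF)
    with G′ , F′ , pG , pF , eG′ , eF′ , cr ← crossBlue (bip (3 + s)) {x} (noConn-≼ G≼ F≼ (Triple.nc₂₃ tr))
           (≼-unique F≼ (unique (Triple.k₃ tr))) (dis-≼ G≼ F≼ (Triple.d₂₃ tr)) (λ q → x∉₂ (≼-⊆ G≼ q)) (λ q → x∉₃ (≼-⊆ F≼ q)) mF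
           (≤-trans (m≤n+m _ 4) (≤-reflexive (sym eG))) (≤-trans (m≤n+m _ 4) (≤-reflexive (sym eF)))
    with F″ , E₁′ , pF″ , pE , eF″ , eE , cr′ ← crossBlue s {x} (noConn-≼ (≼-trans pF F≼) ≼-refl (Triple.nc₃₁ tr))
           (unique (Triple.k₁ tr)) (dis-≼ (≼-trans pF F≼) ≼-refl (Triple.d₃₁ tr)) (λ q → x∉₃ (≼-⊆ (≼-trans pF F≼) q)) x∉₁
           (linkRed (unique (Triple.k₂ tr)) (Triple.d₁₂ tr) x∉₁ x∉₂ (Triple.b₁₂ tr) G≼ (≤-trans (m≤m+n 4 _) (≤-reflexive (sym eG))) mG)
           (≤-trans (m≤n+m _ 3) (≤-reflexive (sym eF′)))
           (≤-trans (≤-trans (≤-trans (≤-trans (m≤n+m _ 3) (≤-trans (≤-bip _) (≤-trans (m≤n+m _ 4) (m≤n+m _ t)))) (m≤n+m _ (ram (blueSize s) 4))) (m≤n+m _ (ram t (blueSize s)))) l₁)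
    = record
      { p₁ = pE ; p₂ = ≼-trans pG G≼ ; p₃ = ≼-trans pF″ (≼-trans pF F≼)
      ; size₁ = ≤-trans (m≤n+m s 3) (≤-reflexive (sym eE))
      ; size₂ = ≤-trans (≤-trans (m≤n+m s 3) (≤-trans (≤-bip _) (m≤n+m _ 3))) (≤-reflexive (sym eG′))
      ; size₃ = ≤-trans (m≤n+m s 3) (≤-reflexive (sym eF″))
      ; mono₂ = mono-≼ pG mG
      ; cross₂₃ = cross-≼ ≼-refl pF″ cr
      ; cross₁₃ = λ a∈ b∈ → trans (link-sym _ _ _) (cr′ b∈ a∈) }

  pick₁ : ∀ {E : List V} → 1 ≤ length E → ∃ λ x → x ∷ [] ≼ E
  pick₁ {E} l with choose 1 E l
  ... | x ∷ [] , p , refl = x , p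

  pick₂ : ∀ {E : List V} → 2 ≤ length E → ∃₂ λ x y → x ∷ y ∷ [] ≼ E
  pick₂ {E} l with choose 2 E l
  ... | x ∷ y ∷ [] , p , refl = x , y , p

  distinctPoints : ∀ {E₁ E₂ E₃ O P₁ P₂ P₃} → Triple E₁ E₂ E₃ → Unique O → Dis O E₁ → Dis O E₂ → Dis O E₃ →
    P₁ ≼ E₁ → P₂ ≼ E₂ → P₃ ≼ E₃ → Unique (O ++ P₁ ++ P₂ ++ P₃)
  distinctPoints {E₁} {E₂} {E₃} {O} {P₁} {P₂} {P₃} tr uO o₁ o₂ o₃ p₁ p₂ p₃ =
    ≼-unique (≼-++ (≼-refl {xs = O}) (≼-++ p₁ (≼-++ p₂ p₃)))
      (unique-++ uO (unique-++ (unique k₁) (unique-++ (unique k₂) (unique k₃) d₂₃) dis₁) dis₀)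
    where
    open Triple tr
    dis₁ : Dis E₁ (E₂ ++ E₃)
    dis₁ x∈ y∈ with ∈-++⁻ E₂ y∈
    ... | inj₁ q = d₁₂ x∈ q
    ... | inj₂ q = d₃₁ q x∈
    dis₀ : Dis O (E₁ ++ E₂ ++ E₃)
    dis₀ x∈ y∈ with ∈-++⁻ E₁ y∈
    ... | inj₁ q = o₁ x∈ q
    ... | inj₂ q with ∈-++⁻ E₂ q
    ...   | inj₁ r = o₂ x∈ r
    ...   | inj₂ r = o₃ x∈ r

  -- Shrinking `E` three times leaves four points on which all three links are blue.
  redClass : ∀ t {E x y z} → Unique E → cliqueClassSize t ≤ length E →
    NoRed t x E → NoRed t y E → NoRed t z E → x ∉ E → y ∉ E → z ∉ E → x ≢ y → x ≢ z → y ≢ z →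
    col c x y z ≡ true
  redClass t uE l nx ny nz x∉ y∉ z∉ x≢y x≢z y≢z =
    let G₁ , p₁ , l₁ , m₁ = noRed⇒blue t (ram t (ram t 4)) nx x∉ l
        G₂ , p₂ , l₂ , m₂ = noRed⇒blue t (ram t 4) (noRed-≼ p₁ ny) (λ q → y∉ (≼-⊆ p₁ q)) (≤-reflexive (sym l₁))
        p₂₁ = ≼-trans p₂ p₁
        G₃ , p₃ , l₃ , m₃ = noRed⇒blue t 4 (noRed-≼ p₂₁ nz) (λ q → z∉ (≼-⊆ p₂₁ q)) (≤-reflexive (sym l₂))
        p = ≼-trans p₃ p₂₁
    in blueLinks⇒red (≼-unique p uE) (≤-reflexive (sym l₃)) (λ q → x∉ (≼-⊆ p q)) (λ q → y∉ (≼-⊆ p q)) (λ q → z∉ (≼-⊆ p q))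
      x≢y x≢z y≢z (mono-≼ (≼-trans p₃ p₂) m₁) (mono-≼ p₃ m₂) m₃

  -- If x x′ y were blue, then with p in `E₁`, q in `E₂` and z, z′ in `E₃` the lines xpz, xx′y,
  -- xz′q, px′z′, pyq, zx′q, zyz′ would form a blue Fano plane. The other six are blue by the types
  -- of x, x′ and y.
  redForward : ∀ t {E₁ E₂ E₃ x x′ y} → Triple E₁ E₂ E₃ → NoRed t x E₂ → NoRed t x′ E₂ → NoRed t y E₃ →
    Unique (x ∷ x′ ∷ y ∷ []) → Dis (x ∷ x′ ∷ y ∷ []) E₁ → Dis (x ∷ x′ ∷ y ∷ []) E₂ → Dis (x ∷ x′ ∷ y ∷ []) E₃ →
    forwardSize t ≤ length E₁ → forwardSize t ≤ length E₂ → forwardSize t ≤ length E₃ →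
    col c x x′ y ≡ true
  redForward t {E₁} {E₂} {E₃} {x} {x′} {y} tr nx nx′ ny uO o₁ o₂ o₃ l₁ l₂ l₃ with col c x x′ y in eq
  ... | true = refl
  ... | false = ⊥-elim (fano
          (unique-↭ (solve 7 (λ x x′ y p q z z′ → (x ⊕ (x′ ⊕ y)) ⊕ (p ⊕ (q ⊕ (z ⊕ z′))) ⊜ x ⊕ (p ⊕ (z ⊕ (x′ ⊕ (y ⊕ (z′ ⊕ q)))))) ↭-refl
              (x ∷ []) (x′ ∷ []) (y ∷ []) (p ∷ []) (q ∷ []) (z ∷ []) (z′ ∷ [])) points)
          (X.cross₁₃ (≼-⊆ (≼-trans Y.p₃ X′.p₁) p∈) (≼-⊆ (≼-trans Y.p₂ X′.p₃) z∈))
          eq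
          (trans (link-sym _ _ _) (X.cross₂₃ (≼-⊆ (≼-trans Y.p₁ X′.p₂) q∈) (≼-⊆ (≼-trans Y.p₂ X′.p₃) z′∈)))
          (trans (sym₁₂ c _ _ _) (X′.cross₁₃ (≼-⊆ Y.p₃ p∈) (≼-⊆ Y.p₂ z′∈)))
          (trans (trans (sym₁₂ c _ _ _) (sym₂₃ c _ _ _)) (Y.cross₁₃ q∈ p∈))
          (trans (trans (sym₁₂ c _ _ _) (sym₂₃ c _ _ _)) (X′.cross₂₃ (≼-⊆ Y.p₁ q∈) (≼-⊆ Y.p₂ z∈)))
          (trans (sym₁₂ c _ _ _) (Y.mono₂ z∈ z′∈ z≢z′)))
    where
    out : ∀ {v O E F} → v ∈ O → F ≼ E → Dis O E → v ∉ F
    out v∈ p o q = o v∈ (≼-⊆ p q)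
    tX : TypeX (typeSize t (typeSize t 2)) x E₁ E₂ E₃
    tX = typeX t _ tr nx (o₁ (here refl)) (o₂ (here refl)) (o₃ (here refl)) l₁ l₂ l₃
    module X = TypeX tX
    tr′ : Triple X.F₁ X.F₂ X.F₃
    tr′ = triple-≼ X.p₁ X.p₂ X.p₃ tr
    i₁ = there {x = x} (here {xs = y ∷ []} refl)
    i₂ = there {x = x} (there {x = x′} (here {xs = []} refl))
    tX′ : TypeX (typeSize t 2) x′ X.F₁ X.F₂ X.F₃
    tX′ = typeX t _ tr′ (noRed-≼ X.p₂ nx′) (out i₁ X.p₁ o₁) (out i₁ X.p₂ o₂) (out i₁ X.p₃ o₃) X.size₁ X.size₂ X.size₃
    module X′ = TypeX tX′
    q₁ : X′.F₁ ≼ E₁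
    q₁ = ≼-trans X′.p₁ X.p₁
    q₂ : X′.F₂ ≼ E₂
    q₂ = ≼-trans X′.p₂ X.p₂
    q₃ : X′.F₃ ≼ E₃
    q₃ = ≼-trans X′.p₃ X.p₃
    -- `y` belongs to the next class, so its type is read in the rotated triple.
    tY : TypeX 2 y X′.F₂ X′.F₃ X′.F₁
    tY = typeX t 2 (rotateT (triple-≼ X′.p₁ X′.p₂ X′.p₃ tr′)) (noRed-≼ q₃ ny) (out i₂ q₂ o₂) (out i₂ q₃ o₃) (out i₂ q₁ o₁)
           X′.size₂ X′.size₃ X′.size₁
    module Y = TypeX tY
    pP = pick₁ {Y.F₃} (≤-trans (s≤s z≤n) Y.size₃)
    pQ = pick₁ {Y.F₁} (≤-trans (s≤s z≤n) Y.size₁)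
    pZ = pick₂ {Y.F₂} Y.size₂
    p = proj₁ pP
    q = proj₁ pQ
    z = proj₁ pZ
    z′ = proj₁ (proj₂ pZ)
    p∈ = ≼-⊆ (proj₂ pP) (here refl)
    q∈ = ≼-⊆ (proj₂ pQ) (here refl)
    z∈ = ≼-⊆ (proj₂ (proj₂ pZ)) (here refl)
    z′∈ = ≼-⊆ (proj₂ (proj₂ pZ)) (there (here refl))
    points : Unique ((x ∷ x′ ∷ y ∷ []) ++ (p ∷ []) ++ (q ∷ []) ++ (z ∷ z′ ∷ []))
    points = distinctPoints tr uO o₁ o₂ o₃ (≼-trans (proj₂ pP) (≼-trans Y.p₃ q₁)) (≼-trans (proj₂ pQ) (≼-trans Y.p₁ q₂))
      (≼-trans (proj₂ (proj₂ pZ)) (≼-trans Y.p₂ q₃))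
    z≢z′ : z ≢ z′
    z≢z′ e = ∉-unique (unique-++ʳ (x ∷ x′ ∷ y ∷ p ∷ q ∷ []) points) (here e)

  -- With e, p in `E₁`, y, y′ in `E₂` and z, z′ in `E₃`, the lines apz, aey, az′y′ are blue by
  -- assumption on a, pez′, pyy′, zyz′ by the cyclic pattern, and zey′ by the type of e.
  crossFano : ∀ {E₁ E₂ E₃ a} → Triple E₁ E₂ E₃ → a ∉ E₁ → a ∉ E₂ → a ∉ E₃ →
    Cross a E₁ E₂ → Cross a E₂ E₃ → Cross a E₃ E₁ →
    crossSize ≤ length E₁ → crossSize ≤ length E₂ → crossSize ≤ length E₃ → ⊥
  crossFano {E₁} {E₂} {E₃} {a} tr a∉₁ a∉₂ a∉₃ c₁₂ c₂₃ c₃₁ l₁ l₂ l₃ = fano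
      (unique-↭ (solve 7 (λ a e p y y′ z z′ → a ⊕ ((e ⊕ p) ⊕ ((y ⊕ y′) ⊕ (z ⊕ z′))) ⊜ a ⊕ (p ⊕ (z ⊕ (e ⊕ (y ⊕ (z′ ⊕ y′)))))) ↭-refl
        (a ∷ []) (e ∷ []) (p ∷ []) (y ∷ []) (y′ ∷ []) (z ∷ []) (z′ ∷ [])) points)
      (trans (link-sym _ _ _) (c₃₁ (≼-⊆ Z≼ z∈) (≼-⊆ P≼ p∈)))
      (c₁₂ e∈ (≼-⊆ Y≼ y∈))
      (trans (link-sym _ _ _) (c₂₃ (≼-⊆ Y≼ y′∈) (≼-⊆ Z≼ z′∈)))
      (trans (trans (sym₂₃ c _ _ _) (sym₁₂ c _ _ _)) (Triple.b₃₁ tr (≼-⊆ Z≼ z′∈) (≼-⊆ P≼ p∈) e∈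
        (λ q → d₃₁′ z′∈ p∈ q) (apart (Triple.d₃₁ tr) (≼-⊆ Z≼ z′∈) e∈) (λ q → e≢p (sym q))))
      (Triple.b₁₂ tr (≼-⊆ P≼ p∈) (≼-⊆ Y≼ y∈) (≼-⊆ Y≼ y′∈) (apart (Triple.d₁₂ tr) (≼-⊆ P≼ p∈) (≼-⊆ Y≼ y∈))
        (apart (Triple.d₁₂ tr) (≼-⊆ P≼ p∈) (≼-⊆ Y≼ y′∈)) y≢y′)
      (trans (trans (sym₁₂ c _ _ _) (sym₂₃ c _ _ _)) (X.cross₂₃ y′∈ z∈))
      (trans (sym₁₂ c _ _ _) (Triple.b₂₃ tr (≼-⊆ Y≼ y∈) (≼-⊆ Z≼ z∈) (≼-⊆ Z≼ z′∈)
        (apart (Triple.d₂₃ tr) (≼-⊆ Y≼ y∈) (≼-⊆ Z≼ z∈)) (apart (Triple.d₂₃ tr) (≼-⊆ Y≼ y∈) (≼-⊆ Z≼ z′∈)) z≢z′))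
    where
    pE = pick₁ {E₁} (≤-trans (s≤s z≤n) l₁)
    e = proj₁ pE
    R = proj₁ (proj₂ pE)
    R↭ : E₁ ↭ e ∷ R
    R↭ = proj₂ (proj₂ pE)
    R≼ : R ≼ E₁
    R≼ = ≼-trans (≼-++ʳ (e ∷ []) R) (↭⇒≼ R↭)
    e∈ : e ∈ E₁
    e∈ = ≼-⊆ (proj₂ pE) (here refl)
    e∉R : e ∉ R
    e∉R = ∉-unique (unique-↭ R↭ (unique (Triple.k₁ tr)))
    -- The whole link of `e` on `E₂` is blue by `b₁₂`, so `t` = 2 is already admissible in `typeX`.
    noRed : NoRed 2 e E₂
    noRed (y ∷ y′ ∷ []) S≼ refl _ m with (y≢y′ ∷ []) ∷ _ ← ≼-unique S≼ (unique (Triple.k₂ tr))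
      with () ← trans (sym (m (here refl) (there (here refl)) y≢y′))
        (Triple.b₁₂ tr e∈ (≼-⊆ S≼ (here refl)) (≼-⊆ S≼ (there (here refl)))
          (apart (Triple.d₁₂ tr) e∈ (≼-⊆ S≼ (here refl))) (apart (Triple.d₁₂ tr) e∈ (≼-⊆ S≼ (there (here refl)))) y≢y′)
    tX : TypeX 2 e R E₂ E₃
    tX = typeX 2 2 (triple-≼ R≼ ≼-refl ≼-refl tr) noRed e∉R (Triple.d₁₂ tr e∈) (λ q → Triple.d₃₁ tr q e∈)
      (≤-pred (≤-trans l₁ (≤-reflexive (Perm.↭-length R↭)))) (≤-trans (n≤1+n _) l₂) (≤-trans (n≤1+n _) l₃)
    module X = TypeX tX
    pP = pick₁ {X.F₁} (≤-trans (s≤s z≤n) X.size₁)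
    pY = pick₂ {X.F₂} X.size₂
    pZ = pick₂ {X.F₃} X.size₃
    p = proj₁ pP
    y = proj₁ pY
    y′ = proj₁ (proj₂ pY)
    z = proj₁ pZ
    z′ = proj₁ (proj₂ pZ)
    p∈ = ≼-⊆ (proj₂ pP) (here refl)
    y∈ = ≼-⊆ (proj₂ (proj₂ pY)) (here refl)
    y′∈ = ≼-⊆ (proj₂ (proj₂ pY)) (there (here refl))
    z∈ = ≼-⊆ (proj₂ (proj₂ pZ)) (here refl)
    z′∈ = ≼-⊆ (proj₂ (proj₂ pZ)) (there (here refl))
    P≼ : X.F₁ ≼ E₁
    P≼ = ≼-trans X.p₁ R≼
    Y≼ : X.F₂ ≼ E₂
    Y≼ = X.p₂
    Z≼ : X.F₃ ≼ E₃
    Z≼ = X.p₃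
    d₃₁′ : ∀ {u w} → u ∈ X.F₃ → w ∈ X.F₁ → u ≢ w
    d₃₁′ u∈ w∈ = apart (Triple.d₃₁ tr) (≼-⊆ Z≼ u∈) (≼-⊆ P≼ w∈)
    points : Unique ((a ∷ []) ++ (e ∷ p ∷ []) ++ (y ∷ y′ ∷ []) ++ (z ∷ z′ ∷ []))
    points = distinctPoints tr ([] ∷ []) (λ { (here refl) → a∉₁ }) (λ { (here refl) → a∉₂ }) (λ { (here refl) → a∉₃ })
      (≼-trans (≼-∷ e (≼-trans (proj₂ pP) X.p₁)) (↭⇒≼ R↭)) (≼-trans (proj₂ (proj₂ pY)) Y≼) (≼-trans (proj₂ (proj₂ pZ)) Z≼)
    e≢p : e ≢ p
    e≢p q = ∉-unique (unique-++ʳ (a ∷ []) points) (here q)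
    y≢y′ : y ≢ y′
    y≢y′ q = ∉-unique (unique-++ʳ (a ∷ e ∷ p ∷ []) points) (here q)
    z≢z′ : z ≢ z′
    z≢z′ q = ∉-unique (unique-++ʳ (a ∷ e ∷ p ∷ y ∷ y′ ∷ []) points) (here q)

  -- Three uses of `crossBlue`, one around each pair, make all crosses at `a` blue and lead to
  -- `crossFano`.
  rainbow : ∀ {E₁ E₂ E₃ a} → Triple E₁ E₂ E₃ → a ∉ E₁ → a ∉ E₂ → a ∉ E₃ →
    Mono true (col c a) E₁ → Mono true (col c a) E₂ → Mono true (col c a) E₃ →
    rainbowSize ≤ length E₁ → rainbowSize ≤ length E₂ → rainbowSize ≤ length E₃ → ⊥
  rainbow {E₁} {E₂} {E₃} {a} tr a∉₁ a∉₂ a∉₃ m₁ m₂ m₃ l₁ l₂ l₃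
    with A₁ , A₂ , a₁ , a₂ , eA₁ , eA₂ , cA ← crossBlue (bip (3 + bip (3 + crossSize))) {a} (Triple.nc₁₂ tr) (unique (Triple.k₂ tr)) (Triple.d₁₂ tr) a∉₁ a∉₂ m₂ l₁ l₂
    with B₂ , B₃ , b₂ , b₃ , eB₂ , eB₃ , cB ← crossBlue (bip (3 + crossSize)) {a} (noConn-≼ a₂ ≼-refl (Triple.nc₂₃ tr)) (unique (Triple.k₃ tr)) (dis-≼ a₂ ≼-refl (Triple.d₂₃ tr))
           (λ q → a∉₂ (≼-⊆ a₂ q)) a∉₃ m₃ (≤-trans (m≤n+m _ 3) (≤-reflexive (sym eA₂)))
           (≤-trans (≤-trans (m≤n+m _ 3) (≤-bip _)) l₃)
    with D₃ , D₁ , d₃ , d₁ , eD₃ , eD₁ , cD ← crossBlue crossSize {a} (noConn-≼ b₃ a₁ (Triple.nc₃₁ tr)) (≼-unique a₁ (unique (Triple.k₁ tr))) (dis-≼ b₃ a₁ (Triple.d₃₁ tr))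
           (λ q → a∉₃ (≼-⊆ b₃ q)) (λ q → a∉₁ (≼-⊆ a₁ q)) (mono-≼ a₁ m₁) (≤-trans (m≤n+m _ 3) (≤-reflexive (sym eB₃)))
           (≤-trans (m≤n+m _ 3) (≤-trans (≤-bip _) (≤-trans (m≤n+m _ 3) (≤-reflexive (sym eA₁)))))
    = crossFano (triple-≼ (≼-trans d₁ a₁) (≼-trans b₂ a₂) (≼-trans d₃ b₃) tr)
        (λ q → a∉₁ (≼-⊆ (≼-trans d₁ a₁) q)) (λ q → a∉₂ (≼-⊆ (≼-trans b₂ a₂) q)) (λ q → a∉₃ (≼-⊆ (≼-trans d₃ b₃) q))
        (cross-≼ d₁ b₂ cA) (cross-≼ ≼-refl d₃ cB) cD
        (≤-trans (m≤n+m _ 3) (≤-reflexive (sym eD₁)))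
        (≤-trans (m≤n+m _ 3) (≤-trans (≤-bip _) (≤-trans (m≤n+m _ 3) (≤-reflexive (sym eB₂)))))
        (≤-trans (m≤n+m _ 3) (≤-reflexive (sym eD₃)))

-- Weaving two lists into a path

weave : {A : Set} → List A → List A → List A
-- While `ys` lasts, any three consecutive entries have two members of `xs` and one of `ys`;
-- afterwards the rest of `xs` follows.
weave (x ∷ x′ ∷ xs) (y ∷ ys) = y ∷ x ∷ x′ ∷ weave xs ys
weave (x ∷ []) (y ∷ ys) = y ∷ x ∷ []
weave [] ys = []
weave xs [] = xs

weave-≼ : {A : Set} (xs ys : List A) → weave xs ys ≼ xs ++ ys
weave-≼ (x ∷ x′ ∷ xs) (y ∷ ys) = let r , p = weave-≼ xs ys in
  r , ↭-trans (Perm.shift y (x ∷ x′ ∷ xs) ys) (prep y (prep x (prep x′ p)))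
weave-≼ (x ∷ []) (y ∷ ys) = ys , swap x y ↭-refl
weave-≼ [] ys = ys , ↭-refl
weave-≼ (x ∷ []) [] = [] , ↭-refl
weave-≼ (x ∷ x′ ∷ xs) [] = [] , ↭-refl

-- The alternatives correspond to `xs` or `ys` running out first.
weave-length : {A : Set} (xs ys : List A) →
  3 * length xs ≤ 2 * length (weave xs ys) ⊎ length (weave xs ys) ≡ length xs + length ys
weave-length (x ∷ x′ ∷ xs) (y ∷ ys) with weave-length xs ys
... | inj₁ le = inj₁ (begin
      3 * (2 + length xs)                 ≡⟨ *-distribˡ-+ 3 2 (length xs) ⟩
      6 + 3 * length xs                   ≤⟨ +-monoʳ-≤ 6 le ⟩
      6 + 2 * length (weave xs ys)        ≡⟨ sym (*-distribˡ-+ 2 3 (length (weave xs ys))) ⟩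
      2 * (3 + length (weave xs ys))      ∎)
  where open ≤-Reasoning
... | inj₂ e = inj₂ (trans (cong (3 +_) e) (cong (2 +_) (sym (+-suc (length xs) (length ys)))))
weave-length (x ∷ []) (y ∷ ys) = inj₁ (n≤1+n 3)
weave-length [] ys = inj₁ z≤n
weave-length (x ∷ []) [] = inj₂ refl
weave-length (x ∷ x′ ∷ xs) [] = inj₂ (sym (+-identityʳ _))

splitThree : {A : Set} {P Q R : A → Set} (xs : List A) → All (λ x → P x ⊎ Q x ⊎ R x) xs →
  ∃ λ X → ∃ λ Y → ∃ λ Z → xs ↭ X ++ Y ++ Z × All P X × All Q Y × All R Z
splitThree [] [] = [] , [] , [] , ↭-refl , [] , [] , []
splitThree (x ∷ xs) (o ∷ os) with splitThree xs os
splitThree (x ∷ xs) (inj₁ o ∷ os) | X , Y , Z , p , a , b , d = x ∷ X , Y , Z , prep x p , o ∷ a , b , d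
splitThree (x ∷ xs) (inj₂ (inj₁ o) ∷ os) | X , Y , Z , p , a , b , d =
  X , x ∷ Y , Z , ↭-trans (prep x p) (↭-sym (Perm.shift x X (Y ++ Z))) , a , o ∷ b , d
splitThree (x ∷ xs) (inj₂ (inj₂ o) ∷ os) | X , Y , Z , p , a , b , d =
  X , Y , x ∷ Z , ↭-trans (prep x p) (↭-trans
    (solve 4 (λ a x y z → a ⊕ (x ⊕ (y ⊕ z)) ⊜ x ⊕ (y ⊕ (a ⊕ z))) ↭-refl (x ∷ []) X Y Z) ↭-refl) , a , b , o ∷ d

-- The class of a vertex is known only up to double negation. This passes through a finite list, and
-- the final goal is absurdity.
¬¬-All : {A : Set} {P : A → Set} → (∀ x → ¬ ¬ P x) → ∀ xs → ¬ ¬ All P xs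
¬¬-All f [] k = k []
¬¬-All f (x ∷ xs) k = f x (λ p → ¬¬-All f xs (λ ps → k (p ∷ ps)))

-- Choice of the constants and proof of the upper bound

structSize stageSize k₂ k₃ ℓ₂ : ℕ
structSize = 3 + (rainbowSize + (cliqueClassSize rainbowSize + forwardSize rainbowSize))
stageSize = (5 + (2 + connSize)) + structSize
-- Fixed from r = 3 downwards: stage r builds its paths with ends of the size that would force stage
-- r + 1, namely `k₂`, `k₃` and finally `naSize₄`.
k₃ = naSize₃ stageSize
ℓ₂ = k₃ + absorbSize (cliqueSize (k₃ + k₃))
k₂ = naSize₂ ℓ₂

small₁ small₂ small₃ threshold : ℕ
small₁ = suc (cliqueSize (k₂ + k₂))
small₂ = suc (ℓ₂ + ℓ₂ + cliqueSize (k₃ + k₃))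
small₃ = suc (7 + (connSize + connSize) + cliqueSize (naSize₄ + naSize₄))
-- The 3 serves the lower bound, which writes n as 3 + m.
threshold = 3 + (small₁ + (small₂ + small₃))

module Upper {N : ℕ} (c : Colouring N) (noFano : ¬ FanoCopy c blue)
  {n : ℕ} (size : suc N ≡ n + n)
  (noPath : ∀ Q → Unique Q → Colour.RedPath c Q → length Q < n) where
  open Colour c
  open NoFano c noFano
  open Stages c noFano
  open Endgame c noFano size noPath
  open Structure c noFano

  module _ {X₀ Y₀ : List V} (tX : T true X₀ X₀ X₀) (tXY : T true X₀ X₀ Y₀) (d : Dis X₀ Y₀) where

    weave-path₂ : ∀ x x′ xs ys → x ∷ x′ ∷ xs ≼ X₀ → Unique (x ∷ x′ ∷ xs) → (∀ {y} → y ∈ ys → y ∈ Y₀) →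
      RedPath (x ∷ x′ ∷ weave xs ys)
    weave-path₂ x x′ (a ∷ b ∷ xs) (y ∷ ys) p u@((xx′ ∷ _) ∷ u′@((x′a ∷ _) ∷ u″@((ab ∷ _) ∷ _))) q =
      tXY x∈ x′∈ y∈ xx′ (apart d x∈ y∈) (apart d x′∈ y∈) ,
      T-swap₂₃ tXY x′∈ y∈ a∈ (apart d x′∈ y∈) x′a (apart (dis-sym d) y∈ a∈) ,
      T-swap₁₂ (T-swap₂₃ tXY) y∈ a∈ b∈ (apart (dis-sym d) y∈ a∈) (apart (dis-sym d) y∈ b∈) ab ,
      weave-path₂ a b xs ys (≼-trans (≼-++ʳ (x ∷ x′ ∷ []) (a ∷ b ∷ xs)) p) u″ (λ r → q (there r))
      where
      x∈ = ≼-⊆ p (here refl)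
      x′∈ = ≼-⊆ p (there (here refl))
      a∈ = ≼-⊆ p (there (there (here refl)))
      b∈ = ≼-⊆ p (there (there (there (here refl))))
      y∈ = q (here refl)
    weave-path₂ x x′ (a ∷ []) (y ∷ ys) p ((xx′ ∷ _) ∷ (x′a ∷ _) ∷ _) q =
      tXY x∈ x′∈ y∈ xx′ (apart d x∈ y∈) (apart d x′∈ y∈) ,
      T-swap₂₃ tXY x′∈ y∈ a∈ (apart d x′∈ y∈) x′a (apart (dis-sym d) y∈ a∈) , tt
      where
      x∈ = ≼-⊆ p (here refl)
      x′∈ = ≼-⊆ p (there (here refl))
      a∈ = ≼-⊆ p (there (there (here refl)))
      y∈ = q (here refl)
    weave-path₂ x x′ [] ys p u q = tt
    weave-path₂ x x′ (a ∷ []) [] p u q = clique-path (clique u (T-≼ p p p tX))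
    weave-path₂ x x′ (a ∷ b ∷ xs) [] p u q = clique-path (clique u (T-≼ p p p tX))

    weave-path : Unique X₀ → ∀ xs → xs ≼ X₀ → RedPath (weave xs Y₀)
    weave-path u xs p = go xs Y₀ p (λ r → r)
      where
      go : ∀ xs ys → xs ≼ X₀ → (∀ {y} → y ∈ ys → y ∈ Y₀) → RedPath (weave xs ys)
      go (x ∷ x′ ∷ xs) (y ∷ ys) p q with (xx′ ∷ _) ∷ _ ← ≼-unique p u =
        T-swap₁₂ (T-swap₂₃ tXY) (q (here refl)) (≼-⊆ p (here refl)) (≼-⊆ p (there (here refl)))
          (apart (dis-sym d) (q (here refl)) (≼-⊆ p (here refl)))
          (apart (dis-sym d) (q (here refl)) (≼-⊆ p (there (here refl)))) xx′ ,
        weave-path₂ x x′ xs ys p (≼-unique p u) (λ r → q (there r))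
      go (x ∷ []) (y ∷ ys) p q = tt
      go [] ys p q = tt
      go (x ∷ []) [] p q = tt
      go (x ∷ x′ ∷ xs) [] p q = clique-path (clique (≼-unique p u) (T-≼ p p p tX))

  -- If the woven path uses up `X`, it has at least 3|X|/2 vertices, but fewer than n. Otherwise it
  -- covers `X` and `Y`, while the clique `Z` is a second path, and the two partition the vertices.
  third : ∀ {X Y Z} → allFin N ↭ X ++ Y ++ Z → T true X X X → T true X X Y → T true Z Z Z → 2 + 3 * length X ≤ n + n
  third {X} {Y} {Z} p tX tXY tZ = [ (λ le → ≤-trans (+-monoʳ-≤ 2 le) (twice w<n)) , (λ e → ⊥-elim (halves {X ++ Y} {Z}
      (↭-trans p (↭-sym (Perm.++-assoc X Y Z)))
      (≤-<-trans (≤-reflexive (trans (length-++ X) (sym e))) w<n)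
      (noPath Z uZ (clique-path (clique uZ tZ))))) ] (weave-length X Y)
    where
    u : Unique (X ++ Y ++ Z)
    u = unique-↭ p uniqueAll
    uZ : Unique Z
    uZ = unique-++ʳ Y (unique-++ʳ X u)
    uXY : Unique (X ++ Y)
    uXY = unique-++ˡ (X ++ Y) (unique-↭ (↭-sym (Perm.++-assoc X Y Z)) u)
    w<n : length (weave X Y) < n
    w<n = noPath _ (≼-unique (weave-≼ X Y) uXY) (weave-path tX tXY (unique-dis X uXY) (unique-++ˡ X u) X ≼-refl)
    twice : ∀ {w} → w < n → 2 + 2 * w ≤ n + n
    twice {w} lt = ≤-trans (≤-reflexive (trans (cong (λ k → 2 + (w + k)) (+-identityʳ w)) (cong suc (sym (+-suc w w))))) (+-mono-≤ lt lt)

  -- The three vertices may lie in `E` themselves and are removed first; the 3 in `structSize` pays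
  -- for this.
  classClique : ∀ {E X} → Unique E → structSize ≤ length E → All (λ v → NoRed rainbowSize v E) X → T true X X X
  classClique {E} uE l q {x} {y} {z} x∈ y∈ z∈ x≢y x≢z y≢z =
    let E′ , p , d , l′ = avoid (x ∷ y ∷ z ∷ []) E uE
    in redClass rainbowSize (≼-unique p uE)
      (≤-trans (≤-trans (m≤m+n _ (forwardSize rainbowSize)) (m≤n+m _ rainbowSize)) (+-cancelˡ-≤ 3 _ _ (≤-trans l l′)))
      (noRed-≼ p (All.lookup q x∈)) (noRed-≼ p (All.lookup q y∈)) (noRed-≼ p (All.lookup q z∈))
      (d (here refl)) (d (there (here refl))) (d (there (there (here refl)))) x≢y x≢z y≢z

  classForward : ∀ {E₁ E₂ E₃ X Y} → Triple E₁ E₂ E₃ →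
    structSize ≤ length E₁ → structSize ≤ length E₂ → structSize ≤ length E₃ →
    All (λ v → NoRed rainbowSize v E₂) X → All (λ v → NoRed rainbowSize v E₃) Y → T true X X Y
  classForward {E₁} {E₂} {E₃} tr l₁ l₂ l₃ qX qY {x} {y} {z} x∈ y∈ z∈ x≢y x≢z y≢z =
    let E₁′ , p₁ , d₁ , l₁′ = avoid (x ∷ y ∷ z ∷ []) E₁ (unique (Triple.k₁ tr))
        E₂′ , p₂ , d₂ , l₂′ = avoid (x ∷ y ∷ z ∷ []) E₂ (unique (Triple.k₂ tr))
        E₃′ , p₃ , d₃ , l₃′ = avoid (x ∷ y ∷ z ∷ []) E₃ (unique (Triple.k₃ tr))
    in redForward rainbowSize (triple-≼ p₁ p₂ p₃ tr)
      (noRed-≼ p₂ (All.lookup qX x∈)) (noRed-≼ p₂ (All.lookup qX y∈)) (noRed-≼ p₃ (All.lookup qY z∈))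
      ((x≢y ∷ x≢z ∷ []) ∷ (y≢z ∷ []) ∷ [] ∷ []) d₁ d₂ d₃ (big l₁ l₁′) (big l₂ l₂′) (big l₃ l₃′)
    where
    big : ∀ {j k} → structSize ≤ j → j ≤ 3 + k → forwardSize rainbowSize ≤ k
    big l l′ = ≤-trans (≤-trans (m≤n+m _ (cliqueClassSize rainbowSize)) (m≤n+m _ rainbowSize)) (+-cancelˡ-≤ 3 _ _ (≤-trans l l′))

  -- Refuting all three alternatives produces red sets in the three cliques at once, which `rainbow`
  -- excludes.
  classified : ∀ {E₁ E₂ E₃} → Triple E₁ E₂ E₃ → ∀ v →
    ¬ ¬ (NoRed rainbowSize v E₂ ⊎ NoRed rainbowSize v E₃ ⊎ NoRed rainbowSize v E₁)
  classified tr v k =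
    k (inj₁ λ S₂ p₂ l₂ v∉₂ m₂ → k (inj₂ (inj₁ λ S₃ p₃ l₃ v∉₃ m₃ → k (inj₂ (inj₂ λ S₁ p₁ l₁ v∉₁ m₁ →
      rainbow (triple-≼ p₁ p₂ p₃ tr) v∉₁ v∉₂ v∉₃ m₁ m₂ m₃
        (≤-reflexive (sym l₁)) (≤-reflexive (sym l₂)) (≤-reflexive (sym l₃)))))))

  -- The three bounds add up to 3N ≤ 3(2n - 2), whereas N = 2n - 1.
  threeThirds : ∀ {x y z} → N ≡ x + (y + z) → 2 + 3 * x ≤ n + n → 2 + 3 * y ≤ n + n → 2 + 3 * z ≤ n + n → ⊥
  threeThirds {x} {y} {z} e lx ly lz = <-irrefl refl (begin-strict
    3 * N                                        <⟨ m<n+m (3 * N) {3} (s≤s z≤n) ⟩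
    3 + 3 * N                                    ≡⟨ cong (λ k → 3 + 3 * k) e ⟩
    3 + 3 * (x + (y + z))                        ≡⟨ cong (3 +_) (trans (*-distribˡ-+ 3 x (y + z)) (cong (3 * x +_) (*-distribˡ-+ 3 y z))) ⟩
    3 + (3 * x + (3 * y + 3 * z))                ≡⟨ shuffle (3 * x) (3 * y) (3 * z) ⟩
    (1 + 3 * x) + ((1 + 3 * y) + (1 + 3 * z))    ≤⟨ +-mono-≤ (pred lx) (+-mono-≤ (pred ly) (pred lz)) ⟩
    N + (N + N)                                  ≡⟨ cong (λ k → N + (N + k)) (sym (+-identityʳ N)) ⟩
    3 * N                                        ∎)
    where
    open ≤-Reasoning
    pred : ∀ {k} → 2 + k ≤ n + n → 1 + k ≤ N
    pred l = ≤-pred (≤-trans l (≤-reflexive (sym size)))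
    shuffle : ∀ a b d → 3 + (a + (b + d)) ≡ (1 + a) + ((1 + b) + (1 + d))
    shuffle a b d = cong suc (sym (trans (cong (λ k → a + suc k) (+-suc b d))
      (trans (+-suc a (suc (b + d))) (cong suc (+-suc a (b + d))))))

  noTriple : ∀ {E₁ E₂ E₃} → Triple E₁ E₂ E₃ →
    structSize ≤ length E₁ → structSize ≤ length E₂ → structSize ≤ length E₃ → ⊥
  noTriple tr l₁ l₂ l₃ = ¬¬-All (classified tr) (allFin N) λ classes →
    let X , Y , Z , p , qX , qY , qZ = splitThree (allFin N) classes
        tX = classClique (unique (Triple.k₂ tr)) l₂ qX
        tY = classClique (unique (Triple.k₃ tr)) l₃ qY
        tZ = classClique (unique (Triple.k₁ tr)) l₁ qZ
        p′ = ↭-trans p (↭-trans (Perm.++-comm X (Y ++ Z)) (Perm.++-assoc Y Z X))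
        p″ = ↭-trans p′ (↭-trans (Perm.++-comm Y (Z ++ X)) (Perm.++-assoc Z X Y))
    in threeThirds {length X} {length Y} {length Z}
         (trans (sym (length-tabulate {n = N} (λ i → i))) (trans (Perm.↭-length p) (trans (length-++ X) (cong (length X +_) (length-++ Y)))))
         (third p tX (classForward tr l₁ l₂ l₃ qX qY) tZ)
         (third p′ tY (classForward (rotateT tr) l₂ l₃ l₁ qY qZ) tX)
         (third p″ tZ (classForward (rotateT (rotateT tr)) l₃ l₁ l₂ qZ qX) tY)

  module _ (large : threshold ≤ n) where

    large₁ : small₁ ≤ n
    large₁ = ≤-trans (≤-trans (m≤m+n small₁ _) (m≤n+m _ 3)) large

    large₂ : small₂ ≤ n
    large₂ = ≤-trans (≤-trans (≤-trans (m≤m+n small₂ small₃) (m≤n+m _ small₁)) (m≤n+m _ 3)) large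

    large₃ : small₃ ≤ n
    large₃ = ≤-trans (≤-trans (≤-trans (m≤n+m small₃ small₂) (m≤n+m _ small₁)) (m≤n+m _ 3)) large

    noConn : (S : Stage₃ stageSize) → NoConn (Stage₃.E₁ S) (Stage₃.E₂ S)
    noConn S = Connector.connector na₁₂ (Cyclic.r₁₂ cyclic) (Cyclic.b₁₂ cyclic)
      (≤-trans (m≤m+n (5 + (2 + connSize)) structSize) size₁) (≤-trans (m≤m+n (5 + (2 + connSize)) structSize) size₂) large₃
      where open Stage₃ S

    threeStage : Stage₃ stageSize → ⊥
    threeStage S = noTriple
      (record { cyclic = cyclic ; nc₁₂ = noConn S ; nc₂₃ = noConn (rotate₃ S) ; nc₃₁ = noConn (rotate₃ (rotate₃ S)) })
      (≤-trans (m≤n+m structSize (5 + (2 + connSize))) size₁) (≤-trans (m≤n+m structSize (5 + (2 + connSize))) size₂) (≤-trans (m≤n+m structSize (5 + (2 + connSize))) size₃)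
      where open Stage₃ S

    noIndep₃ : ∀ Us → length Us ≡ 3 → Indep k₃ Us → ⊥
    noIndep₃ (_ ∷ _ ∷ _ ∷ []) refl i = threeStage (indep₃ stageSize i)

    noIndep₂ : ∀ Us → length Us ≡ 2 → Indep k₂ Us → ⊥
    noIndep₂ (_ ∷ _ ∷ []) refl i = twoStage k₃
      (≤-trans (≤-trans (s≤s (s≤s z≤n)) (≤-homSize (4 + stageSize))) (≤-trans (≤-homSize _) (≤-homSize _)))
      noIndep₃ (indep₂ ℓ₂ i) large₂

    upper : ⊥
    upper = oneStage k₂ (≤-trans (s≤s (s≤s z≤n)) (≤-homSize (4 + ℓ₂))) noIndep₂ large₁

-- Deciding whether a copy exists

module Decide {N : ℕ} (c : Colouring N) where
  open Colour c

  -- The upper bound is argued by contradiction, while `Arrows` demands an actual copy; exhaustive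
  -- search bridges the two.
  searchLists : ∀ k {P : List V → Set} → (∀ l → Dec (P l)) → Dec (∃ λ l → length l ≡ k × P l)
  searchLists zero P? = map′ (λ p → [] , refl , p) (λ { ([] , refl , p) → p }) (P? [])
  searchLists (suc k) P? = map′ (λ { (x , l , e , p) → x ∷ l , cong suc e , p }) (λ { (x ∷ l , refl , p) → x , l , refl , p })
    (FinP.any? (λ x → searchLists k (λ l → P? (x ∷ l))))

  unique? : ∀ l → Dec (Unique {A = V} l)
  unique? = Pairs.allPairs? (λ x y → ¬? (x FinP.≟ y))

  redPath? : ∀ l → Dec (RedPath l)
  redPath? (x ∷ y ∷ z ∷ l) = (col c x y z ≟ᵇ true) ×-dec redPath? (y ∷ z ∷ l)
  redPath? [] = yes tt
  redPath? (_ ∷ []) = yes tt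
  redPath? (_ ∷ _ ∷ []) = yes tt

  BlueFano : List V → Set
  BlueFano (p₀ ∷ p₁ ∷ p₂ ∷ p₃ ∷ p₄ ∷ p₅ ∷ p₆ ∷ []) =
    col c p₀ p₁ p₂ ≡ false × col c p₀ p₃ p₄ ≡ false × col c p₀ p₅ p₆ ≡ false × col c p₁ p₃ p₅ ≡ false ×
    col c p₁ p₄ p₆ ≡ false × col c p₂ p₃ p₆ ≡ false × col c p₂ p₄ p₅ ≡ false
  BlueFano _ = ⊥

  blueFano? : ∀ l → Dec (BlueFano l)
  blueFano? (p₀ ∷ p₁ ∷ p₂ ∷ p₃ ∷ p₄ ∷ p₅ ∷ p₆ ∷ []) =
    (col c p₀ p₁ p₂ ≟ᵇ false) ×-dec (col c p₀ p₃ p₄ ≟ᵇ false) ×-dec (col c p₀ p₅ p₆ ≟ᵇ false) ×-dec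
    (col c p₁ p₃ p₅ ≟ᵇ false) ×-dec (col c p₁ p₄ p₆ ≟ᵇ false) ×-dec (col c p₂ p₃ p₆ ≟ᵇ false) ×-dec (col c p₂ p₄ p₅ ≟ᵇ false)
  blueFano? [] = no λ ()
  blueFano? (_ ∷ []) = no λ ()
  blueFano? (_ ∷ _ ∷ []) = no λ ()
  blueFano? (_ ∷ _ ∷ _ ∷ []) = no λ ()
  blueFano? (_ ∷ _ ∷ _ ∷ _ ∷ []) = no λ ()
  blueFano? (_ ∷ _ ∷ _ ∷ _ ∷ _ ∷ []) = no λ ()
  blueFano? (_ ∷ _ ∷ _ ∷ _ ∷ _ ∷ _ ∷ []) = no λ ()
  blueFano? (_ ∷ _ ∷ _ ∷ _ ∷ _ ∷ _ ∷ _ ∷ _ ∷ _) = no λ ()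

  fanoCopy : ∀ l → length l ≡ 7 → Unique l × BlueFano l → FanoCopy c blue
  fanoCopy l@(_ ∷ _ ∷ _ ∷ _ ∷ _ ∷ _ ∷ _ ∷ []) refl (u , b₁ , b₂ , b₃ , b₄ , b₅ , b₆ , b₇) =
    lookup l , (λ {i} {j} → lookup-injective u i j) , λ where
      _ _ _ e₁ → b₁
      _ _ _ e₂ → b₂
      _ _ _ e₃ → b₃
      _ _ _ e₄ → b₄
      _ _ _ e₅ → b₅
      _ _ _ e₆ → b₆
      _ _ _ e₇ → b₇

  fanoList : FanoCopy c blue → ∃ λ l → length l ≡ 7 × Unique l × BlueFano l
  fanoList (f , inj , e) = tabulate f , refl , Uniq.tabulate⁺ inj ,
    e _ _ _ e₁ , e _ _ _ e₂ , e _ _ _ e₃ , e _ _ _ e₄ , e _ _ _ e₅ , e _ _ _ e₆ , e _ _ _ e₇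

  path-lookup : ∀ l → RedPath l → ∀ i j k → toℕ j ≡ suc (toℕ i) → toℕ k ≡ suc (toℕ j) →
    col c (lookup l i) (lookup l j) (lookup l k) ≡ true
  path-lookup (x ∷ y ∷ z ∷ l) (r , _) zero (suc zero) (suc (suc zero)) refl refl = r
  path-lookup (x ∷ y ∷ []) _ zero (suc zero) (suc zero) _ ()
  path-lookup (x ∷ l) p (suc i) (suc j) (suc k) e e′ =
    path-lookup l (path-tail x l p) i j k (suc-injective e) (suc-injective e′)

  pathCopy : ∀ {n} → (∃ λ l → length l ≡ n × Unique l × RedPath l) → TightPathCopy c red n
  pathCopy (l , refl , u , p) = lookup l , (λ {i} {j} → lookup-injective u i j) , path-lookup l p

-- The lower bound

sameSide : Bool → Bool → Bool → Bool
sameSide true true true = true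
sameSide false false false = true
sameSide _ _ _ = false

sameSide₁₂ : ∀ a b d → sameSide a b d ≡ sameSide b a d
sameSide₁₂ true true d = refl
sameSide₁₂ true false d = refl
sameSide₁₂ false true d = refl
sameSide₁₂ false false d = refl

sameSide₂₃ : ∀ a b d → sameSide a b d ≡ sameSide a d b
sameSide₂₃ true true true = refl
sameSide₂₃ true true false = refl
sameSide₂₃ true false true = refl
sameSide₂₃ true false false = refl
sameSide₂₃ false true true = refl
sameSide₂₃ false true false = refl
sameSide₂₃ false false true = refl
sameSide₂₃ false false false = refl

sameSide-≡ : ∀ a b d → sameSide a b d ≡ true → b ≡ a × d ≡ a
sameSide-≡ true true true _ = refl , refl
sameSide-≡ false false false _ = refl , refl

-- In each clause the absurd pattern marks a line that is monochromatic.
fano-not-2-colourable : ∀ b₀ b₁ b₂ b₃ b₄ b₅ b₆ →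
  sameSide b₀ b₁ b₂ ≡ false → sameSide b₀ b₃ b₄ ≡ false → sameSide b₀ b₅ b₆ ≡ false → sameSide b₁ b₃ b₅ ≡ false →
  sameSide b₁ b₄ b₆ ≡ false → sameSide b₂ b₃ b₆ ≡ false → sameSide b₂ b₄ b₅ ≡ false → ⊥
fano-not-2-colourable true true true _ _ _ _ ()
fano-not-2-colourable true true false true true _ _ _ ()
fano-not-2-colourable true true false true false true _ _ _ _ ()
fano-not-2-colourable true true false true false false _ _ _ _ _ _ _ ()
fano-not-2-colourable true true false false true true true _ _ ()
fano-not-2-colourable true true false false true true false _ _ _ _ _ ()
fano-not-2-colourable true true false false true false true _ _ _ _ ()
fano-not-2-colourable true true false false true false false _ _ _ _ _ ()
fano-not-2-colourable true true false false false true true _ _ ()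
fano-not-2-colourable true true false false false true false _ _ _ _ _ ()
fano-not-2-colourable true true false false false false _ _ _ _ _ _ _ ()
fano-not-2-colourable true false true true true _ _ _ ()
fano-not-2-colourable true false true true false true true _ _ ()
fano-not-2-colourable true false true true false true false _ _ _ _ ()
fano-not-2-colourable true false true true false false true _ _ _ _ _ ()
fano-not-2-colourable true false true true false false false _ _ _ _ ()
fano-not-2-colourable true false true false true true _ _ _ _ _ _ _ ()
fano-not-2-colourable true false true false true false _ _ _ _ ()
fano-not-2-colourable true false true false false true true _ _ ()
fano-not-2-colourable true false true false false true false _ _ _ _ ()
fano-not-2-colourable true false true false false false _ _ _ _ ()
fano-not-2-colourable true false false true true _ _ _ ()
fano-not-2-colourable true false false true false true true _ _ ()
fano-not-2-colourable true false false true false true false _ _ _ _ ()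
fano-not-2-colourable true false false true false false _ _ _ _ _ _ _ ()
fano-not-2-colourable true false false false true true true _ _ ()
fano-not-2-colourable true false false false true true false _ _ _ _ _ ()
fano-not-2-colourable true false false false true false _ _ _ _ ()
fano-not-2-colourable true false false false false true true _ _ ()
fano-not-2-colourable true false false false false true false _ _ _ _ ()
fano-not-2-colourable true false false false false false _ _ _ _ ()
fano-not-2-colourable false true true true true true _ _ _ _ ()
fano-not-2-colourable false true true true true false true _ _ _ _ ()
fano-not-2-colourable false true true true true false false _ _ ()
fano-not-2-colourable false true true true false true _ _ _ _ ()
fano-not-2-colourable false true true true false false true _ _ _ _ _ ()
fano-not-2-colourable false true true true false false false _ _ ()
fano-not-2-colourable false true true false true true _ _ _ _ _ _ _ ()
fano-not-2-colourable false true true false true false true _ _ _ _ ()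
fano-not-2-colourable false true true false true false false _ _ ()
fano-not-2-colourable false true true false false _ _ _ ()
fano-not-2-colourable false true false true true true _ _ _ _ ()
fano-not-2-colourable false true false true true false true _ _ _ _ ()
fano-not-2-colourable false true false true true false false _ _ ()
fano-not-2-colourable false true false true false true _ _ _ _ ()
fano-not-2-colourable false true false true false false _ _ _ _ _ _ _ ()
fano-not-2-colourable false true false false true true true _ _ _ _ ()
fano-not-2-colourable false true false false true true false _ _ _ _ _ ()
fano-not-2-colourable false true false false true false true _ _ _ _ ()
fano-not-2-colourable false true false false true false false _ _ ()
fano-not-2-colourable false true false false false _ _ _ ()
fano-not-2-colourable false false true true true true _ _ _ _ _ _ _ ()
fano-not-2-colourable false false true true true false true _ _ _ _ _ ()
fano-not-2-colourable false false true true true false false _ _ ()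
fano-not-2-colourable false false true true false true true _ _ _ _ _ ()
fano-not-2-colourable false false true true false true false _ _ _ _ ()
fano-not-2-colourable false false true true false false true _ _ _ _ _ ()
fano-not-2-colourable false false true true false false false _ _ ()
fano-not-2-colourable false false true false true true _ _ _ _ _ _ _ ()
fano-not-2-colourable false false true false true false _ _ _ _ ()
fano-not-2-colourable false false true false false _ _ _ ()
fano-not-2-colourable false false false _ _ _ _ ()

module Lower (m : ℕ) {M : ℕ} (M≤ : M ≤ (2 + m) + (2 + m)) where

  side : Fin M → Bool
  side x = toℕ x <ᵇ 2 + m

  halvesColouring : Colouring M
  halvesColouring = record
    { col = λ x y z → sameSide (side x) (side y) (side z)
    ; sym₁₂ = λ x y z → sameSide₁₂ (side x) (side y) (side z)
    ; sym₂₃ = λ x y z → sameSide₂₃ (side x) (side y) (side z) }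

  noFanoCopy : ¬ FanoCopy halvesColouring blue
  noFanoCopy (f , _ , e) = fano-not-2-colourable (s (# 0)) (s (# 1)) (s (# 2)) (s (# 3)) (s (# 4)) (s (# 5)) (s (# 6))
    (e _ _ _ e₁) (e _ _ _ e₂) (e _ _ _ e₃) (e _ _ _ e₄) (e _ _ _ e₅) (e _ _ _ e₆) (e _ _ _ e₇)
    where
    s : Fin 7 → Bool
    s i = side (f i)

  -- Consecutive edges overlap, so a red path stays on the side of its first vertex, and a side has
  -- at most 2 + m = n - 1 vertices.
  noPathCopy : ¬ TightPathCopy halvesColouring red (3 + m)
  noPathCopy (v , inj , e) = clash (side (v zero)) refl
    where
    step : ∀ j (l₁ : j < 3 + m) (l₂ : suc j < 3 + m) (l₃ : 2 + j < 3 + m) →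
      side (v (fromℕ< l₂)) ≡ side (v (fromℕ< l₁)) × side (v (fromℕ< l₃)) ≡ side (v (fromℕ< l₁))
    step j l₁ l₂ l₃ = sameSide-≡ _ _ _ (e (fromℕ< l₁) (fromℕ< l₂) (fromℕ< l₃)
      (trans (FinP.toℕ-fromℕ< l₂) (cong suc (sym (FinP.toℕ-fromℕ< l₁))))
      (trans (FinP.toℕ-fromℕ< l₃) (cong suc (sym (FinP.toℕ-fromℕ< l₂)))))
    same : ∀ j (l : j < 3 + m) → side (v (fromℕ< l)) ≡ side (v zero)
    same zero l = refl
    same (suc zero) l = proj₁ (step 0 (s≤s z≤n) l (s≤s (s≤s (s≤s z≤n))))
    same (suc (suc zero)) l = proj₂ (step 0 (s≤s z≤n) (s≤s (s≤s z≤n)) l)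
    same (suc (suc (suc j))) l = let l₁ = ≤-trans (n≤1+n _) (≤-trans (n≤1+n _) l) in
      trans (proj₂ (step (suc j) l₁ (≤-trans (n≤1+n _) l) l)) (same (suc j) l₁)
    all : ∀ i → side (v i) ≡ side (v zero)
    all i = trans (cong (λ k → side (v k)) (sym (FinP.fromℕ<-toℕ i (FinP.toℕ<n i)))) (same (toℕ i) (FinP.toℕ<n i))
    injected : (g : Fin (3 + m) → ℕ) → (∀ i → g i < 2 + m) → (∀ {i j} → g i ≡ g j → toℕ (v i) ≡ toℕ (v j)) → ⊥
    injected g lt g-inj with i , j , i<j , eq ← FinP.pigeonhole ≤-refl (λ i → fromℕ< (lt i)) =
      <-irrefl (cong toℕ (inj (FinP.toℕ-injective (g-inj
        (trans (sym (FinP.toℕ-fromℕ< (lt i))) (trans (cong toℕ eq) (FinP.toℕ-fromℕ< (lt j)))))))) i<j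
    clash : ∀ b → side (v zero) ≡ b → ⊥
    clash true e₀ = injected (λ i → toℕ (v i)) (λ i → <ᵇ⇒< _ _ (subst Bool.T (sym (trans (all i) e₀)) tt)) (λ q → q)
    -- The second side has at most 2 + m vertices by `M≤`; subtracting 2 + m keeps them distinct
    -- because all lie above that bound.
    clash false e₀ = injected (λ i → toℕ (v i) ∸ (2 + m))
      (λ i → +-cancelʳ-< (2 + m) _ _ (≤-trans (≤-reflexive (cong suc (m∸n+n≡m (above i)))) (≤-trans (FinP.toℕ<n (v i)) M≤)))
      (λ {i} {j} q → trans (sym (m∸n+n≡m (above i))) (trans (cong (_+ (2 + m)) q) (m∸n+n≡m (above j))))
      where
      above : ∀ i → 2 + m ≤ toℕ (v i)
      above i = ≮⇒≥ (λ lt → subst Bool.T (trans (all i) e₀) (<⇒<ᵇ lt))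

-- The two bounds combined

upperBound : ∀ n → threshold ≤ n → Arrows n (2 * n ∸ 1)
upperBound zero ()
upperBound n@(suc k) le c
  with searchLists n (λ l → unique? l ×-dec redPath? l) | searchLists 7 (λ l → unique? l ×-dec blueFano? l)
  where open Decide c
... | yes p | _ = inj₁ (Decide.pathCopy c p)
... | no _ | yes (l , e , p) = inj₂ (Decide.fanoCopy c l e p)
... | no noPath | no noFano = ⊥-elim (Upper.upper c (λ f → noFano (Decide.fanoList c f)) size shortPath le)
  where
  size : suc (2 * n ∸ 1) ≡ n + n
  size = cong (n +_) (+-identityʳ n)
  shortPath : ∀ Q → Unique Q → Colour.RedPath c Q → length Q < n
  -- The first n vertices of a longer red path would already be a copy.
  shortPath Q u r = ≰⇒> λ l → noPath (take n Q , trans (length-take n Q) (m≤n⇒m⊓n≡m l) , Uniq.take⁺ n u ,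
    Colour.path-++ˡ c (take n Q) (subst (Colour.RedPath c) (sym (take++drop≡id n Q)) r))

lowerBound : ∀ n → threshold ≤ n → ∀ M → M < 2 * n ∸ 1 → ¬ Arrows n M
lowerBound (suc (suc (suc m))) (s≤s (s≤s (s≤s _))) M lt arrows =
  [ Lower.noPathCopy m M≤ , Lower.noFanoCopy m M≤ ] (arrows (Lower.halvesColouring m M≤))
  where
  M≤ : M ≤ (2 + m) + (2 + m)
  M≤ = ≤-trans (≤-pred (≤-trans lt (≤-reflexive (+-suc (2 + m) _)))) (≤-reflexive (cong ((2 + m) +_) (+-identityʳ (2 + m))))

theorem1 : Σ ℕ λ n₀ → (n : ℕ) → n₀ ≤ n → RamseyPathFano≡ n (2 * n ∸ 1)
theorem1 = threshold , λ n le → upperBound n le , lowerBound n le
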